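{- Let $\mathbb{K}\in\{\mathbb{R},\mathbb{C}\}$ and suppose that $T=\sum_{i=1}^r a_{i1}^2a_{i2}\in S^3(\mathbb{K}^n)$, where for each $i$ the vectors $a_{i1},a_{i2}\in\mathbb{K}^n$ are linearly independent, and the spaces $\langle a_{i1},a_{i2}\rangle$, $i=1,\dots,r$, are in direct sum with $\mathbb{K}^n=\bigoplus_{i=1}^r\langle a_{i1},a_{i2}\rangle$. Then this is the unique minimal decomposition of $T$ into W-tensors, and the following algorithm, with input $T$, produces the terms $a_{i1}^2a_{i2}$, $i=1,\dots,r$: (1) Sample generic $f,g,\ell\in\mathbb{K}^n$. (2) Find the solutions $\lambda_i,x_i$ to $\det(T_f-\lambda T_g)=0$ (generalized eigenvalues and eigenvectors). (3) Let $a_{i1}'=T_fx_i$, and let $b_i$ be a vector that is perpendicular to all $a_{j1}'$ for $j\neq i$ and satisfies $\langle b_i,a_{i1}'\rangle=1$. Compute $v_i=((b_i^T)^{\otimes 2}\otimes I)T$ and let $U_i=\langle a_{i1}',v_i\rangle$. (4) Let $\Pi_i$ be the matrix for which $\Pi_i|_{U_i}=I_{U_i}$ and $\Pi_i|_{U_j}=0$ for $j\neq i$. (5) Solve the linear system $\Pi_iT_fg=\big((a_{i1}')^2(\alpha a_{i1}'+\beta v_i)\big)_f\,g$ for the scalars $\alpha$ and $\beta$. Let $a_{i2}'=\alpha a_{i1}'+\beta v_i$, so that $a_{i1}^2a_{i2}=(a_{i1}')^2a_{i2}'$. (6) Output $\{(a_{i1}')^2a_{i2}' : i=1,\dots,r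\}$.
   Context: For vectors $v_1,v_2,v_3$ write $v_1v_2v_3:=\frac{1}{3!}\sum_{\sigma\in\mathfrak{S}_3}v_{\sigma(1)}\otimes v_{\sigma(2)}\otimes v_{\sigma(3)}$ and $v^2w:=vvw$. A W-tensor in $S^3(\mathbb{K}^n)$ is a tensor $a^2b$ with $a,b\in\mathbb{K}^n$ linearly independent (an element of the orbit $\mathrm{GL}_n\,e_1^2e_2$). A decomposition of $T$ into W-tensors is minimal if it has the smallest possible number of terms; uniqueness refers to the set of terms. For a symmetric $3$-tensor $S$ and a vector $f$, $S_f=(f^T\otimes I\otimes I)S$ is the contraction along the first index, regarded as an $n\times n$ matrix. A generalized eigenvector for a solution $\lambda$ of $\det(T_f-\lambda T_g)=0$ is a nonzero $x\in\mathbb{C}^n$ with $(T_f-\lambda T_g)x=0$; in step (2), one eigenvector $x_i$ is taken for each distinct generalized eigenvalue $\lambda_i$. Orthogonality is with respect to the bilinear pairing $\langle a,b\rangle=a^Tb$, and $\langle\cdot\rangle$ also denotes linear span. "Generic" means outside some proper Zariski closed subset. Algorithmic operations are carried out over $\mathbb{C}$, even if $\mathbb{K}=\mathbb{R}$. The labeling of the indices in the output is arbitrary. -}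

module Defs where

open import Algebra.Bundles using (CommutativeRing)
import Algebra.Bundles as Bundles
import Algebra.Construct.DirectProduct as DirectProduct
import Algebra.Properties.Ring as RingProperties
import Algebra.Properties.Semiring.Exp as Exp
import Algebra.Properties.Semiring.Sum as Sum
import Algebra.Solver.Ring.NaturalCoefficients.Default as NatSolver
open import Data.Fin.Base using (Fin; zero; suc; toℕ)
open import Data.Fin.Patterns using (0F; 1F; 2F)
open import Data.List.Base using (List)
open import Data.List.Relation.Unary.All using (All)
open import Data.Nat.Base as ℕ using (ℕ; zero; suc)
open import Data.Product using (∃; ∃₂; ∃!; ∃-syntax; _×_; _,_; proj₁; proj₂)
open import Data.Product.Relation.Binary.Pointwise.NonDependent using (×-decidable)
open import Data.Sum.Base using (inj₁; inj₂)
open import Data.Vec.Functional using (Vector; []; _∷_; removeAt)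
open import Function.Bundles using (_⇔_)
open import Level using (0ℓ)
open import Relation.Binary.Core using (Rel)
open import Relation.Binary.Definitions using (Decidable)
open import Relation.Binary.PropositionalEquality using (_≡_; _≢_)
open import Relation.Binary.Structures using (IsDecTotalOrder)
open import Relation.Nullary using (¬_; yes; no)
open import Relation.Unary using (Pred; _∈_; _∉_; _≐_; Satisfiable)

record Field : Set₁ where
  field
    commutativeRing : CommutativeRing 0ℓ 0ℓ
  open CommutativeRing commutativeRing public
  infix 4 _≟_
  field
    _≟_     : Decidable _≈_
    1≉0     : 1# ≉ 0#
    inverse : ∀ x → x ≉ 0# → ∃ λ y → x * y ≈ 1#

  infix 9 _⁻¹

  -- Made total by 0 ⁻¹ = 0.
  _⁻¹ : Carrier → Carrier
  x ⁻¹ with x ≟ 0#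
  ... | yes _   = 0#
  ... | no  x≉0 = proj₁ (inverse x x≉0)

-- The (classical) real numbers: a Dedekind-complete ordered field, which is
-- unique up to isomorphism. Decidability of equality and of the order, and
-- suprema of arbitrary subsets, are the classical properties of ℝ; they are
-- part of the structure because the ambient logic is constructive.

record RealNumbers : Set₁ where
  field
    real-field : Field
  open Field real-field public
  infix 4 _≤_
  field
    _≤_             : Rel Carrier 0ℓ
    isDecTotalOrder : IsDecTotalOrder _≈_ _≤_
    +-monoˡ-≤       : ∀ {x y} z → x ≤ y → x + z ≤ y + z
    *-nonNegative   : ∀ {x y} → 0# ≤ x → 0# ≤ y → 0# ≤ x * y

  UpperBound : Pred Carrier 0ℓ → Pred Carrier 0ℓ
  UpperBound S b = ∀ x → x ∈ S → x ≤ b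

  field
    supremum : ∀ (S : Pred Carrier 0ℓ) → Satisfiable S → Satisfiable (UpperBound S) →
               ∃ λ s → s ∈ UpperBound S × (∀ b → b ∈ UpperBound S → s ≤ b)

-- ℂ = ℝ², as pairs (real part , imaginary part).

module Complex (ℝ : RealNumbers) where
  open RealNumbers ℝ
  open IsDecTotalOrder isDecTotalOrder using (total; antisym; ≤-respˡ-≈; ≤-respʳ-≈)
  open RingProperties ring using (-1*x≈-x; -‿distribʳ-*; -‿distribˡ-*; -‿involutive)
  private module +² = Bundles.AbelianGroup (DirectProduct.abelianGroup +-abelianGroup +-abelianGroup)

  ℂ-Carrier : Set
  ℂ-Carrier = Carrier × Carrier

  infixl 7 _*ᶜ_
  _*ᶜ_ : ℂ-Carrier → ℂ-Carrier → ℂ-Carrier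
  (a , b) *ᶜ (c , d) = a * c - b * d , a * d + b * c

  private
    infix 4 _≈ᶜ_
    _≈ᶜ_ : Rel ℂ-Carrier 0ℓ
    _≈ᶜ_ = +²._≈_

    -- The multiplication with the sign as a factor, for the semiring solver.
    mul : Carrier → ℂ-Carrier → ℂ-Carrier → ℂ-Carrier
    mul J (a , b) (c , d) = a * c + J * (b * d) , a * d + b * c

    *≈mul : ∀ z w → z *ᶜ w ≈ᶜ mul (- 1#) z w
    *≈mul (a , b) (c , d) = +-congˡ (sym (-1*x≈-x (b * d))) , refl

    mul-cong : ∀ J {z z′ w w′} → z ≈ᶜ z′ → w ≈ᶜ w′ → mul J z w ≈ᶜ mul J z′ w′
    mul-cong J (p , q) (s , t) =
      +-cong (*-cong p s) (*-congˡ (*-cong q t)) , +-cong (*-cong p t) (*-cong q s)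

    open NatSolver commutativeSemiring

    mul-assoc : ∀ J x y z → mul J (mul J x y) z ≈ᶜ mul J x (mul J y z)
    mul-assoc J (a , b) (c , d) (e , f) =
      solve 7 (λ J a b c d e f →
          (a :* c :+ J :* (b :* d)) :* e :+ J :* ((a :* d :+ b :* c) :* f)
        := a :* (c :* e :+ J :* (d :* f)) :+ J :* (b :* (c :* f :+ d :* e))) refl J a b c d e f ,
      solve 7 (λ J a b c d e f →
          (a :* c :+ J :* (b :* d)) :* f :+ (a :* d :+ b :* c) :* e
        := a :* (c :* f :+ d :* e) :+ b :* (c :* e :+ J :* (d :* f))) refl J a b c d e f

    mul-comm : ∀ J x y → mul J x y ≈ᶜ mul J y x
    mul-comm J (a , b) (c , d) =
      solve 5 (λ J a b c d → a :* c :+ J :* (b :* d) := c :* a :+ J :* (d :* b)) refl J a b c d ,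
      solve 4 (λ a b c d → a :* d :+ b :* c := c :* b :+ d :* a) refl a b c d

    mul-distribˡ : ∀ J x y z → mul J x ((y +².∙ z)) ≈ᶜ (mul J x y +².∙ mul J x z)
    mul-distribˡ J (a , b) (c , d) (e , f) =
      solve 7 (λ J a b c d e f →
          a :* (c :+ e) :+ J :* (b :* (d :+ f))
        := (a :* c :+ J :* (b :* d)) :+ (a :* e :+ J :* (b :* f))) refl J a b c d e f ,
      solve 6 (λ a b c d e f →
          a :* (d :+ f) :+ b :* (c :+ e)
        := (a :* d :+ b :* c) :+ (a :* f :+ b :* e)) refl a b c d e f

    mul-identityˡ : ∀ J z → mul J (1# , 0#) z ≈ᶜ z
    mul-identityˡ J (a , b) =
      trans (+-cong (*-identityˡ a) (trans (*-congˡ (zeroˡ b)) (zeroʳ J))) (+-identityʳ a) ,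
      trans (+-cong (*-identityˡ b) (zeroˡ a)) (+-identityʳ b)

    J₀ : Carrier
    J₀ = - 1#

    *ᶜ-cong : ∀ {z z′ w w′} → z ≈ᶜ z′ → w ≈ᶜ w′ → z *ᶜ w ≈ᶜ z′ *ᶜ w′
    *ᶜ-cong {z} {z′} {w} {w′} p q =
      +².trans (*≈mul z w) (+².trans (mul-cong J₀ p q) (+².sym (*≈mul z′ w′)))

    *ᶜ-assoc : ∀ x y z → (x *ᶜ y) *ᶜ z ≈ᶜ x *ᶜ (y *ᶜ z)
    *ᶜ-assoc x y z =
      +².trans (*ᶜ-cong (*≈mul x y) +².refl) (+².trans (*≈mul (mul J₀ x y) z)
        (+².trans (mul-assoc J₀ x y z)
          (+².sym (+².trans (*ᶜ-cong {x} +².refl (*≈mul y z)) (*≈mul x (mul J₀ y z))))))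

    *ᶜ-comm : ∀ x y → x *ᶜ y ≈ᶜ y *ᶜ x
    *ᶜ-comm x y = +².trans (*≈mul x y) (+².trans (mul-comm J₀ x y) (+².sym (*≈mul y x)))

    *ᶜ-identityˡ : ∀ z → (1# , 0#) *ᶜ z ≈ᶜ z
    *ᶜ-identityˡ z = +².trans (*≈mul (1# , 0#) z) (mul-identityˡ J₀ z)

    *ᶜ-distribˡ : ∀ x y z → x *ᶜ (y +².∙ z) ≈ᶜ (x *ᶜ y) +².∙ (x *ᶜ z)
    *ᶜ-distribˡ x y z = +².trans (*≈mul x (y +².∙ z))
      (+².trans (mul-distribˡ J₀ x y z) (+².sym (+².∙-cong (*≈mul x y) (*≈mul x z))))

    *ᶜ-identityʳ : ∀ z → z *ᶜ (1# , 0#) ≈ᶜ z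
    *ᶜ-identityʳ z = +².trans (*ᶜ-comm z (1# , 0#)) (*ᶜ-identityˡ z)

    *ᶜ-distribʳ : ∀ x y z → (y +².∙ z) *ᶜ x ≈ᶜ (y *ᶜ x) +².∙ (z *ᶜ x)
    *ᶜ-distribʳ x y z = +².trans (*ᶜ-comm (y +².∙ z) x)
      (+².trans (*ᶜ-distribˡ x y z) (+².∙-cong (*ᶜ-comm x y) (*ᶜ-comm x z)))

  ℂ-commutativeRing : CommutativeRing 0ℓ 0ℓ
  ℂ-commutativeRing = record
    { Carrier = ℂ-Carrier
    ; _≈_ = _≈ᶜ_
    ; _+_ = +²._∙_
    ; _*_ = _*ᶜ_
    ; -_ = +²._⁻¹
    ; 0# = 0# , 0#
    ; 1# = 1# , 0#
    ; isCommutativeRing = record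
      { isRing = record
        { +-isAbelianGroup = +².isAbelianGroup
        ; *-cong = *ᶜ-cong
        ; *-assoc = *ᶜ-assoc
        ; *-identity = *ᶜ-identityˡ , *ᶜ-identityʳ
        ; distrib = *ᶜ-distribˡ , *ᶜ-distribʳ
        }
      ; *-comm = *ᶜ-comm
      }
    }

  private
    0≤x² : ∀ x → 0# ≤ x * x
    0≤x² x with total 0# x
    ... | inj₁ 0≤x = *-nonNegative 0≤x 0≤x
    ... | inj₂ x≤0 = ≤-respʳ-≈ -x*-x≈x*x (*-nonNegative 0≤-x 0≤-x)
      where
      -x*-x≈x*x : - x * - x ≈ x * x
      -x*-x≈x*x = trans (sym (-‿distribˡ-* x (- x)))
                    (trans (-‿cong (sym (-‿distribʳ-* x x))) (-‿involutive (x * x)))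
      0≤-x : 0# ≤ - x
      0≤-x = ≤-respˡ-≈ (-‿inverseʳ x) (≤-respʳ-≈ (+-identityˡ (- x)) (+-monoˡ-≤ (- x) x≤0))

    x²≈0⇒x≈0 : ∀ x → x * x ≈ 0# → x ≈ 0#
    x²≈0⇒x≈0 x x²≈0 with x ≟ 0#
    ... | yes x≈0 = x≈0
    ... | no  x≉0 with inverse x x≉0
    ... | y , xy≈1 = trans (sym (*-identityʳ x)) (trans (*-congˡ (sym xy≈1))
                       (trans (sym (*-assoc x x y)) (trans (*-congʳ x²≈0) (zeroˡ y))))

    x²+y²≈0⇒x≈0 : ∀ x y → x * x + y * y ≈ 0# → x ≈ 0#
    x²+y²≈0⇒x≈0 x y eq = x²≈0⇒x≈0 x (antisym x²≤0 (0≤x² x))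
      where
      x²≤0 : x * x ≤ 0#
      x²≤0 = ≤-respˡ-≈ (+-identityˡ (x * x))
               (≤-respʳ-≈ (trans (+-comm (y * y) (x * x)) eq) (+-monoˡ-≤ (x * x) (0≤x² y)))

    normSq≉0 : ∀ {a b} → ¬ ((a , b) ≈ᶜ (0# , 0#)) → a * a + b * b ≉ 0#
    normSq≉0 {a} {b} z≉0 eq =
      z≉0 (x²+y²≈0⇒x≈0 a b eq , x²+y²≈0⇒x≈0 b a (trans (+-comm (b * b) (a * a)) eq))

  ℂ-inverse : ∀ z → ¬ (z ≈ᶜ (0# , 0#)) → ∃ λ w → z *ᶜ w ≈ᶜ (1# , 0#)
  ℂ-inverse (a , b) z≉0 with inverse (a * a + b * b) (normSq≉0 z≉0)
  ... | N⁻¹ , NN⁻¹≈1 = (a * N⁻¹ , - (b * N⁻¹)) , re , im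
    where
    re : a * (a * N⁻¹) - b * - (b * N⁻¹) ≈ 1#
    re = trans (+-cong (sym (*-assoc a a N⁻¹))
                 (trans (-‿cong (sym (-‿distribʳ-* b (b * N⁻¹))))
                   (trans (-‿involutive (b * (b * N⁻¹))) (sym (*-assoc b b N⁻¹)))))
           (trans (sym (distribʳ N⁻¹ (a * a) (b * b))) NN⁻¹≈1)
    im : a * - (b * N⁻¹) + b * (a * N⁻¹) ≈ 0#
    im = trans (+-cong (sym (-‿distribʳ-* a (b * N⁻¹)))
                 (trans (sym (*-assoc b a N⁻¹))
                   (trans (*-congʳ (*-comm b a)) (*-assoc a b N⁻¹))))
           (-‿inverseˡ (a * (b * N⁻¹)))

  ℂ-field : Field
  ℂ-field = record
    { commutativeRing = ℂ-commutativeRing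
    ; _≟_ = ×-decidable _≟_ _≟_
    ; 1≉0 = λ eq → 1≉0 (proj₁ eq)
    ; inverse = ℂ-inverse
    }

-- 𝕂 ∈ {ℝ, ℂ}

data Scalars : Set where
  real complex : Scalars

module _ (ℝ : RealNumbers) where
  open RealNumbers ℝ using (real-field; 0#)
  open Complex ℝ using (ℂ-field)

  scalarField : Scalars → Field
  scalarField real    = real-field
  scalarField complex = ℂ-field

  toℂ : (k : Scalars) → Field.Carrier (scalarField k) → Field.Carrier ℂ-field
  toℂ real    x = x , 0#
  toℂ complex z = z

module LinearAlgebra (F : Field) where
  open Field F hiding (zero)
  open Sum semiring public using (sum-syntax)
  open Exp semiring using (_^_)

  V : ℕ → Set
  V n = Vector Carrier n

  Matrix : ℕ → Set
  Matrix n = Fin n → Fin n → Carrier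

  Tensor : ℕ → Set
  Tensor n = Fin n → Fin n → Fin n → Carrier

  infix 4 _≈ᵛ_ _≈ᴹ_ _≈ᵀ_
  _≈ᵛ_ : ∀ {n} → Rel (V n) 0ℓ
  u ≈ᵛ v = ∀ i → u i ≈ v i

  _≈ᴹ_ : ∀ {n} → Rel (Matrix n) 0ℓ
  A ≈ᴹ B = ∀ i j → A i j ≈ B i j

  _≈ᵀ_ : ∀ {n} → Rel (Tensor n) 0ℓ
  S ≈ᵀ T = ∀ i j k → S i j k ≈ T i j k

  0ᵛ : ∀ {n} → V n
  0ᵛ _ = 0#

  infixl 6 _+ᵛ_
  _+ᵛ_ : ∀ {n} → V n → V n → V n
  (u +ᵛ v) i = u i + v i

  infixr 7 _·ᵛ_
  _·ᵛ_ : ∀ {n} → Carrier → V n → V n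
  (c ·ᵛ v) i = c * v i

  ∑ᵛ : ∀ {n m} → Vector (V n) m → V n
  ∑ᵛ {m = m} u i = ∑[ s < m ] u s i

  ∑ᵀ : ∀ {n m} → Vector (Tensor n) m → Tensor n
  ∑ᵀ {m = m} T i j k = ∑[ s < m ] T s i j k

  LinearlyIndependent : ∀ {n m} → Vector (V n) m → Set
  LinearlyIndependent {m = m} v =
    ∀ (c : Vector Carrier m) → ∑ᵛ (λ s → c s ·ᵛ v s) ≈ᵛ 0ᵛ → ∀ s → c s ≈ 0#

  Span : ∀ {n m} → Vector (V n) m → Pred (V n) 0ℓ
  Span {m = m} v u = ∃ λ (c : Vector Carrier m) → u ≈ᵛ ∑ᵛ (λ s → c s ·ᵛ v s)

  ⟨_,_⟩ : ∀ {n} → V n → V n → Pred (V n) 0ℓ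
  ⟨ a , b ⟩ = Span (a ∷ b ∷ [])

  InDirectSum : ∀ {n m} → Vector (Pred (V n) 0ℓ) m → Set
  InDirectSum W = ∀ u → (∀ s → u s ∈ W s) → ∑ᵛ u ≈ᵛ 0ᵛ → ∀ s → u s ≈ᵛ 0ᵛ

  WholeSpaceIsSum : ∀ {n m} → Vector (Pred (V n) 0ℓ) m → Set
  WholeSpaceIsSum W = ∀ v → ∃ λ u → (∀ s → u s ∈ W s) × v ≈ᵛ ∑ᵛ u

  -- The bilinear (not Hermitian) pairing aᵀb.
  pairing : ∀ {n} → V n → V n → Carrier
  pairing {n} a b = ∑[ i < n ] (a i * b i)

  infixr 7 _·ᴹ_
  _·ᴹ_ : ∀ {n} → Matrix n → V n → V n
  _·ᴹ_ {n} A v i = ∑[ j < n ] (A i j * v j)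

  _-[_]_ : ∀ {n} → Matrix n → Carrier → Matrix n → Matrix n
  (A -[ μ ] B) i j = A i j - μ * B i j

  -- Laplace expansion along the first row.
  det : ∀ {n} → Matrix n → Carrier
  det {zero}  A = 1#
  det {suc n} A =
    ∑[ j < suc n ] ((- 1#) ^ toℕ j * A zero j * det (λ i → removeAt (A (suc i)) j))

  3! : Carrier
  3! = 1# + 1# + 1# + 1# + 1# + 1#

  -- v₁v₂v₃ = 1/3! ∑_{σ ∈ 𝔖₃} v_σ(1) ⊗ v_σ(2) ⊗ v_σ(3); 3! is nonzero in ℝ and ℂ.
  symProduct : ∀ {n} → V n → V n → V n → Tensor n
  symProduct u v w i j k = 3! ⁻¹ *
    ( u i * v j * w k + u i * w j * v k
    + v i * u j * w k + v i * w j * u k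
    + w i * u j * v k + w i * v j * u k )

  -- a²b
  _²⊙_ : ∀ {n} → V n → V n → Tensor n
  a ²⊙ b = symProduct a a b

  -- T_f = (fᵀ ⊗ I ⊗ I) T
  infixl 8 _⌟_
  _⌟_ : ∀ {n} → Tensor n → V n → Matrix n
  _⌟_ {n} T f j k = ∑[ i < n ] (f i * T i j k)

  -- ((bᵀ)^⊗2 ⊗ I) T
  contract₂ : ∀ {n} → V n → Tensor n → V n
  contract₂ {n} b T k = ∑[ i < n ] ∑[ j < n ] (b i * b j * T i j k)

module WTensors (F : Field) where
  open LinearAlgebra F

  IsWTensor : ∀ {n} → Pred (Tensor n) 0ℓ
  IsWTensor S = ∃₂ λ a b → LinearlyIndependent (a ∷ b ∷ []) × S ≈ᵀ a ²⊙ b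

  IsWDecomposition : ∀ {n r} → Tensor n → Vector (Tensor n) r → Set
  IsWDecomposition T t = (∀ i → IsWTensor (t i)) × T ≈ᵀ ∑ᵀ t

  IsMinimalWDecomposition : ∀ {n r} → Tensor n → Vector (Tensor n) r → Set
  IsMinimalWDecomposition {n} {r} T t =
    IsWDecomposition T t ×
    (∀ {s} (t′ : Vector (Tensor n) s) → IsWDecomposition T t′ → r ℕ.≤ s)

  Terms : ∀ {n r} → Vector (Tensor n) r → Pred (Tensor n) 0ℓ
  Terms t S = ∃ λ i → S ≈ᵀ t i

  IsUniqueMinimalWDecomposition : ∀ {n r} → Tensor n → Vector (Tensor n) r → Set
  IsUniqueMinimalWDecomposition {n} T t =
    IsMinimalWDecomposition T t ×
    (∀ {s} (t′ : Vector (Tensor n) s) → IsMinimalWDecomposition T t′ → Terms t′ ≐ Terms t)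

module Zariski (F : Field) where
  open Field F

  data Polynomial (X : Set) : Set where
    con       : Carrier → Polynomial X
    var       : X → Polynomial X
    _:+_ _:*_ : Polynomial X → Polynomial X → Polynomial X

  eval : ∀ {X} → Polynomial X → (X → Carrier) → Carrier
  eval (con c)  x = c
  eval (var i)  x = x i
  eval (p :+ q) x = eval p x + eval q x
  eval (p :* q) x = eval p x * eval q x

  -- The Zariski closed sets; finite lists suffice by Hilbert's basis theorem.
  ZeroLocus : ∀ {X} → List (Polynomial X) → Pred (X → Carrier) 0ℓ
  ZeroLocus ps x = All (λ p → eval p x ≈ 0#) ps

  Generic : ∀ {X} → Pred (X → Carrier) 0ℓ → Set
  Generic P = ∃ λ ps → Satisfiable (_∉ ZeroLocus ps) × (∀ x → x ∉ ZeroLocus ps → x ∈ P)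

-- Total correctness of nondeterministic choices. "choose A Q": a choice in A
-- can be made, and Q holds after each of them. "the≈ _≈_ P Q": the same for
-- the choice of the element satisfying P, which has to be unique.

choose : (A : Set) → (A → Set) → Set
choose A Q = A × (∀ a → Q a)

the≈ : {A : Set} → Rel A 0ℓ → Pred A 0ℓ → (A → Set) → Set
the≈ _≈_ P Q = ∃! _≈_ P × (∀ a → P a → Q a)

module Algorithm (F : Field) where
  open Field F
  open LinearAlgebra F

  record GeneralizedEigenpairs {n} (A B : Matrix n) : Set where
    field
      count       : ℕ
      value       : Vector Carrier count
      solutions   : ∀ μ → det (A -[ μ ] B) ≈ 0# ⇔ (∃[ i ] value i ≈ μ)
      distinct    : ∀ {i j} → value i ≈ value j → i ≡ j
      vector      : Vector (V n) count
      nonzero     : ∀ i → ¬ vector i ≈ᵛ 0ᵛ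
      eigenvector : ∀ i → (A -[ value i ] B) ·ᴹ vector i ≈ᵛ 0ᵛ

  record DualVectors {n m} (a : Vector (V n) m) : Set where
    field
      b      : Vector (V n) m
      orthog : ∀ i j → j ≢ i → pairing (b i) (a j) ≈ 0#
      normal : ∀ i → pairing (b i) (a i) ≈ 1#

  AreProjections : ∀ {n m} → Vector (Pred (V n) 0ℓ) m → Pred (Vector (Matrix n) m) 0ℓ
  AreProjections U Π =
    ∀ i → (∀ u → u ∈ U i → Π i ·ᴹ u ≈ᵛ u) ×
          (∀ j → j ≢ i → ∀ u → u ∈ U j → Π i ·ᴹ u ≈ᵛ 0ᵛ)

  record Coefficients {n m} (T : Tensor n) (f g : V n)
                      (a v : Vector (V n) m) (Π : Vector (Matrix n) m) : Set where
    field
      α β    : Vector Carrier m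
      solves : ∀ i → Π i ·ᴹ (T ⌟ f ·ᴹ g) ≈ᵛ
                     (a i ²⊙ (α i ·ᵛ a i +ᵛ β i ·ᵛ v i)) ⌟ f ·ᴹ g

  -- On input T with samples f, g, ℓ the algorithm never gets stuck, and
  -- whatever choices are made, the output satisfies Post. The sample ℓ is
  -- drawn but not used by the later steps.
  algorithm : ∀ {n} (T : Tensor n) (f g ℓ : V n) →
              (Post : ∀ {m} → Vector (Tensor n) m → Set) → Set
  algorithm T f g ℓ Post =
    choose (GeneralizedEigenpairs (T ⌟ f) (T ⌟ g)) λ eig →
    let open GeneralizedEigenpairs eig renaming (vector to x)
        a₁ = λ i → T ⌟ f ·ᴹ x i
    in
    choose (DualVectors a₁) λ dual →
    let open DualVectors dual
        v = λ i → contract₂ (b i) T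
        U = λ i → ⟨ a₁ i , v i ⟩
    in
    the≈ (λ Π Π′ → ∀ i → Π i ≈ᴹ Π′ i) (AreProjections U) λ Π →
    choose (Coefficients T f g a₁ v Π) λ coeff →
    let open Coefficients coeff
        a₂ = λ i → α i ·ᵛ a₁ i +ᵛ β i ·ᵛ v i
    in
    Post (λ i → a₁ i ²⊙ a₂ i)

module Setting (ℝ : RealNumbers) (k : Scalars) where
  open LinearAlgebra (scalarField ℝ k) public
  open WTensors (scalarField ℝ k) public
  open Zariski (scalarField ℝ k) public
  module ℂ where
    open LinearAlgebra (Complex.ℂ-field ℝ) public
    open WTensors (Complex.ℂ-field ℝ) public using (Terms)
    open Algorithm (Complex.ℂ-field ℝ) public

  ιᵛ : ∀ {n} → V n → ℂ.V n
  ιᵛ v i = toℂ ℝ k (v i)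

  ιᵀ : ∀ {n} → Tensor n → ℂ.Tensor n
  ιᵀ T i j l = toℂ ℝ k (T i j l)

  -- The sampled vectors f, g, ℓ are read off from a point of 𝕂ⁿ × 𝕂ⁿ × 𝕂ⁿ,
  -- whose coordinates are indexed by Fin 3 × Fin n.
  AlgorithmProduces : ∀ {n r} → Tensor n → Vector (Tensor n) r → Set
  AlgorithmProduces {n} {r} T t = Generic {Fin 3 × Fin n} λ sample →
    let f = λ i → sample (0F , i)
        g = λ i → sample (1F , i)
        ℓ = λ i → sample (2F , i)
    in
    ℂ.algorithm (ιᵀ T) (ιᵛ f) (ιᵛ g) (ιᵛ ℓ) λ {m} output →
      m ≡ r × ℂ.Terms output ≐ ℂ.Terms (λ i → ιᵀ (t i))

{-# OPTIONS --safe #-}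
module Submission where

-- Write p_i(x) = ⟨x , a_i1⟩, q_i(x) = ⟨x , a_i2⟩. In the basis (a_i1 , a_i2) the
-- vector T_x y has coordinates proportional to p_i(x) q_i(y) + q_i(x) p_i(y) and
-- p_i(x) p_i(y), so the pencil T_f − λ T_g is congruent to a sum of blocks
-- ((q p) (p 0)). For generic f and g its eigenvalues are the distinct ratios
-- p_i(f) / p_i(g), each with a single Jordan block, whose eigenvector is dual to
-- a_i2 and is mapped by T_f to a multiple of a_i1; the remaining steps are then
-- linear algebra inside the plane ⟨a_i1 , a_i2⟩.
--
-- Minimality holds since some T_f is invertible, so that the vectors of any
-- W-decomposition span. For uniqueness, contract T with the vector dual to b_k2 for
-- a second minimal decomposition: the result is b_k1 ⊗ b_k1 in one basis and
-- diagonal in the a_i1 in the other, so b_k1 is parallel to some a_i1.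

open import Defs
import Algebra.Properties.Monoid.Mult as Mult
import Algebra.Properties.Ring as RingProperties
import Algebra.Properties.Semiring.Exp as Exp
import Algebra.Properties.Semiring.Sum as Sum
import Algebra.Solver.Ring.NaturalCoefficients.Default as NatSolver
import Relation.Binary.Reasoning.Setoid as SetoidReasoning
open import Data.Fin.Base using (Fin; zero; suc; toℕ; punchIn; splitAt; _↑ˡ_; _↑ʳ_)
open import Data.Fin.Patterns using (0F; 1F; 2F)
open import Data.Fin.Properties as Fin using (any?; all?; cantor-schröder-bernstein; join-splitAt; toℕ-injective)
import Data.List.Base as List
import Data.List.Relation.Unary.All as All
open import Data.Nat.Base as ℕ using (ℕ; zero; suc; s≤s)
open import Data.Nat.Properties as ℕ using ()
open import Data.Product using (∃-syntax; _×_; _,_; proj₁; proj₂)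
open import Data.Sum.Base using (inj₁; inj₂)
open import Data.Vec.Functional using (Vector; []; _∷_; _++_; tail; removeAt; insertAt)
open import Data.Vec.Functional.Properties using (insertAt-lookup; insertAt-punchIn; lookup-++ˡ; lookup-++ʳ)
open import Function.Base using (_∘_; id)
open import Function.Bundles using (mk⇔; Equivalence)
open import Relation.Binary.Definitions using (tri<; tri≈; tri>)
open import Relation.Binary.PropositionalEquality as ≡ using (_≡_; _≢_)
open import Relation.Binary.Structures using (IsDecTotalOrder)
open import Relation.Nullary using (¬_; Dec; yes; no; contradiction)
open import Relation.Nullary.Decidable using (¬?; decidable-stable)
open import Relation.Unary using (_∈_; _≐_)

-- Correctness quantifies over every admissible list of eigenvectors, dual vectors, projections and
-- coefficients. The choices are tamed by one normal form: up to a relabelling ρ and nonzero scalars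
-- c the computed vectors are c a_i1, and the only remaining freedom is one coordinate of v_i inside
-- its plane.
--
-- Samples are drawn over 𝕂 while the run takes place over ℂ. Bases are therefore recorded by
-- equations and genericity by finitely many inequations in 𝕂: the first survive any homomorphism,
-- the second any injective one.
--
-- The determinant is a Laplace expansion, so its zeros have to be tied to kernels by elimination.
--
-- The number 3 is essential. Adding ξ a_1 to a_2 adds ξ a_1³ to a_1²a_2, and this adds 3ξκ p(f)
-- p(g) a_1 to T_f g. Hence one vector equation determines both coefficients in step (5). The same
-- factor finishes uniqueness: once the squared vectors of two decompositions are parallel, a
-- possible component of one second vector along the squared vector is killed by an equation 3κp²q =
-- 0.

module FieldTheory (F : Field) where
  open Field F hiding (zero)
  open LinearAlgebra F
  open WTensors F
  open Algorithm F
  open Zariski F renaming (_:+_ to _⊕_; _:*_ to _⊗_)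
  open RingProperties ring
  open Sum semiring using
    (sum; sum-cong-≋; sum-remove; sum-replicate-zero; ∑-distrib-+; ∑-comm; *-distribˡ-sum; *-distribʳ-sum)
  open Exp semiring using (_^_)
  open Mult +-monoid using (×-homo-+; ×-congˡ)
  open Mult +-monoid public using () renaming (_×_ to _·ℕ_)
  open SetoidReasoning setoid
  open NatSolver commutativeSemiring using (solve; con; _:=_; _:+_; _:*_)

  -- Field arithmetic, finite sums and the bilinear pairing.

  inverseʳ : ∀ {x} → x ≉ 0# → x * x ⁻¹ ≈ 1#
  inverseʳ {x} x≉0 with x ≟ 0#
  ... | yes x≈0 = contradiction x≈0 x≉0
  ... | no  x≉0′ = proj₂ (inverse x x≉0′)

  x*y≈0⇒y≈0 : ∀ {x y} → x ≉ 0# → x * y ≈ 0# → y ≈ 0#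
  x*y≈0⇒y≈0 {x} {y} x≉0 xy≈0 = begin
    y                ≈⟨ *-identityʳ y ⟨
    y * 1#           ≈⟨ *-congˡ (inverseʳ x≉0) ⟨
    y * (x * x ⁻¹)   ≈⟨ solve 3 (λ x y i → y :* (x :* i) := (x :* y) :* i) refl x y (x ⁻¹) ⟩
    (x * y) * x ⁻¹   ≈⟨ *-congʳ xy≈0 ⟩
    0# * x ⁻¹        ≈⟨ zeroˡ _ ⟩
    0#               ∎

  *-nonzero : ∀ {x y} → x ≉ 0# → y ≉ 0# → x * y ≉ 0#
  *-nonzero x≉0 y≉0 xy≈0 = y≉0 (x*y≈0⇒y≈0 x≉0 xy≈0)

  *-cancelˡ : ∀ {x y z} → x ≉ 0# → x * y ≈ x * z → y ≈ z
  *-cancelˡ {x} {y} {z} x≉0 eq = x∙y⁻¹≈ε⇒x≈y y z (x*y≈0⇒y≈0 x≉0 (begin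
    x * (y - z)     ≈⟨ x[y-z]≈xy-xz x y z ⟩
    x * y - x * z   ≈⟨ x≈y⇒x∙y⁻¹≈ε eq ⟩
    0#              ∎))

  x*x≈0⇒x≈0 : ∀ {x} → x * x ≈ 0# → x ≈ 0#
  x*x≈0⇒x≈0 {x} eq with x ≟ 0#
  ... | yes x≈0 = x≈0
  ... | no  x≉0 = x*y≈0⇒y≈0 x≉0 eq

  sum-zero : ∀ {n} {t : Vector Carrier n} → (∀ i → t i ≈ 0#) → sum t ≈ 0#
  sum-zero {n} t≈0 = trans (sum-cong-≋ t≈0) (sum-replicate-zero n)

  sum-single : ∀ {n} (i : Fin n) {t : Vector Carrier n} → (∀ j → j ≢ i → t j ≈ 0#) → sum t ≈ t i
  sum-single zero {t} off =
    trans (+-congˡ (sum-zero (λ j → off (suc j) λ ()))) (+-identityʳ (t zero))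
  sum-single (suc i) off =
    trans (+-cong (off zero λ ()) (sum-single i (λ j j≢i → off (suc j) λ { ≡.refl → j≢i ≡.refl })))
          (+-identityˡ _)

  sum-linear : ∀ {n} (x y : Vector Carrier n) (s t : Carrier) →
               ∑[ i < n ] (x i * s + y i * t) ≈ sum x * s + sum y * t
  sum-linear x y s t = trans (∑-distrib-+ (λ i → x i * s) (λ i → y i * t))
    (+-cong (sym (*-distribʳ-sum s x)) (sym (*-distribʳ-sum t y)))

  0ᵛ? : ∀ {n} (v : V n) → Dec (v ≈ᵛ 0ᵛ)
  0ᵛ? v = all? (λ i → v i ≟ 0#)

  nonzero-entry : ∀ {n} (v : V n) → ¬ v ≈ᵛ 0ᵛ → ∃[ i ] v i ≉ 0#
  nonzero-entry v v≉0 with any? (λ i → ¬? (v i ≟ 0#))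
  ... | yes i  = i
  ... | no ¬i = contradiction (λ i → decidable-stable (v i ≟ 0#) (λ vi → ¬i (i , vi))) v≉0

  pairing-cong : ∀ {n} {u u′ v v′ : V n} → u ≈ᵛ u′ → v ≈ᵛ v′ → pairing u v ≈ pairing u′ v′
  pairing-cong p q = sum-cong-≋ (λ i → *-cong (p i) (q i))

  pairing-comm : ∀ {n} (u v : V n) → pairing u v ≈ pairing v u
  pairing-comm u v = sum-cong-≋ (λ i → *-comm (u i) (v i))

  pairing-linearʳ : ∀ {n} (w : V n) c u d v →
                    pairing w (c ·ᵛ u +ᵛ d ·ᵛ v) ≈ c * pairing w u + d * pairing w v
  pairing-linearʳ w c u d v = begin
    pairing w (c ·ᵛ u +ᵛ d ·ᵛ v)
      ≈⟨ sum-cong-≋ (λ i → solve 5 (λ w c u d v → w :* (c :* u :+ d :* v) := (w :* u) :* c :+ (w :* v) :* d) refl (w i) c (u i) d (v i)) ⟩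
    _ ≈⟨ sum-linear (λ i → w i * u i) (λ i → w i * v i) c d ⟩
    pairing w u * c + pairing w v * d
      ≈⟨ +-cong (*-comm _ c) (*-comm _ d) ⟩
    c * pairing w u + d * pairing w v ∎

  pairing-+ʳ : ∀ {n} (w u v : V n) c → pairing w (λ i → u i + c * v i) ≈ pairing w u + c * pairing w v
  pairing-+ʳ w u v c = trans
    (pairing-cong {u = w} (λ i → refl) (λ i → +-congʳ (sym (*-identityˡ (u i)))))
    (trans (pairing-linearʳ w 1# u c v) (+-congʳ (*-identityˡ _)))

  pairing-+ˡ : ∀ {n} (w u v : V n) c → pairing (λ i → u i + c * v i) w ≈ pairing u w + c * pairing v w
  pairing-+ˡ w u v c = trans (pairing-comm (λ i → u i + c * v i) w)
    (trans (pairing-+ʳ w u v c) (+-cong (pairing-comm w u) (*-congˡ (pairing-comm w v))))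

  pairing-·ʳ : ∀ {n} (w v : V n) c → pairing w (c ·ᵛ v) ≈ c * pairing w v
  pairing-·ʳ w v c = trans
    (sum-cong-≋ (λ i → solve 3 (λ w c v → w :* (c :* v) := c :* (w :* v)) refl (w i) c (v i)))
    (sym (*-distribˡ-sum c (λ i → w i * v i)))

  pairing-0ʳ : ∀ {n} (w : V n) → pairing w 0ᵛ ≈ 0#
  pairing-0ʳ w = sum-zero (λ i → zeroʳ (w i))

  -- Linear systems

  Kernel : ∀ {m n} → (Fin m → V n) → V n → Set
  Kernel A x = ∀ i → pairing (A i) x ≈ 0#

  -- Gaussian elimination by one row: a zero first row is dropped; otherwise its pivot column is
  -- eliminated from the other rows, which leaves one equation and one unknown fewer, and the
  -- removed unknown is recovered from the pivot row.
  underdetermined : ∀ {m n} → m ℕ.< n → (A : Fin m → V n) → ∃[ x ] (¬ x ≈ᵛ 0ᵛ × Kernel A x)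
  underdetermined {zero}  {suc n} _ A = (λ _ → 1#) , (λ eq → 1≉0 (eq zero)) , λ ()
  underdetermined {suc m} {suc n} (s≤s m<n) A with 0ᵛ? (A zero)
  ... | yes A₀≈0 = let x , x≉0 , Ax≈0 = underdetermined (ℕ.m<n⇒m<1+n m<n) (A ∘ suc) in
    x , x≉0 , λ { zero → sum-zero (λ j → trans (*-congʳ (A₀≈0 j)) (zeroˡ (x j))) ; (suc i) → Ax≈0 i }
  ... | no A₀≉0 = x , x≉0 , Ax≈0
    where
    p = proj₁ (nonzero-entry (A zero) A₀≉0)
    pivot≉0 = proj₂ (nonzero-entry (A zero) A₀≉0)
    rest : Fin (suc m) → V n
    rest i = removeAt (A i) p
    q : Carrier
    q = A zero p ⁻¹
    B : Fin m → V n
    B i j = rest (suc i) j + (- (A (suc i) p * q)) * rest zero j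
    IH = underdetermined m<n B
    y = proj₁ IH
    x₀ : Carrier
    x₀ = - (q * pairing (rest zero) y)
    x : V (suc n)
    x = insertAt y p x₀
    x≉0 : ¬ x ≈ᵛ 0ᵛ
    x≉0 eq = proj₁ (proj₂ IH) λ j → trans (reflexive (≡.sym (insertAt-punchIn y p x₀ j))) (eq (punchIn p j))
    row : ∀ i → pairing (A i) x ≈ A i p * x₀ + pairing (rest i) y
    row i = trans (sum-remove {i = p} (λ j → A i j * x j)) (+-cong
      (*-congˡ (reflexive (insertAt-lookup y p x₀)))
      (sum-cong-≋ (λ j → *-congˡ (reflexive (insertAt-punchIn y p x₀ j)))))
    pull : ∀ a b r → a * - (b * r) ≈ - (a * b) * r
    pull a b r = trans (sym (-‿distribʳ-* a (b * r)))
      (trans (-‿cong (sym (*-assoc a b r))) (-‿distribˡ-* (a * b) r))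
    Ax≈0 : Kernel A x
    Ax≈0 zero = begin
      pairing (A zero) x ≈⟨ row zero ⟩
      A zero p * x₀ + R   ≈⟨ +-congʳ (pull (A zero p) q R) ⟩
      - (A zero p * q) * R + R ≈⟨ +-congʳ (*-congʳ (-‿cong (inverseʳ pivot≉0))) ⟩
      - 1# * R + R ≈⟨ +-congʳ (-1*x≈-x R) ⟩
      - R + R ≈⟨ -‿inverseˡ R ⟩
      0# ∎
      where R = pairing (rest zero) y
    Ax≈0 (suc i) = begin
      pairing (A (suc i)) x ≈⟨ row (suc i) ⟩
      A (suc i) p * x₀ + S ≈⟨ +-congʳ (pull (A (suc i) p) q R) ⟩
      - (A (suc i) p * q) * R + S ≈⟨ +-comm _ S ⟩
      S + - (A (suc i) p * q) * R ≈⟨ pairing-+ˡ y (rest (suc i)) (rest zero) (- (A (suc i) p * q)) ⟨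
      pairing (B i) y ≈⟨ proj₂ (proj₂ IH) i ⟩
      0# ∎
      where
      R = pairing (rest zero) y
      S = pairing (rest (suc i)) y

  -- Determinants: det A ≈ 0 iff A is singular

  sign : ∀ {n} → Fin n → Carrier
  sign j = (- 1#) ^ toℕ j

  det-cong : ∀ {n} {A B : Matrix n} → A ≈ᴹ B → det A ≈ det B
  det-cong {zero}  A≈B = refl
  det-cong {suc n} A≈B = sum-cong-≋ λ j →
    *-cong (*-congˡ {x = sign j} (A≈B zero j)) (det-cong (λ i k → A≈B (suc i) (punchIn j k)))

  -- The terms (j , k) and (k + 1 , j), for j ≤ k, cancel; the recursion peels off j = 0.
  double-expansion : ∀ {n} (u : V (suc (suc n))) (W : (Fin n → Fin (suc (suc n))) → Carrier) →
    (∀ {h h′} → (∀ l → h l ≡ h′ l) → W h ≈ W h′) →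
    ∑[ j < suc (suc n) ] ∑[ k < suc n ]
      (sign j * sign k * u j * u (punchIn j k) * W (punchIn j ∘ punchIn k)) ≈ 0#
  double-expansion {n} u W W-cong = begin
    ∑[ k < suc n ] f zero k + ∑[ j < suc n ] (f (suc j) zero + ∑[ k < n ] f (suc j) (suc k))
      ≈⟨ +-congˡ (∑-distrib-+ (λ j → f (suc j) zero) (λ j → ∑[ k < n ] f (suc j) (suc k))) ⟩
    ∑[ k < suc n ] f zero k + (∑[ j < suc n ] f (suc j) zero + rest)
      ≈⟨ +-assoc _ _ _ ⟨
    (∑[ k < suc n ] f zero k + ∑[ j < suc n ] f (suc j) zero) + rest
      ≈⟨ +-cong (sym (∑-distrib-+ (f zero) (λ j → f (suc j) zero))) (rest≈0 u W W-cong) ⟩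
    ∑[ k < suc n ] (f zero k + f (suc k) zero) + 0#
      ≈⟨ +-identityʳ _ ⟩
    ∑[ k < suc n ] (f zero k + f (suc k) zero)
      ≈⟨ sum-zero cancel ⟩
    0# ∎
    where
    f : Fin (suc (suc n)) → Fin (suc n) → Carrier
    f j k = sign j * sign k * u j * u (punchIn j k) * W (punchIn j ∘ punchIn k)
    rest : Carrier
    rest = ∑[ j < suc n ] ∑[ k < n ] f (suc j) (suc k)
    cancel : ∀ k → f zero k + f (suc k) zero ≈ 0#
    cancel k = begin
      f zero k + f (suc k) zero
        ≈⟨ +-congˡ (*-congˡ (W-cong λ { l → ≡.refl })) ⟩
      1# * sign k * u zero * u (suc k) * w + - 1# * sign k * 1# * u (suc k) * u zero * w
        ≈⟨ solve 5 (λ m s a b w → con 1 :* s :* a :* b :* w :+ m :* s :* con 1 :* b :* a :* w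
                               := (con 1 :+ m) :* (s :* a :* b :* w))
             refl (- 1#) (sign k) (u zero) (u (suc k)) w ⟩
      (1# + - 1#) * _ ≈⟨ *-congʳ (-‿inverseʳ 1#) ⟩
      0# * _ ≈⟨ zeroˡ _ ⟩
      0# ∎
      where
      w = W (suc ∘ punchIn k)
    rest≈0 : ∀ {n} (u : V (suc (suc n))) (W : (Fin n → Fin (suc (suc n))) → Carrier) →
      (∀ {h h′} → (∀ l → h l ≡ h′ l) → W h ≈ W h′) →
      ∑[ j < suc n ] ∑[ k < n ]
        (sign (suc j) * sign (suc k) * u (suc j) * u (suc (punchIn j k)) * W (punchIn (suc j) ∘ punchIn (suc k))) ≈ 0#
    rest≈0 {zero}  u W W-cong = sum-zero {1} λ j → refl
    rest≈0 {suc n} u W W-cong = trans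
      (sum-cong-≋ λ j → sum-cong-≋ (shifted j))
      -- When both deleted columns are positive, column 0 survives in every selection. This is why
      -- `W` is an arbitrary function of selections and not a minor: the recursion passes to the one
      -- that always keeps column 0.
      (double-expansion (tail u) (λ h → W (zero ∷ (suc ∘ h)))
        (λ h≡h′ → W-cong λ { zero → ≡.refl ; (suc l) → ≡.cong suc (h≡h′ l) }))
      where
      signs : ∀ s t → (- 1# * s) * (- 1# * t) ≈ s * t
      signs s t = begin
        (- 1# * s) * (- 1# * t) ≈⟨ *-cong (-1*x≈-x s) (-1*x≈-x t) ⟩
        - s * - t ≈⟨ -‿distribˡ-* s (- t) ⟨
        - (s * - t) ≈⟨ -‿cong (sym (-‿distribʳ-* s t)) ⟩
        - - (s * t) ≈⟨ -‿involutive _ ⟩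
        s * t ∎
      shifted : ∀ j k →
        sign (suc j) * sign (suc k) * u (suc j) * u (suc (punchIn j k)) * W (punchIn (suc j) ∘ punchIn (suc k)) ≈
        sign j * sign k * u (suc j) * u (suc (punchIn j k)) * W (zero ∷ (suc ∘ punchIn j ∘ punchIn k))
      shifted j k = *-cong (*-congʳ (*-congʳ (signs (sign j) (sign k))))
        (W-cong λ { zero → ≡.refl ; (suc l) → ≡.refl })

  -- Only additions between neighbouring rows: they keep the determinant exactly, where swaps and
  -- scalings would bring in factors, and after `shift` has passed to minors they always concern the
  -- first two rows, along which the determinant is expanded.
  data RowOp : ℕ → Set where
    down up : ∀ {m} → Carrier → RowOp (suc (suc m))
    shift   : ∀ {m} → RowOp m → RowOp (suc m)

  addMultiple : ∀ {n} → Carrier → V n → V n → V n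
  addMultiple c u v i = v i + c * u i

  rowOp : ∀ {m n} → RowOp m → (Fin m → V n) → Fin m → V n
  rowOp (down c)   A = A zero ∷ addMultiple c (A zero) (A (suc zero)) ∷ tail (tail A)
  rowOp (up c)     A = addMultiple c (A (suc zero)) (A zero) ∷ tail A
  rowOp (shift op) A = A zero ∷ rowOp op (tail A)

  rowOp-removeAt : ∀ {m n} (op : RowOp m) (A : Fin m → V (suc n)) j i k →
                   rowOp op A i (punchIn j k) ≡ rowOp op (λ i → removeAt (A i) j) i k
  rowOp-removeAt (down c)   A j zero          k = ≡.refl
  rowOp-removeAt (down c)   A j (suc zero)    k = ≡.refl
  rowOp-removeAt (down c)   A j (suc (suc i)) k = ≡.refl
  rowOp-removeAt (up c)     A j zero          k = ≡.refl
  rowOp-removeAt (up c)     A j (suc i)       k = ≡.refl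
  rowOp-removeAt (shift op) A j zero          k = ≡.refl
  rowOp-removeAt (shift op) A j (suc i)       k = rowOp-removeAt op (tail A) j i k

  private
    minor : ∀ {n} → (Fin n → V (suc (suc n))) → (Fin n → Fin (suc (suc n))) → Carrier
    minor R h = det (λ i l → R i (h l))

    minor-cong : ∀ {n} (R : Fin n → V (suc (suc n))) {h h′} → (∀ l → h l ≡ h′ l) → minor R h ≈ minor R h′
    minor-cong R h≡h′ = det-cong (λ i l → reflexive (≡.cong (R i) (h≡h′ l)))

    term : ∀ {n} (u v : V (suc (suc n))) (R : Fin n → V (suc (suc n))) →
           Fin (suc (suc n)) → Fin (suc n) → Carrier
    term u v R j k = sign j * sign k * u j * v (punchIn j k) * minor R (punchIn j ∘ punchIn k)

    bilinear : ∀ {n} (u v : V (suc (suc n))) (R : Fin n → V (suc (suc n))) → Carrier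
    bilinear {n} u v R = ∑[ j < suc (suc n) ] ∑[ k < suc n ] term u v R j k

    -- For fixed lower rows the twofold Laplace expansion is a bilinear form in the first two rows;
    -- `double-expansion` says that this form is alternating.
    det-bilinear : ∀ {n} (A : Matrix (suc (suc n))) →
                   det A ≈ bilinear (A zero) (A (suc zero)) (tail (tail A))
    det-bilinear A = sum-cong-≋ λ j → trans
      (*-distribˡ-sum (sign j * A zero j) (λ k → sign k * A (suc zero) (punchIn j k) * M j k))
      (sum-cong-≋ λ k → solve 5 (λ s a t b m → s :* a :* (t :* b :* m) := s :* t :* a :* b :* m)
        refl (sign j) (A zero j) (sign k) (A (suc zero) (punchIn j k)) (M j k))
      where M = λ j k → minor (tail (tail A)) (punchIn j ∘ punchIn k)

    bilinear-alternating : ∀ {n} (u : V (suc (suc n))) R → bilinear u u R ≈ 0#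
    bilinear-alternating u R = double-expansion u (minor R) (minor-cong R)

    sum²-+ : ∀ {m n} (x y : Fin m → Fin n → Carrier) c →
      ∑[ j < m ] ∑[ k < n ] (x j k + c * y j k) ≈ ∑[ j < m ] ∑[ k < n ] x j k + c * ∑[ j < m ] ∑[ k < n ] y j k
    sum²-+ {m} {n} x y c = begin
      ∑[ j < m ] ∑[ k < n ] (x j k + c * y j k)
        ≈⟨ sum-cong-≋ (λ j → trans (∑-distrib-+ (x j) (λ k → c * y j k)) (+-congˡ (sym (*-distribˡ-sum c (y j))))) ⟩
      ∑[ j < m ] (sum (x j) + c * sum (y j))
        ≈⟨ ∑-distrib-+ (λ j → sum (x j)) (λ j → c * sum (y j)) ⟩
      sum (λ j → sum (x j)) + sum (λ j → c * sum (y j))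
        ≈⟨ +-congˡ (sym (*-distribˡ-sum c (λ j → sum (y j)))) ⟩
      _ ∎

    bilinear-down : ∀ {n} c (u v : V (suc (suc n))) R → bilinear u (addMultiple c u v) R ≈ bilinear u v R
    bilinear-down c u v R = begin
      bilinear u (addMultiple c u v) R
        ≈⟨ sum-cong-≋ (λ j → sum-cong-≋ (λ k →
             solve 6 (λ s a b c d m → s :* a :* (b :+ c :* d) :* m := s :* a :* b :* m :+ c :* (s :* a :* d :* m))
               refl (sign j * sign k) (u j) (v (punchIn j k)) c (u (punchIn j k)) (minor R (punchIn j ∘ punchIn k)))) ⟩
      _ ≈⟨ sum²-+ (term u v R) (term u u R) c ⟩
      bilinear u v R + c * bilinear u u R ≈⟨ +-congˡ (*-congˡ (bilinear-alternating u R)) ⟩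
      bilinear u v R + c * 0# ≈⟨ +-congˡ (zeroʳ c) ⟩
      bilinear u v R + 0# ≈⟨ +-identityʳ _ ⟩
      bilinear u v R ∎

    bilinear-up : ∀ {n} c (u v : V (suc (suc n))) R → bilinear (addMultiple c v u) v R ≈ bilinear u v R
    bilinear-up c u v R = begin
      bilinear (addMultiple c v u) v R
        ≈⟨ sum-cong-≋ (λ j → sum-cong-≋ (λ k →
             solve 6 (λ s a b c d m → s :* (a :+ c :* d) :* b :* m := s :* a :* b :* m :+ c :* (s :* d :* b :* m))
               refl (sign j * sign k) (u j) (v (punchIn j k)) c (v j) (minor R (punchIn j ∘ punchIn k)))) ⟩
      _ ≈⟨ sum²-+ (term u v R) (term v v R) c ⟩
      bilinear u v R + c * bilinear v v R ≈⟨ +-congˡ (*-congˡ (bilinear-alternating v R)) ⟩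
      bilinear u v R + c * 0# ≈⟨ +-congˡ (zeroʳ c) ⟩
      bilinear u v R + 0# ≈⟨ +-identityʳ _ ⟩
      bilinear u v R ∎

  -- The added term has two equal rows and vanishes by `bilinear-alternating`. Under `shift` the
  -- operation acts on every minor, since it commutes with deleting a column.
  det-rowOp : ∀ {n} (op : RowOp n) (A : Matrix n) → det (rowOp op A) ≈ det A
  det-rowOp (down c) A = begin
    det (rowOp (down c) A) ≈⟨ det-bilinear (rowOp (down c) A) ⟩
    _ ≈⟨ bilinear-down c (A zero) (A (suc zero)) (tail (tail A)) ⟩
    _ ≈⟨ det-bilinear A ⟨
    det A ∎
  det-rowOp (up c) A = begin
    det (rowOp (up c) A) ≈⟨ det-bilinear (rowOp (up c) A) ⟩
    _ ≈⟨ bilinear-up c (A zero) (A (suc zero)) (tail (tail A)) ⟩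
    _ ≈⟨ det-bilinear A ⟨
    det A ∎
  det-rowOp (shift op) A = sum-cong-≋ λ j → *-congˡ {x = sign j * A zero j} (trans
    (det-cong (λ i k → reflexive (rowOp-removeAt op (tail A) j i k)))
    (det-rowOp op (λ i → removeAt (A (suc i)) j)))

  kernel-rowOp : ∀ {m n} (op : RowOp m) (A : Fin m → V n) x → Kernel A x → Kernel (rowOp op A) x
  kernel-rowOp (down c) A x ker zero          = ker zero
  kernel-rowOp (down c) A x ker (suc zero)    = trans (pairing-+ˡ x (A (suc zero)) (A zero) c)
    (trans (+-cong (ker (suc zero)) (*-congˡ (ker zero))) (trans (+-identityˡ _) (zeroʳ c)))
  kernel-rowOp (down c) A x ker (suc (suc i)) = ker (suc (suc i))
  kernel-rowOp (up c)   A x ker zero          = trans (pairing-+ˡ x (A zero) (A (suc zero)) c)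
    (trans (+-cong (ker zero) (*-congˡ (ker (suc zero)))) (trans (+-identityˡ _) (zeroʳ c)))
  kernel-rowOp (up c)   A x ker (suc i)       = ker (suc i)
  kernel-rowOp (shift op) A x ker zero        = ker zero
  kernel-rowOp (shift op) A x ker (suc i)     = kernel-rowOp op (tail A) x (ker ∘ suc) i

  private
    x+cy≈0⇒x≈0 : ∀ {x y} c → x + c * y ≈ 0# → y ≈ 0# → x ≈ 0#
    x+cy≈0⇒x≈0 {x} {y} c eq y≈0 = begin
      x         ≈⟨ +-identityʳ x ⟨
      x + 0#    ≈⟨ +-congˡ (trans (*-congˡ y≈0) (zeroʳ c)) ⟨
      x + c * y ≈⟨ eq ⟩
      0# ∎

  kernel-rowOp⁻ : ∀ {m n} (op : RowOp m) (A : Fin m → V n) x → Kernel (rowOp op A) x → Kernel A x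
  kernel-rowOp⁻ (down c) A x ker zero          = ker zero
  kernel-rowOp⁻ (down c) A x ker (suc zero)    =
    x+cy≈0⇒x≈0 c (trans (sym (pairing-+ˡ x (A (suc zero)) (A zero) c)) (ker (suc zero))) (ker zero)
  kernel-rowOp⁻ (down c) A x ker (suc (suc i)) = ker (suc (suc i))
  kernel-rowOp⁻ (up c)   A x ker zero          =
    x+cy≈0⇒x≈0 c (trans (sym (pairing-+ˡ x (A zero) (A (suc zero)) c)) (ker zero)) (ker (suc zero))
  kernel-rowOp⁻ (up c)   A x ker (suc i)       = ker (suc i)
  kernel-rowOp⁻ (shift op) A x ker zero        = ker zero
  kernel-rowOp⁻ (shift op) A x ker (suc i)     = kernel-rowOp⁻ op (tail A) x (ker ∘ suc) i

  -- An elimination kept as data, so that determinant and kernel are transported along the same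
  -- sequence of operations.
  data _⟶_ {n} : ∀ {m} → (Fin m → V n) → (Fin m → V n) → Set where
    done : ∀ {m} {A B : Fin m → V n} → (∀ i j → A i j ≈ B i j) → A ⟶ B
    step : ∀ {m} {A B : Fin m → V n} (op : RowOp m) → rowOp op A ⟶ B → A ⟶ B

  det-⟶ : ∀ {n} {A B : Matrix n} → A ⟶ B → det A ≈ det B
  det-⟶ (done A≈B)          = det-cong A≈B
  det-⟶ {A = A} (step op s) = trans (sym (det-rowOp op A)) (det-⟶ s)

  kernel-⟶ : ∀ {m n} {A B : Fin m → V n} → A ⟶ B → ∀ x → Kernel A x → Kernel B x
  kernel-⟶ (done A≈B) x ker i = trans (pairing-cong {v = x} (λ j → sym (A≈B i j)) (λ j → refl)) (ker i)
  kernel-⟶ {A = A} (step op s) x ker = kernel-⟶ s x (kernel-rowOp op A x ker)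

  kernel-⟶⁻ : ∀ {m n} {A B : Fin m → V n} → A ⟶ B → ∀ x → Kernel B x → Kernel A x
  kernel-⟶⁻ (done A≈B) x ker i = trans (pairing-cong {v = x} (A≈B i) (λ j → refl)) (ker i)
  kernel-⟶⁻ {A = A} (step op s) x ker = kernel-rowOp⁻ op A x (kernel-⟶⁻ s x ker)

  rowOp-cong : ∀ {m n} (op : RowOp m) {A B : Fin m → V n} →
               (∀ i j → A i j ≈ B i j) → ∀ i j → rowOp op A i j ≈ rowOp op B i j
  rowOp-cong (down c)   eq zero          j = eq zero j
  rowOp-cong (down c)   eq (suc zero)    j = +-cong (eq (suc zero) j) (*-congˡ (eq zero j))
  rowOp-cong (down c)   eq (suc (suc i)) j = eq (suc (suc i)) j
  rowOp-cong (up c)     eq zero          j = +-cong (eq zero j) (*-congˡ (eq (suc zero) j))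
  rowOp-cong (up c)     eq (suc i)       j = eq (suc i) j
  rowOp-cong (shift op) eq zero          j = eq zero j
  rowOp-cong (shift op) eq (suc i)       j = rowOp-cong op (eq ∘ suc) i j

  resp-⟶ : ∀ {m n} {A A′ B : Fin m → V n} → (∀ i j → A′ i j ≈ A i j) → A ⟶ B → A′ ⟶ B
  resp-⟶ eq (done A≈B)  = done (λ i j → trans (eq i j) (A≈B i j))
  resp-⟶ eq (step op s) = step op (resp-⟶ (rowOp-cong op eq) s)

  trans-⟶ : ∀ {m n} {A B C : Fin m → V n} → A ⟶ B → B ⟶ C → A ⟶ C
  trans-⟶ (done A≈B)  t = resp-⟶ A≈B t
  trans-⟶ (step op s) t = step op (trans-⟶ s t)

  shift-⟶ : ∀ {m n} u {A B : Fin m → V n} → A ⟶ B → (u ∷ A) ⟶ (u ∷ B)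
  shift-⟶ u (done A≈B)  = done λ { zero j → refl ; (suc i) j → A≈B i j }
  shift-⟶ u (step op s) = step (shift op) (resp-⟶ (λ { zero j → refl ; (suc i) j → refl }) (shift-⟶ u s))

  extend-⟶ : ∀ {m n} {A : Fin (suc m) → V n} {B} → tail A ⟶ B → A ⟶ (A zero ∷ B)
  extend-⟶ {A = A} tailA⟶B =
    resp-⟶ (λ { zero j → refl ; (suc i) j → refl }) (shift-⟶ (A zero) tailA⟶B)

  -- The lower rows are cleared first. Then at most the leading entries `a` and `b` of the first two
  -- rows remain, and operations between these two rows finish.
  clear-column : ∀ {m n} (A : Fin (suc m) → V (suc n)) → ∃[ B ] (A ⟶ B × ∀ i → B (suc i) zero ≈ 0#)
  clear-column {zero}  A = A , done (λ i j → refl) , λ ()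
  clear-column {suc m} {n} A with clear-column (tail A)
  ... | B , tailA⟶B , B₀≈0 with A zero zero ≟ 0# | B zero zero ≟ 0#
  ... | _ | yes b≈0 = (A zero ∷ B) , extend-⟶ tailA⟶B , λ { zero → b≈0 ; (suc i) → B₀≈0 i }
  ... | no a≉0 | no _ = _ , trans-⟶ (extend-⟶ tailA⟶B) (step (down c) (done λ i j → refl)) , λ
      { zero → begin
          b + c * a ≈⟨ +-congˡ (solve 3 (λ m i a → m :* i :* a := m :* (a :* i)) refl (- b) (a ⁻¹) a) ⟩
          b + - b * (a * a ⁻¹) ≈⟨ +-congˡ (trans (*-congˡ (inverseʳ a≉0)) (*-identityʳ (- b))) ⟩
          b + - b ≈⟨ -‿inverseʳ b ⟩
          0# ∎
      ; (suc i) → B₀≈0 i }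
    where
    a = A zero zero
    b = B zero zero
    c = - b * a ⁻¹
  -- Without a pivot in the first row, adding the second row to it replaces a swap: the entry
  -- becomes `b`, and a subtraction then clears the second row.
  ... | yes a≈0 | no _ = _ , trans-⟶ (extend-⟶ tailA⟶B) (step (up 1#) (step (down (- 1#)) (done λ i j → refl))) , λ
      { zero → begin
          b + - 1# * (a + 1# * b) ≈⟨ +-congˡ (*-congˡ (trans (+-cong a≈0 (*-identityˡ b)) (+-identityˡ b))) ⟩
          b + - 1# * b ≈⟨ +-congˡ (-1*x≈-x b) ⟩
          b + - b ≈⟨ -‿inverseʳ b ⟩
          0# ∎
      ; (suc i) → B₀≈0 i }
    where
    a = A zero zero
    b = B zero zero

  mutual
    -- Deleting any column but the first leaves a zero column in the minor, so by induction on the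
    -- size only one term of the Laplace expansion survives.
    det-cleared : ∀ {n} (A : Matrix (suc n)) → (∀ i → A (suc i) zero ≈ 0#) →
                  det A ≈ A zero zero * det (λ i j → A (suc i) (suc j))
    det-cleared {n} A A₀≈0 = trans
      (sum-single zero {λ j → sign j * A zero j * det (λ i → removeAt (A (suc i)) j)} off)
      (*-congʳ (*-identityˡ _))
      where
      minor≈0 : ∀ {n} (A : Matrix (suc n)) → (∀ i → A (suc i) zero ≈ 0#) → ∀ j →
                det (λ i → removeAt (A (suc i)) (suc j)) ≈ 0#
      minor≈0 {suc n} A A₀≈0 j = zero-column⇒det≈0 (λ i → removeAt (A (suc i)) (suc j)) A₀≈0
      off : ∀ j → j ≢ zero → sign j * A zero j * det (λ i → removeAt (A (suc i)) j) ≈ 0#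
      off zero    0≢0 = contradiction ≡.refl 0≢0
      off (suc j) _   = trans (*-congˡ (minor≈0 A A₀≈0 j)) (zeroʳ _)

    zero-column⇒det≈0 : ∀ {n} (A : Matrix (suc n)) → (∀ i → A i zero ≈ 0#) → det A ≈ 0#
    zero-column⇒det≈0 A A₀≈0 = trans (det-cleared A (λ i → A₀≈0 (suc i)))
      (trans (*-congʳ (A₀≈0 zero)) (zeroˡ _))

  Singular : ∀ {n} → Matrix n → Set
  Singular A = ∃[ x ] (¬ x ≈ᵛ 0ᵛ × Kernel A x)

  -- After clearing, a vanishing pivot leaves a zero column. With a nonzero pivot the tail of `x` is
  -- a kernel vector of the lower block, and it is nonzero because the first row would otherwise
  -- force `x` to vanish.
  singular⇒det≈0 : ∀ {n} (A : Matrix n) → Singular A → det A ≈ 0#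
  singular⇒det≈0 {zero}  A (x , x≉0 , _) = contradiction (λ ()) x≉0
  singular⇒det≈0 {suc n} A (x , x≉0 , Ax≈0) with clear-column A
  ... | B , A⟶B , B₀≈0 with B zero zero ≟ 0#
  ... | yes b≈0 = trans (det-⟶ A⟶B) (zero-column⇒det≈0 B λ { zero → b≈0 ; (suc i) → B₀≈0 i })
  ... | no  b≉0 = trans (det-⟶ A⟶B) (trans (det-cleared B B₀≈0) (trans (*-congˡ
          (singular⇒det≈0 (λ i j → B (suc i) (suc j)) (tail x , tail≉0 , tail-kernel))) (zeroʳ _)))
    where
    Bx≈0 : Kernel B x
    Bx≈0 = kernel-⟶ A⟶B x Ax≈0
    tail-kernel : Kernel (λ i j → B (suc i) (suc j)) (tail x)
    tail-kernel i = trans (sym (+-identityˡ _))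
      (trans (+-congʳ (sym (trans (*-congʳ (B₀≈0 i)) (zeroˡ _)))) (Bx≈0 (suc i)))
    tail≉0 : ¬ tail x ≈ᵛ 0ᵛ
    tail≉0 tail≈0 = x≉0 λ
      { zero → x*y≈0⇒y≈0 b≉0 (trans (sym (+-identityʳ _)) (trans
          (+-congˡ (sym (sum-zero (λ j → trans (*-congˡ (tail≈0 j)) (zeroʳ _))))) (Bx≈0 zero)))
      ; (suc j) → tail≈0 j }

  -- A vanishing pivot makes the first standard basis vector a kernel vector. Otherwise the lower
  -- block has determinant zero, and its kernel vector is extended by solving the first row for the
  -- leading coordinate.
  det≈0⇒singular : ∀ {n} (A : Matrix n) → det A ≈ 0# → Singular A
  det≈0⇒singular {zero}  A 1≈0 = contradiction 1≈0 1≉0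
  det≈0⇒singular {suc n} A det≈0 with clear-column A
  ... | B , A⟶B , B₀≈0 with B zero zero ≟ 0#
  ... | yes b≈0 = e , (λ e≈0 → 1≉0 (e≈0 zero)) , kernel-⟶⁻ A⟶B e Be≈0
    where
    e : V (suc n)
    e = 1# ∷ 0ᵛ
    Be≈0 : Kernel B e
    Be≈0 i = trans (+-cong (trans (*-identityʳ _) (column i)) (pairing-0ʳ (tail (B i)))) (+-identityʳ 0#)
      where
      column : ∀ i → B i zero ≈ 0#
      column zero    = b≈0
      column (suc i) = B₀≈0 i
  ... | no  b≉0 = x , (λ x≈0 → y≉0 (x≈0 ∘ suc)) , kernel-⟶⁻ A⟶B x Bx≈0
    where
    IH = det≈0⇒singular (λ i j → B (suc i) (suc j))
           (x*y≈0⇒y≈0 b≉0 (trans (sym (det-cleared B B₀≈0)) (trans (sym (det-⟶ A⟶B)) det≈0)))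
    y = proj₁ IH
    y≉0 = proj₁ (proj₂ IH)
    b = B zero zero
    R = pairing (tail (B zero)) y
    x : V (suc n)
    x = (b ⁻¹ * - R) ∷ y
    Bx≈0 : Kernel B x
    Bx≈0 zero = begin
      b * (b ⁻¹ * - R) + R ≈⟨ +-congʳ (*-assoc _ _ _) ⟨
      b * b ⁻¹ * - R + R ≈⟨ +-congʳ (trans (*-congʳ (inverseʳ b≉0)) (*-identityˡ _)) ⟩
      - R + R ≈⟨ -‿inverseˡ R ⟩
      0# ∎
    Bx≈0 (suc i) = trans (+-cong (trans (*-congʳ (B₀≈0 i)) (zeroˡ _)) (proj₂ (proj₂ IH) i)) (+-identityʳ 0#)

  -- Contractions of W-tensors

  -- The constant 1/3: the six permutations in a²b coincide in pairs, which leaves three terms with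
  -- the factor 2/3!.
  κ : Carrier
  κ = 3! ⁻¹ * (1# + 1#)

  ²⊙-entry : ∀ {n} (a b : V n) i j k →
    (a ²⊙ b) i j k ≈ κ * (a i * a j * b k + a i * b j * a k + b i * a j * a k)
  ²⊙-entry a b i j k =
    solve 7 (λ s x y z x′ y′ z′ →
      s :* (x :* y :* z′ :+ x :* y′ :* z :+ x :* y :* z′ :+ x :* y′ :* z :+ x′ :* y :* z :+ x′ :* y :* z)
      := s :* con 2 :* (x :* y :* z′ :+ x :* y′ :* z :+ x′ :* y :* z))
      refl (3! ⁻¹) (a i) (a j) (a k) (b i) (b j) (b k)

  ²⊙-contract : ∀ {n} (a b f g : V n) j →
    ((a ²⊙ b) ⌟ f ·ᴹ g) j ≈
    κ * (pairing f a * pairing g a) * b j +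
    κ * (pairing f a * pairing g b + pairing f b * pairing g a) * a j
  ²⊙-contract {n} a b f g j = begin
    ((a ²⊙ b) ⌟ f ·ᴹ g) j
      ≈⟨ sum-cong-≋ (λ k → *-congʳ {x = g k} (inner k)) ⟩
    ∑[ k < n ] ((P * s k + Q * t k) * g k)
      ≈⟨ sum-cong-≋ (λ k → solve 8 (λ c P Q x y x′ y′ z →
           (P :* (c :* (x :* y′ :+ x′ :* y)) :+ Q :* (c :* (x :* y))) :* z
           := (z :* y) :* (c :* (P :* x′ :+ Q :* x)) :+ (z :* y′) :* (c :* (P :* x)))
           refl κ P Q (a j) (a k) (b j) (b k) (g k)) ⟩
    ∑[ k < n ] ((g k * a k) * (κ * (P * b j + Q * a j)) + (g k * b k) * (κ * (P * a j)))
      ≈⟨ sum-linear (λ k → g k * a k) (λ k → g k * b k) _ _ ⟩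
    P′ * (κ * (P * b j + Q * a j)) + Q′ * (κ * (P * a j))
      ≈⟨ solve 7 (λ c P Q P′ Q′ x y →
           P′ :* (c :* (P :* y :+ Q :* x)) :+ Q′ :* (c :* (P :* x))
           := c :* (P :* P′) :* y :+ c :* (P :* Q′ :+ Q :* P′) :* x)
           refl κ P Q P′ Q′ (a j) (b j) ⟩
    κ * (P * P′) * b j + κ * (P * Q′ + Q * P′) * a j ∎
    where
    P  = pairing f a
    Q  = pairing f b
    P′ = pairing g a
    Q′ = pairing g b
    s t : Fin n → Carrier
    s k = κ * (a j * b k + b j * a k)
    t k = κ * (a j * a k)
    inner : ∀ k → ((a ²⊙ b) ⌟ f) j k ≈ P * s k + Q * t k
    inner k = begin
      ((a ²⊙ b) ⌟ f) j k
        ≈⟨ sum-cong-≋ (λ i → *-congˡ {x = f i} (²⊙-entry a b i j k)) ⟩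
      ∑[ i < n ] (f i * (κ * (a i * a j * b k + a i * b j * a k + b i * a j * a k)))
        ≈⟨ sum-cong-≋ (λ i → solve 8 (λ c x y z x′ y′ z′ w →
             w :* (c :* (x :* y :* z′ :+ x :* y′ :* z :+ x′ :* y :* z))
             := (w :* x) :* (c :* (y :* z′ :+ y′ :* z)) :+ (w :* x′) :* (c :* (y :* z)))
             refl κ (a i) (a j) (a k) (b i) (b j) (b k) (f i)) ⟩
      ∑[ i < n ] ((f i * a i) * s k + (f i * b i) * t k)
        ≈⟨ sum-linear (λ i → f i * a i) (λ i → f i * b i) _ _ ⟩
      P * s k + Q * t k ∎

  -- By symmetry of a²b it does not matter whether the first two slots or the first and the last are
  -- contracted; so the vectors v_i of step (3) obey the same formulas as T_x x.
  ²⊙-contract₂ : ∀ {n} (a b x : V n) k → contract₂ x (a ²⊙ b) k ≈ ((a ²⊙ b) ⌟ x ·ᴹ x) k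
  ²⊙-contract₂ {n} a b x k = begin
    contract₂ x (a ²⊙ b) k
      ≈⟨ sum-cong-≋ inner ⟩
    ∑[ i < n ] (P * (x i * (κ * (a i * b k + b i * a k))) + Q * (x i * (κ * (a i * a k))))
      ≈⟨ sum-cong-≋ (λ i → solve 8 (λ c P Q y z y′ z′ w →
           P :* (w :* (c :* (y :* z′ :+ y′ :* z))) :+ Q :* (w :* (c :* (y :* z)))
           := (w :* y) :* (c :* (P :* z′ :+ Q :* z)) :+ (w :* y′) :* (c :* (P :* z)))
           refl κ P Q (a i) (a k) (b i) (b k) (x i)) ⟩
    ∑[ i < n ] ((x i * a i) * (κ * (P * b k + Q * a k)) + (x i * b i) * (κ * (P * a k)))
      ≈⟨ sum-linear (λ i → x i * a i) (λ i → x i * b i) _ _ ⟩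
    P * (κ * (P * b k + Q * a k)) + Q * (κ * (P * a k))
      ≈⟨ solve 5 (λ c P Q x y →
           P :* (c :* (P :* y :+ Q :* x)) :+ Q :* (c :* (P :* x))
           := c :* (P :* P) :* y :+ c :* (P :* Q :+ Q :* P) :* x)
           refl κ P Q (a k) (b k) ⟩
    κ * (P * P) * b k + κ * (P * Q + Q * P) * a k
      ≈⟨ ²⊙-contract a b x x k ⟨
    ((a ²⊙ b) ⌟ x ·ᴹ x) k ∎
    where
    P = pairing x a
    Q = pairing x b
    inner : ∀ i → ∑[ j < n ] (x i * x j * (a ²⊙ b) i j k) ≈
            P * (x i * (κ * (a i * b k + b i * a k))) + Q * (x i * (κ * (a i * a k)))
    inner i = begin
      ∑[ j < n ] (x i * x j * (a ²⊙ b) i j k)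
        ≈⟨ sum-cong-≋ (λ j → *-congˡ {x = x i * x j} (²⊙-entry a b i j k)) ⟩
      ∑[ j < n ] (x i * x j * (κ * (a i * a j * b k + a i * b j * a k + b i * a j * a k)))
        ≈⟨ sum-cong-≋ (λ j → solve 9 (λ c x y z x′ y′ z′ w v →
             w :* v :* (c :* (x :* y :* z′ :+ x :* y′ :* z :+ x′ :* y :* z))
             := (v :* y) :* (w :* (c :* (x :* z′ :+ x′ :* z))) :+ (v :* y′) :* (w :* (c :* (x :* z))))
             refl κ (a i) (a j) (a k) (b i) (b j) (b k) (x i) (x j)) ⟩
      ∑[ j < n ] ((x j * a j) * _ + (x j * b j) * _)
        ≈⟨ sum-linear (λ j → x j * a j) (λ j → x j * b j) _ _ ⟩
      P * (x i * (κ * (a i * b k + b i * a k))) + Q * (x i * (κ * (a i * a k))) ∎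

  ·ᴹ-cong : ∀ {n} {A B : Matrix n} {u v : V n} → A ≈ᴹ B → u ≈ᵛ v → A ·ᴹ u ≈ᵛ B ·ᴹ v
  ·ᴹ-cong A≈B u≈v i = sum-cong-≋ (λ j → *-cong (A≈B i j) (u≈v j))

  ⌟-cong : ∀ {n} {S T : Tensor n} → S ≈ᵀ T → ∀ f → S ⌟ f ≈ᴹ T ⌟ f
  ⌟-cong S≈T f j k = sum-cong-≋ (λ i → *-congˡ {x = f i} (S≈T i j k))

  contract₂-cong : ∀ {n} {S T : Tensor n} → S ≈ᵀ T → ∀ x → contract₂ x S ≈ᵛ contract₂ x T
  contract₂-cong S≈T x k = sum-cong-≋ (λ i → sum-cong-≋ (λ j → *-congˡ {x = x i * x j} (S≈T i j k)))

  ∑ᵀ-⌟ : ∀ {n m} (t : Vector (Tensor n) m) f j k → (∑ᵀ t ⌟ f) j k ≈ ∑[ s < m ] (t s ⌟ f) j k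
  ∑ᵀ-⌟ t f j k = trans (sum-cong-≋ (λ i → *-distribˡ-sum (f i) (λ s → t s i j k)))
    (∑-comm (λ i s → f i * t s i j k))

  ∑ᵀ-contract : ∀ {n m} (t : Vector (Tensor n) m) f g j →
                (∑ᵀ t ⌟ f ·ᴹ g) j ≈ ∑[ s < m ] (t s ⌟ f ·ᴹ g) j
  ∑ᵀ-contract t f g j = trans
    (sum-cong-≋ (λ k → trans (*-congʳ (∑ᵀ-⌟ t f j k)) (*-distribʳ-sum (g k) (λ s → (t s ⌟ f) j k))))
    (∑-comm (λ k s → (t s ⌟ f) j k * g k))

  ∑ᵀ-contract₂ : ∀ {n m} (t : Vector (Tensor n) m) x k →
                 contract₂ x (∑ᵀ t) k ≈ ∑[ s < m ] contract₂ x (t s) k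
  ∑ᵀ-contract₂ t x k = trans
    (sum-cong-≋ (λ i → trans
      (sum-cong-≋ (λ j → *-distribˡ-sum (x i * x j) (λ s → t s i j k)))
      (∑-comm (λ j s → x i * x j * t s i j k))))
    (∑-comm (λ i s → sum (λ j → x i * x j * t s i j k)))

  pairing-combination : ∀ {n m} (z : V n) (c d : Vector Carrier m) (u w : Vector (V n) m) →
    pairing z (λ k → ∑[ s < m ] (c s * u s k + d s * w s k)) ≈
    ∑[ s < m ] (c s * pairing z (u s) + d s * pairing z (w s))
  pairing-combination z c d u w = trans
    (sum-cong-≋ (λ k → *-distribˡ-sum (z k) (λ s → c s * u s k + d s * w s k)))
    (trans (∑-comm (λ k s → z k * (c s * u s k + d s * w s k)))
      (sum-cong-≋ (λ s → pairing-linearʳ z (c s) (u s) (d s) (w s))))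

  -- Spanning families and dual bases.

  δ : ∀ {n} → Fin n → Fin n → Carrier
  δ zero    zero    = 1#
  δ zero    (suc j) = 0#
  δ (suc i) zero    = 0#
  δ (suc i) (suc j) = δ i j

  δ-diag : ∀ {n} (i : Fin n) → δ i i ≈ 1#
  δ-diag zero    = refl
  δ-diag (suc i) = δ-diag i

  δ-off : ∀ {n} {i j : Fin n} → i ≢ j → δ i j ≈ 0#
  δ-off {i = zero}  {zero}  i≢j = contradiction ≡.refl i≢j
  δ-off {i = zero}  {suc j} i≢j = refl
  δ-off {i = suc i} {zero}  i≢j = refl
  δ-off {i = suc i} {suc j} i≢j = δ-off (i≢j ∘ ≡.cong suc)

  δ-sym : ∀ {n} (i j : Fin n) → δ i j ≡ δ j i
  δ-sym zero    zero    = ≡.refl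
  δ-sym zero    (suc j) = ≡.refl
  δ-sym (suc i) zero    = ≡.refl
  δ-sym (suc i) (suc j) = δ-sym i j

  sum-δ : ∀ {n} (i : Fin n) (x : Vector Carrier n) → ∑[ j < n ] (δ i j * x j) ≈ x i
  sum-δ i x = trans
    (sum-single i (λ j j≢i → trans (*-congʳ (δ-off (j≢i ∘ ≡.sym))) (zeroˡ (x j))))
    (trans (*-congʳ (δ-diag i)) (*-identityˡ (x i)))

  -- A resolution of the identity: it says that the vectors span and provides coordinates linear in
  -- the vector, but not that these coordinates are unique.
  record Coframe {n r} (a b : Vector (V n) r) : Set where
    field
      a* b* : Vector (V n) r
      complete : ∀ k l → ∑[ i < r ] (a i k * a* i l + b i k * b* i l) ≈ δ k l

    expand : ∀ v k → v k ≈ ∑[ i < r ] (pairing (a* i) v * a i k + pairing (b* i) v * b i k)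
    expand v k = begin
      v k                       ≈⟨ sum-δ k v ⟨
      ∑[ l < n ] (δ k l * v l)  ≈⟨ sum-cong-≋ (λ l → *-congʳ {x = v l} (complete k l)) ⟨
      ∑[ l < n ] (∑[ i < r ] (a i k * a* i l + b i k * b* i l) * v l)
        ≈⟨ sum-cong-≋ (λ l → trans
             (*-distribʳ-sum (v l) (λ i → a i k * a* i l + b i k * b* i l))
             (sum-cong-≋ (λ i → solve 5 (λ x y z w v → (x :* y :+ z :* w) :* v := (y :* v) :* x :+ (w :* v) :* z)
               refl (a i k) (a* i l) (b i k) (b* i l) (v l)))) ⟩
      ∑[ l < n ] ∑[ i < r ] ((a* i l * v l) * a i k + (b* i l * v l) * b i k)
        ≈⟨ ∑-comm (λ l i → (a* i l * v l) * a i k + (b* i l * v l) * b i k) ⟩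
      ∑[ i < r ] ∑[ l < n ] ((a* i l * v l) * a i k + (b* i l * v l) * b i k)
        ≈⟨ sum-cong-≋ (λ i → sum-linear (λ l → a* i l * v l) (λ l → b* i l * v l) (a i k) (b i k)) ⟩
      ∑[ i < r ] (pairing (a* i) v * a i k + pairing (b* i) v * b i k) ∎

    expand* : ∀ x l → x l ≈ ∑[ i < r ] (pairing x (a i) * a* i l + pairing x (b i) * b* i l)
    expand* x l = begin
      x l                       ≈⟨ sum-δ l x ⟨
      ∑[ k < n ] (δ l k * x k)  ≈⟨ sum-cong-≋ (λ k → *-congʳ {x = x k} (trans (complete k l) (reflexive (δ-sym k l)))) ⟨
      ∑[ k < n ] (∑[ i < r ] (a i k * a* i l + b i k * b* i l) * x k)
        ≈⟨ sum-cong-≋ (λ k → trans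
             (*-distribʳ-sum (x k) (λ i → a i k * a* i l + b i k * b* i l))
             (sum-cong-≋ (λ i → solve 5 (λ x y z w v → (x :* y :+ z :* w) :* v := (v :* x) :* y :+ (v :* z) :* w)
               refl (a i k) (a* i l) (b i k) (b* i l) (x k)))) ⟩
      ∑[ k < n ] ∑[ i < r ] ((x k * a i k) * a* i l + (x k * b i k) * b* i l)
        ≈⟨ ∑-comm (λ k i → (x k * a i k) * a* i l + (x k * b i k) * b* i l) ⟩
      ∑[ i < r ] ∑[ k < n ] ((x k * a i k) * a* i l + (x k * b i k) * b* i l)
        ≈⟨ sum-cong-≋ (λ i → sum-linear (λ k → x k * a i k) (λ k → x k * b i k) (a* i l) (b* i l)) ⟩
      ∑[ i < r ] (pairing x (a i) * a* i l + pairing x (b i) * b* i l) ∎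

    covector-zero : ∀ x → (∀ i → pairing x (a i) ≈ 0#) → (∀ i → pairing x (b i) ≈ 0#) → x ≈ᵛ 0ᵛ
    covector-zero x xa≈0 xb≈0 l = trans (expand* x l) (sum-zero λ i → trans
      (+-cong (trans (*-congʳ (xa≈0 i)) (zeroˡ _)) (trans (*-congʳ (xb≈0 i)) (zeroˡ _))) (+-identityʳ 0#))

  -- A basis with its dual basis, given by equations so that it can be transported
  -- along a field embedding.
  record Frame {n r} (a b : Vector (V n) r) : Set where
    field
      coframe : Coframe a b
    open Coframe coframe public
    field
      a*a : ∀ i j → pairing (a* i) (a j) ≈ δ i j
      a*b : ∀ i j → pairing (a* i) (b j) ≈ 0#
      b*a : ∀ i j → pairing (b* i) (a j) ≈ 0#
      b*b : ∀ i j → pairing (b* i) (b j) ≈ δ i j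

    -- The vector with prescribed pairings `c` and `d` with the basis. Explicit samples and
    -- preimages are built in this way.
    cocombination : Vector Carrier r → Vector Carrier r → V n
    cocombination c d k = ∑[ i < r ] (c i * a* i k + d i * b* i k)

    cocombination-a : ∀ c d j → pairing (cocombination c d) (a j) ≈ c j
    cocombination-a c d j = begin
      pairing (cocombination c d) (a j) ≈⟨ pairing-comm (cocombination c d) (a j) ⟩
      pairing (a j) (cocombination c d) ≈⟨ pairing-combination (a j) c d a* b* ⟩
      ∑[ i < r ] (c i * pairing (a j) (a* i) + d i * pairing (a j) (b* i))
        ≈⟨ sum-cong-≋ (λ i → trans (+-cong
             (*-congˡ (trans (pairing-comm (a j) (a* i)) (trans (a*a i j) (reflexive (δ-sym i j)))))
             (trans (*-congˡ (trans (pairing-comm (a j) (b* i)) (b*a i j))) (zeroʳ (d i))))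
             (trans (+-identityʳ _) (*-comm (c i) (δ j i)))) ⟩
      ∑[ i < r ] (δ j i * c i) ≈⟨ sum-δ j c ⟩
      c j ∎

    cocombination-b : ∀ c d j → pairing (cocombination c d) (b j) ≈ d j
    cocombination-b c d j = begin
      pairing (cocombination c d) (b j) ≈⟨ pairing-comm (cocombination c d) (b j) ⟩
      pairing (b j) (cocombination c d) ≈⟨ pairing-combination (b j) c d a* b* ⟩
      ∑[ i < r ] (c i * pairing (b j) (a* i) + d i * pairing (b j) (b* i))
        ≈⟨ sum-cong-≋ (λ i → trans (+-cong
             (trans (*-congˡ (trans (pairing-comm (b j) (a* i)) (a*b i j))) (zeroʳ (c i)))
             (*-congˡ (trans (pairing-comm (b j) (b* i)) (trans (b*b i j) (reflexive (δ-sym i j))))))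
             (trans (+-identityˡ _) (*-comm (d i) (δ j i)))) ⟩
      ∑[ i < r ] (δ j i * d i) ≈⟨ sum-δ j d ⟩
      d j ∎

    in-block : ∀ i v → (∀ j → j ≢ i → pairing (a* j) v ≈ 0#) → (∀ j → j ≢ i → pairing (b* j) v ≈ 0#) →
               v ≈ᵛ pairing (a* i) v ·ᵛ a i +ᵛ pairing (b* i) v ·ᵛ b i
    in-block i v a*≈0 b*≈0 k = trans (expand v k) (sum-single i λ j j≢i → trans
      (+-cong (trans (*-congʳ (a*≈0 j j≢i)) (zeroˡ _)) (trans (*-congʳ (b*≈0 j j≢i)) (zeroˡ _)))
      (+-identityʳ 0#))

    vector-ext : ∀ {u v} → (∀ i → pairing (a* i) u ≈ pairing (a* i) v) →
                 (∀ i → pairing (b* i) u ≈ pairing (b* i) v) → u ≈ᵛ v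
    vector-ext {u} {v} eqa eqb k = trans (expand u k)
      (trans (sum-cong-≋ (λ i → +-cong (*-congʳ {x = a i k} (eqa i)) (*-congʳ {x = b i k} (eqb i)))) (sym (expand v k)))

  module Decomposition {n r} (a b : Vector (V n) r)
                       {T : Tensor n} (T≈ : T ≈ᵀ ∑ᵀ (λ i → a i ²⊙ b i)) where
    contract-expand : ∀ f g k → (T ⌟ f ·ᴹ g) k ≈
      ∑[ s < r ] (κ * (pairing f (a s) * pairing g (a s)) * b s k +
                  κ * (pairing f (a s) * pairing g (b s) + pairing f (b s) * pairing g (a s)) * a s k)
    contract-expand f g k = trans (·ᴹ-cong (⌟-cong T≈ f) (λ _ → refl) k)
      (trans (∑ᵀ-contract (λ i → a i ²⊙ b i) f g k)
        (sum-cong-≋ (λ s → ²⊙-contract (a s) (b s) f g k)))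

    contract₂≈ : ∀ x → contract₂ x T ≈ᵛ T ⌟ x ·ᴹ x
    contract₂≈ x k = trans (contract₂-cong T≈ x k)
      (trans (∑ᵀ-contract₂ (λ i → a i ²⊙ b i) x k)
      (trans (sum-cong-≋ (λ s → ²⊙-contract₂ (a s) (b s) x k))
      (trans (sym (∑ᵀ-contract (λ i → a i ²⊙ b i) x x k))
             (sym (·ᴹ-cong (⌟-cong T≈ x) (λ _ → refl) k)))))

    pairing-contract : ∀ z f g → pairing z (T ⌟ f ·ᴹ g) ≈
      ∑[ s < r ] (κ * (pairing f (a s) * pairing g (a s)) * pairing z (b s) +
                  κ * (pairing f (a s) * pairing g (b s) + pairing f (b s) * pairing g (a s)) * pairing z (a s))
    pairing-contract z f g = trans (pairing-cong {u = z} (λ _ → refl) (contract-expand f g))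
      (pairing-combination z (λ s → κ * (pairing f (a s) * pairing g (a s)))
         (λ s → κ * (pairing f (a s) * pairing g (b s) + pairing f (b s) * pairing g (a s))) b a)

  module FramedDecomposition {n r} {a b : Vector (V n) r} (frame : Frame a b)
                             {T : Tensor n} (T≈ : T ≈ᵀ ∑ᵀ (λ i → a i ²⊙ b i)) where
    open Frame frame
    open Decomposition a b T≈ public

    a*-contract : ∀ i f g → pairing (a* i) (T ⌟ f ·ᴹ g) ≈
      κ * (pairing f (a i) * pairing g (b i) + pairing f (b i) * pairing g (a i))
    a*-contract i f g = begin
      pairing (a* i) (T ⌟ f ·ᴹ g) ≈⟨ pairing-contract (a* i) f g ⟩
      ∑[ s < r ] (y s * pairing (a* i) (b s) + x s * pairing (a* i) (a s))
        ≈⟨ sum-cong-≋ (λ s → trans (+-cong (trans (*-congˡ (a*b i s)) (zeroʳ (y s))) (*-congˡ (a*a i s)))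
             (trans (+-identityˡ _) (*-comm (x s) (δ i s)))) ⟩
      ∑[ s < r ] (δ i s * x s) ≈⟨ sum-δ i x ⟩
      x i ∎
      where
      x y : Fin r → Carrier
      x s = κ * (pairing f (a s) * pairing g (b s) + pairing f (b s) * pairing g (a s))
      y s = κ * (pairing f (a s) * pairing g (a s))

    b*-contract : ∀ i f g → pairing (b* i) (T ⌟ f ·ᴹ g) ≈ κ * (pairing f (a i) * pairing g (a i))
    b*-contract i f g = begin
      pairing (b* i) (T ⌟ f ·ᴹ g) ≈⟨ pairing-contract (b* i) f g ⟩
      ∑[ s < r ] (y s * pairing (b* i) (b s) + x s * pairing (b* i) (a s))
        ≈⟨ sum-cong-≋ (λ s → trans (+-cong (*-congˡ (b*b i s)) (trans (*-congˡ (b*a i s)) (zeroʳ (x s))))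
             (trans (+-identityʳ _) (*-comm (y s) (δ i s)))) ⟩
      ∑[ s < r ] (δ i s * y s) ≈⟨ sum-δ i y ⟩
      y i ∎
      where
      x y : Fin r → Carrier
      x s = κ * (pairing f (a s) * pairing g (b s) + pairing f (b s) * pairing g (a s))
      y s = κ * (pairing f (a s) * pairing g (a s))

  -- Independence and exchange

  combination : ∀ {n r} (a b : Vector (V n) r) → Vector Carrier r → Vector Carrier r → V n
  combination {r = r} a b c d k = ∑[ i < r ] (c i * a i k + d i * b i k)

  Independent : ∀ {n r} (a b : Vector (V n) r) → Set
  Independent a b = ∀ c d → combination a b c d ≈ᵛ 0ᵛ → (∀ i → c i ≈ 0#) × (∀ i → d i ≈ 0#)

  combination-+· : ∀ {n r} (a b : Vector (V n) r) c d c′ d′ x k →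
    combination a b (λ i → c i + x * c′ i) (λ i → d i + x * d′ i) k ≈
    combination a b c d k + x * combination a b c′ d′ k
  combination-+· a b c d c′ d′ x k = trans
    (sum-cong-≋ (λ i → solve 7 (λ c d c′ d′ x a b →
        (c :+ x :* c′) :* a :+ (d :+ x :* d′) :* b := (c :* a :+ d :* b) :+ x :* (c′ :* a :+ d′ :* b))
      refl (c i) (d i) (c′ i) (d′ i) x (a i k) (b i k)))
    (trans (∑-distrib-+ (λ i → c i * a i k + d i * b i k) (λ i → x * (c′ i * a i k + d′ i * b i k)))
      (+-congˡ (sym (*-distribˡ-sum x (λ i → c′ i * a i k + d′ i * b i k)))))

  independent-unique : ∀ {n r} {a b : Vector (V n) r} → Independent a b → ∀ c d c′ d′ →
    combination a b c d ≈ᵛ combination a b c′ d′ → (∀ i → c i ≈ c′ i) × (∀ i → d i ≈ d′ i)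
  independent-unique {a = a} {b} indep c d c′ d′ eq =
    (λ i → equal (proj₁ zeros i)) , (λ i → equal (proj₂ zeros i))
    where
    zeros = indep (λ i → c i + - 1# * c′ i) (λ i → d i + - 1# * d′ i) λ k → begin
      combination a b (λ i → c i + - 1# * c′ i) (λ i → d i + - 1# * d′ i) k
        ≈⟨ combination-+· a b c d c′ d′ (- 1#) k ⟩
      combination a b c d k + - 1# * combination a b c′ d′ k
        ≈⟨ +-cong (eq k) (-1*x≈-x _) ⟩
      combination a b c′ d′ k - combination a b c′ d′ k
        ≈⟨ -‿inverseʳ _ ⟩
      0# ∎
    equal : ∀ {x y} → x + - 1# * y ≈ 0# → x ≈ y
    equal {x} {y} eq = x∙y⁻¹≈ε⇒x≈y x y (trans (+-congˡ (sym (-1*x≈-x y))) eq)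

  -- The coframe expands `a j` and `b j` in the family itself; independence forces this expansion to
  -- be the trivial one, which is the duality relation.
  independent⇒frame : ∀ {n r} {a b : Vector (V n) r} → Coframe a b → Independent a b → Frame a b
  independent⇒frame {n} {r} {a} {b} coframe indep = record
    { coframe = coframe
    ; a*a = λ i j → trans (proj₁ (a-coordinates j) i) (reflexive (δ-sym j i))
    ; a*b = λ i j → proj₁ (b-coordinates j) i
    ; b*a = λ i j → proj₂ (a-coordinates j) i
    ; b*b = λ i j → trans (proj₂ (b-coordinates j) i) (reflexive (δ-sym j i))
    }
    where
    open Coframe coframe
    a-coordinates : ∀ j → (∀ i → pairing (a* i) (a j) ≈ δ j i) × (∀ i → pairing (b* i) (a j) ≈ 0#)
    a-coordinates j = independent-unique indep
      (λ i → pairing (a* i) (a j)) (λ i → pairing (b* i) (a j)) (δ j) (λ _ → 0#) λ k → begin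
      _ ≈⟨ expand (a j) k ⟨
      a j k ≈⟨ sum-δ j (λ i → a i k) ⟨
      ∑[ i < r ] (δ j i * a i k) ≈⟨ sum-cong-≋ (λ i → trans (+-congˡ (zeroˡ (b i k))) (+-identityʳ (δ j i * a i k))) ⟨
      ∑[ i < r ] (δ j i * a i k + 0# * b i k) ∎
    b-coordinates : ∀ j → (∀ i → pairing (a* i) (b j) ≈ 0#) × (∀ i → pairing (b* i) (b j) ≈ δ j i)
    b-coordinates j = independent-unique indep
      (λ i → pairing (a* i) (b j)) (λ i → pairing (b* i) (b j)) (λ _ → 0#) (δ j) λ k → begin
      _ ≈⟨ expand (b j) k ⟨
      b j k ≈⟨ sum-δ j (λ i → b i k) ⟨
      ∑[ i < r ] (δ j i * b i k) ≈⟨ sum-cong-≋ (λ i → trans (+-congʳ (zeroˡ (a i k))) (+-identityˡ (δ j i * b i k))) ⟨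
      ∑[ i < r ] (0# * a i k + δ j i * b i k) ∎

  frame⇒independent : ∀ {n r} {a b : Vector (V n) r} → Frame a b → Independent a b
  frame⇒independent {n} {r} {a} {b} frame c d eq =
    (λ j → begin
      c j ≈⟨ sum-δ j c ⟨
      ∑[ i < r ] (δ j i * c i)
        ≈⟨ sum-cong-≋ (λ i → trans (+-cong (trans (*-congˡ (a*a j i)) (*-comm (c i) (δ j i))) (trans (*-congˡ (a*b j i)) (zeroʳ (d i)))) (+-identityʳ (δ j i * c i))) ⟨
      ∑[ i < r ] (c i * pairing (a* j) (a i) + d i * pairing (a* j) (b i)) ≈⟨ pairing-combination (a* j) c d a b ⟨
      pairing (a* j) (combination a b c d) ≈⟨ pairing-cong {u = a* j} (λ _ → refl) eq ⟩
      pairing (a* j) 0ᵛ ≈⟨ pairing-0ʳ (a* j) ⟩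
      0# ∎) ,
    (λ j → begin
      d j ≈⟨ sum-δ j d ⟨
      ∑[ i < r ] (δ j i * d i)
        ≈⟨ sum-cong-≋ (λ i → trans (+-cong (trans (*-congˡ (b*a j i)) (zeroʳ (c i))) (trans (*-congˡ (b*b j i)) (*-comm (d i) (δ j i)))) (+-identityˡ (δ j i * d i))) ⟨
      ∑[ i < r ] (c i * pairing (b* j) (a i) + d i * pairing (b* j) (b i)) ≈⟨ pairing-combination (b* j) c d a b ⟨
      pairing (b* j) (combination a b c d) ≈⟨ pairing-cong {u = b* j} (λ _ → refl) eq ⟩
      pairing (b* j) 0ᵛ ≈⟨ pairing-0ʳ (b* j) ⟩
      0# ∎)
    where open Frame frame

  direct-sum⇒frame : ∀ {n r} {a b : Vector (V n) r} →
    (∀ i → LinearlyIndependent (a i ∷ b i ∷ [])) →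
    InDirectSum (λ i → ⟨ a i , b i ⟩) → WholeSpaceIsSum (λ i → ⟨ a i , b i ⟩) → Frame a b
  direct-sum⇒frame {n} {r} {a} {b} indep direct whole = independent⇒frame coframe independent
    where
    -- The covectors are read off from the standard basis: the coefficients of e_l in the i-th plane
    -- are the l-th entries of `a* i` and `b* i`.
    coefficient : Fin n → Fin r → Fin 2 → Carrier
    coefficient l i = proj₁ (proj₁ (proj₂ (whole (δ l))) i)
    coframe : Coframe a b
    coframe = record
      { a* = λ i l → coefficient l i zero
      ; b* = λ i l → coefficient l i (suc zero)
      ; complete = λ k l → let u , u∈ , δ≈ = whole (δ l) in begin
          ∑[ i < r ] (a i k * coefficient l i zero + b i k * coefficient l i (suc zero))
            ≈⟨ sum-cong-≋ (λ i → trans (proj₂ (u∈ i) k)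
                 (+-cong (*-comm (coefficient l i zero) (a i k))
                   (trans (+-identityʳ _) (*-comm (coefficient l i (suc zero)) (b i k))))) ⟨
          ∑[ i < r ] u i k ≈⟨ δ≈ k ⟨
          δ l k ≈⟨ reflexive (δ-sym l k) ⟩
          δ k l ∎
      }
    independent : Independent a b
    independent c d eq =
      (λ i → indep i (c i ∷ d i ∷ []) (block i) zero) , (λ i → indep i (c i ∷ d i ∷ []) (block i) (suc zero))
      where
      block : ∀ i → ∑ᵛ (λ s → (c i ∷ d i ∷ []) s ·ᵛ (a i ∷ b i ∷ []) s) ≈ᵛ 0ᵛ
      block i k = trans (+-congˡ (+-identityʳ _)) (direct (λ i → c i ·ᵛ a i +ᵛ d i ·ᵛ b i)
        (λ i → c i ∷ d i ∷ [] , λ k → +-congˡ (sym (+-identityʳ _))) eq i k)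

  -- Exchange: comparing a basis with a spanning family.

  sum-++ : ∀ m {n} (t : Vector Carrier (m ℕ.+ n)) → sum t ≈ sum (t ∘ (_↑ˡ n)) + sum (t ∘ (m ↑ʳ_))
  sum-++ zero    t = sym (+-identityˡ _)
  sum-++ (suc m) t = trans (+-congˡ (sum-++ m (tail t))) (sym (+-assoc _ _ _))

  pairing-++ : ∀ {m n} (u : V m) (w : V n) (x : V (m ℕ.+ n)) →
    pairing (u ++ w) x ≈ pairing u (x ∘ (_↑ˡ n)) + pairing w (x ∘ (m ↑ʳ_))
  pairing-++ {m} {n} u w x = trans (sum-++ m (λ i → (u ++ w) i * x i)) (+-cong
    (sum-cong-≋ (λ i → *-congʳ {x = x (i ↑ˡ n)} (reflexive (lookup-++ˡ u w i))))
    (sum-cong-≋ (λ i → *-congʳ {x = x (m ↑ʳ i)} (reflexive (lookup-++ʳ u w i)))))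

  split-zero : ∀ m {n} (x : V (m ℕ.+ n)) → (∀ i → x (i ↑ˡ n) ≈ 0#) → (∀ i → x (m ↑ʳ i) ≈ 0#) → x ≈ᵛ 0ᵛ
  split-zero m {n} x left right i with splitAt m i | join-splitAt m n i
  ... | inj₁ j | ≡.refl = left j
  ... | inj₂ j | ≡.refl = right j

  trivial-kernel⇒≤ : ∀ {m n} (A : Fin m → V n) → (∀ x → Kernel A x → x ≈ᵛ 0ᵛ) → n ℕ.≤ m
  trivial-kernel⇒≤ A trivial = ℕ.≮⇒≥ λ m<n →
    let x , x≉0 , ker = underdetermined m<n A in x≉0 (trivial x ker)

  module Exchange {n r s} {a b : Vector (V n) r} {a′ b′ : Vector (V n) s}
                  (frame : Frame a b) (coframe′ : Coframe a′ b′) where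
    open Coframe coframe′ using () renaming (a* to a′*; b* to b′*; expand to expand′)

    vector : V (r ℕ.+ r) → V n
    vector x = combination a b (x ∘ (_↑ˡ r)) (x ∘ (r ↑ʳ_))

    coordinates : V n → V (r ℕ.+ r)
    coordinates y = (λ i → pairing y (a i)) ++ (λ i → pairing y (b i))

    pairing-coordinates : ∀ y x → pairing (coordinates y) x ≈ pairing y (vector x)
    pairing-coordinates y x = trans (pairing-++ (λ i → pairing y (a i)) (λ i → pairing y (b i)) x)
      (trans (sym (∑-distrib-+ (λ i → pairing y (a i) * x (i ↑ˡ r)) (λ i → pairing y (b i) * x (r ↑ʳ i))))
      (trans (sum-cong-≋ (λ i → +-cong (*-comm (pairing y (a i)) (x (i ↑ˡ r))) (*-comm (pairing y (b i)) (x (r ↑ʳ i)))))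
             (sym (pairing-combination y (x ∘ (_↑ˡ r)) (x ∘ (r ↑ʳ_)) a b))))

    vector-injective : ∀ x → vector x ≈ᵛ 0ᵛ → x ≈ᵛ 0ᵛ
    vector-injective x eq = let left , right = frame⇒independent frame _ _ eq in split-zero r x left right

    -- The change of coordinates: it takes the coordinates of a vector in the frame to those which
    -- the coframe assigns to the same vector.
    transition : Fin (s ℕ.+ s) → V (r ℕ.+ r)
    transition = (coordinates ∘ a′*) ++ (coordinates ∘ b′*)

    transition-left : ∀ j → transition (j ↑ˡ s) ≡ coordinates (a′* j)
    transition-left = lookup-++ˡ (coordinates ∘ a′*) (coordinates ∘ b′*)

    transition-right : ∀ j → transition (s ↑ʳ j) ≡ coordinates (b′* j)
    transition-right = lookup-++ʳ (coordinates ∘ a′*) (coordinates ∘ b′*)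

    transition-applyˡ : ∀ j x → pairing (transition (j ↑ˡ s)) x ≈ pairing (a′* j) (vector x)
    transition-applyˡ j x = trans
      (reflexive (≡.cong (λ y → pairing y x) (transition-left j))) (pairing-coordinates (a′* j) x)

    transition-applyʳ : ∀ j x → pairing (transition (s ↑ʳ j)) x ≈ pairing (b′* j) (vector x)
    transition-applyʳ j x = trans
      (reflexive (≡.cong (λ y → pairing y x) (transition-right j))) (pairing-coordinates (b′* j) x)

    -- Adding τ times a relation leaves a combination unchanged, so `vector x` vanishes as soon as
    -- its shifted coordinates do. Minimality takes τ = 0; for independence τ is the unknown
    -- belonging to the additional column.
    relation-trivial : ∀ c d → combination a′ b′ c d ≈ᵛ 0ᵛ → ∀ τ x →
      (∀ j → pairing (a′* j) (vector x) + τ * c j ≈ 0#) → (∀ j → pairing (b′* j) (vector x) + τ * d j ≈ 0#) →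
      x ≈ᵛ 0ᵛ
    relation-trivial c d eq τ x eqa eqb = vector-injective x λ k → begin
      vector x k ≈⟨ expand′ (vector x) k ⟩
      combination a′ b′ α β k ≈⟨ +-identityʳ _ ⟨
      combination a′ b′ α β k + 0# ≈⟨ +-congˡ (trans (*-congˡ (eq k)) (zeroʳ τ)) ⟨
      combination a′ b′ α β k + τ * combination a′ b′ c d k ≈⟨ combination-+· a′ b′ α β c d τ k ⟨
      combination a′ b′ (λ i → α i + τ * c i) (λ i → β i + τ * d i) k
        ≈⟨ sum-zero (λ i → trans (+-cong (trans (*-congʳ (eqa i)) (zeroˡ _)) (trans (*-congʳ (eqb i)) (zeroˡ _))) (+-identityʳ 0#)) ⟩
      0# ∎
      where
      α β : Vector Carrier s
      α j = pairing (a′* j) (vector x)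
      β j = pairing (b′* j) (vector x)

    -- The transition matrix has 2s rows, 2r columns and trivial kernel, so 2r ≤ 2s.
    frame-minimal : r ℕ.≤ s
    frame-minimal = ℕ.≮⇒≥ λ s<r → ℕ.<⇒≱ (ℕ.+-mono-< s<r s<r)
      (trivial-kernel⇒≤ transition λ x ker →
        relation-trivial (λ _ → 0#) (λ _ → 0#)
          (λ k → sum-zero (λ i → trans (+-cong (zeroˡ (a′ i k)) (zeroˡ (b′ i k))) (+-identityʳ 0#))) 0# x
          (λ j → trans (+-cong (trans (sym (transition-applyˡ j x)) (ker (j ↑ˡ s))) (zeroʳ 0#)) (+-identityʳ 0#))
          (λ j → trans (+-cong (trans (sym (transition-applyʳ j x)) (ker (s ↑ʳ j))) (zeroʳ 0#)) (+-identityʳ 0#)))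

    -- A nontrivial relation among the vectors of the coframe would provide an
    -- additional column without destroying injectivity.
    spanning⇒independent : s ≡ r → Independent a′ b′
    spanning⇒independent ≡.refl c d eq with 0ᵛ? (c ++ d)
    ... | yes w≈0 =
      (λ i → trans (reflexive (≡.sym (lookup-++ˡ c d i))) (w≈0 (i ↑ˡ s))) ,
      (λ i → trans (reflexive (≡.sym (lookup-++ʳ c d i))) (w≈0 (s ↑ʳ i)))
    ... | no  w≉0 = contradiction (trivial-kernel⇒≤ A trivial) ℕ.1+n≰n
      where
      A : Fin (s ℕ.+ s) → V (suc (s ℕ.+ s))
      A j = (c ++ d) j ∷ transition j
      trivial : ∀ x → Kernel A x → x ≈ᵛ 0ᵛ
      trivial x ker = λ { zero → τ≈0 ; (suc i) → rest≈0 i }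
        where
        τ = x zero
        rest≈0 : tail x ≈ᵛ 0ᵛ
        rest≈0 = relation-trivial c d eq τ (tail x)
          (λ j → trans (+-comm _ _) (trans (+-cong
            (trans (*-comm τ (c j)) (*-congʳ (reflexive (≡.sym (lookup-++ˡ c d j)))))
            (sym (transition-applyˡ j (tail x)))) (ker (j ↑ˡ s))))
          (λ j → trans (+-comm _ _) (trans (+-cong
            (trans (*-comm τ (d j)) (*-congʳ (reflexive (≡.sym (lookup-++ʳ c d j)))))
            (sym (transition-applyʳ j (tail x)))) (ker (s ↑ʳ j))))
        -- Once the tail vanishes, the row of `A` at a nonzero coefficient of the relation reads:
        -- coefficient times τ is zero.
        entry = nonzero-entry (c ++ d) w≉0
        τ≈0 : τ ≈ 0#
        τ≈0 = x*y≈0⇒y≈0 (proj₂ entry) (begin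
          (c ++ d) (proj₁ entry) * τ ≈⟨ +-identityʳ _ ⟨
          (c ++ d) (proj₁ entry) * τ + 0# ≈⟨ +-congˡ (trans (pairing-cong {u = transition (proj₁ entry)} (λ _ → refl) rest≈0) (pairing-0ʳ (transition (proj₁ entry)))) ⟨
          (c ++ d) (proj₁ entry) * τ + pairing (transition (proj₁ entry)) (tail x) ≈⟨ ker (proj₁ entry) ⟩
          0# ∎)

  module SixInvertible (3!≉0 : 3! ≉ 0#) where

    private
      3!≈2*3 : 3! ≈ (1# + 1#) * (1# + 1# + 1#)
      3!≈2*3 = solve 0 (con 1 :+ con 1 :+ con 1 :+ con 1 :+ con 1 :+ con 1
                         := (con 1 :+ con 1) :* (con 1 :+ con 1 :+ con 1)) refl

    2≉0 : 1# + 1# ≉ 0#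
    2≉0 2≈0 = 3!≉0 (trans 3!≈2*3 (trans (*-congʳ 2≈0) (zeroˡ _)))

    -- Contracting a³ yields 3κ p(f) p(g) a; the component of a second vector along a is detected
    -- through this multiple.
    3≉0 : 1# + 1# + 1# ≉ 0#
    3≉0 3≈0 = 3!≉0 (trans 3!≈2*3 (trans (*-congˡ 3≈0) (zeroʳ _)))

    κ≉0 : κ ≉ 0#
    κ≉0 = *-nonzero (λ eq → 1≉0 (trans (sym (inverseʳ 3!≉0)) (trans (*-congˡ eq) (zeroʳ 3!)))) 2≉0

    ²⊙-cong : ∀ {n} {a a′ b b′ : V n} → a ≈ᵛ a′ → b ≈ᵛ b′ → a ²⊙ b ≈ᵀ a′ ²⊙ b′
    ²⊙-cong {a = a} {a′} {b} {b′} a≈ b≈ i j k = trans (²⊙-entry a b i j k) (trans (*-congˡ (+-cong (+-cong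
      (*-cong (*-cong (a≈ i) (a≈ j)) (b≈ k))
      (*-cong (*-cong (a≈ i) (b≈ j)) (a≈ k)))
      (*-cong (*-cong (b≈ i) (a≈ j)) (a≈ k)))) (sym (²⊙-entry a′ b′ i j k)))

    ²⊙-rescale : ∀ {n} (a b : V n) {c z} → c * c * z ≈ 1# → (c ·ᵛ a) ²⊙ (z ·ᵛ b) ≈ᵀ a ²⊙ b
    ²⊙-rescale a b {c} {z} ccz≈1 i j k = begin
      ((c ·ᵛ a) ²⊙ (z ·ᵛ b)) i j k ≈⟨ ²⊙-entry (c ·ᵛ a) (z ·ᵛ b) i j k ⟩
      _ ≈⟨ solve 9 (λ s c w x y z x′ y′ z′ →
             s :* (c :* x :* (c :* y) :* (w :* z′) :+ c :* x :* (w :* y′) :* (c :* z) :+ w :* x′ :* (c :* y) :* (c :* z))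
             := (c :* c :* w) :* (s :* (x :* y :* z′ :+ x :* y′ :* z :+ x′ :* y :* z)))
             refl κ c z (a i) (a j) (a k) (b i) (b j) (b k) ⟩
      (c * c * z) * _ ≈⟨ trans (*-congʳ ccz≈1) (*-identityˡ _) ⟩
      _ ≈⟨ ²⊙-entry a b i j k ⟨
      (a ²⊙ b) i j k ∎

    -- The algorithm

    pencil : ∀ {n} (A B : Matrix n) μ x i → ((A -[ μ ] B) ·ᴹ x) i ≈ (A ·ᴹ x) i - μ * (B ·ᴹ x) i
    pencil A B μ x i = trans
      (sum-cong-≋ (λ j → *-congʳ {x = x j} (+-congˡ (-‿distribˡ-* μ (B i j)))))
      (trans (pairing-+ˡ x (A i) (B i) (- μ)) (+-congˡ (sym (-‿distribˡ-* μ _))))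

    cancel-distinct : ∀ {u v x} → u ≉ v → u * x ≈ v * x → x ≈ 0#
    cancel-distinct {u} {v} {x} u≉v ux≈vx with x ≟ 0#
    ... | yes x≈0 = x≈0
    ... | no  x≉0 = contradiction (*-cancelˡ x≉0 (trans (*-comm x u) (trans ux≈vx (*-comm v x)))) u≉v

    ∈⟨,⟩ : ∀ {n} {u a b : V n} → u ∈ ⟨ a , b ⟩ → ∃[ x ] ∃[ y ] u ≈ᵛ x ·ᵛ a +ᵛ y ·ᵛ b
    ∈⟨,⟩ (c , u≈) = c zero , c (suc zero) , λ k → trans (u≈ k) (+-congˡ (+-identityʳ _))

    ⟨,⟩∋ : ∀ {n} {a b : V n} x y {u} → u ≈ᵛ x ·ᵛ a +ᵛ y ·ᵛ b → u ∈ ⟨ a , b ⟩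
    ⟨,⟩∋ x y u≈ = x ∷ y ∷ [] , λ k → trans (u≈ k) (+-congˡ (sym (+-identityʳ _)))

    left∈⟨,⟩ : ∀ {n} (a b : V n) → a ∈ ⟨ a , b ⟩
    left∈⟨,⟩ a b = ⟨,⟩∋ 1# 0# λ k → sym (trans (+-cong (*-identityˡ _) (zeroˡ _)) (+-identityʳ _))

    right∈⟨,⟩ : ∀ {n} (a b : V n) → b ∈ ⟨ a , b ⟩
    right∈⟨,⟩ a b = ⟨,⟩∋ 0# 1# λ k → sym (trans (+-cong (zeroˡ _) (*-identityˡ _)) (+-identityˡ _))

    -- The conditions in turn: `fa≉0` keeps the images T_f x nonzero, `ga≉0` makes the eigenvalues
    -- finite, `ratios` separates them, and `nondegenerate` makes each block of the pencil a genuine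
    -- Jordan block, with one eigenvector up to scaling.
    module Run {n r} {a b : Vector (V n) r} (frame : Frame a b)
               {T : Tensor n} (T≈ : T ≈ᵀ ∑ᵀ (λ i → a i ²⊙ b i)) (f g : V n)
               (fa≉0 : ∀ i → pairing f (a i) ≉ 0#) (ga≉0 : ∀ i → pairing g (a i) ≉ 0#)
               (ratios : ∀ {i j} → i ≢ j →
                 pairing f (a i) * pairing g (a j) ≉ pairing f (a j) * pairing g (a i))
               (nondegenerate : ∀ i → pairing f (b i) * pairing g (a i) ≉ pairing f (a i) * pairing g (b i))
               where
      open Frame frame
      open FramedDecomposition frame T≈

      P Q P′ Q′ : Fin r → Carrier
      P  i = pairing f (a i)
      Q  i = pairing f (b i)
      P′ i = pairing g (a i)
      Q′ i = pairing g (b i)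

      Eigenvalue : Carrier → Fin r → Set
      Eigenvalue μ i = P i ≈ μ * P′ i

      eigenvalue-index-unique : ∀ {μ i j} → Eigenvalue μ i → Eigenvalue μ j → i ≡ j
      eigenvalue-index-unique {μ} {i} {j} μi μj = decidable-stable (i Fin.≟ j) λ i≢j → ratios i≢j (begin
        P i * P′ j         ≈⟨ *-congʳ μi ⟩
        μ * P′ i * P′ j    ≈⟨ solve 3 (λ m x y → m :* x :* y := m :* y :* x) refl μ (P′ i) (P′ j) ⟩
        μ * P′ j * P′ i    ≈⟨ *-congʳ μj ⟨
        P j * P′ i         ∎)

      module Eigenvector {μ x} (x≉0 : ¬ x ≈ᵛ 0ᵛ) (ker : ((T ⌟ f) -[ μ ] (T ⌟ g)) ·ᴹ x ≈ᵛ 0ᵛ) where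

        Tfx≈μTgx : T ⌟ f ·ᴹ x ≈ᵛ μ ·ᵛ (T ⌟ g ·ᴹ x)
        Tfx≈μTgx k = x∙y⁻¹≈ε⇒x≈y _ _ (trans (sym (pencil (T ⌟ f) (T ⌟ g) μ x k)) (ker k))

        b*-equation : ∀ i → P i * pairing x (a i) ≈ μ * P′ i * pairing x (a i)
        b*-equation i = *-cancelˡ κ≉0 (begin
          κ * (P i * pairing x (a i)) ≈⟨ b*-contract i f x ⟨
          pairing (b* i) (T ⌟ f ·ᴹ x) ≈⟨ pairing-cong {u = b* i} (λ _ → refl) Tfx≈μTgx ⟩
          pairing (b* i) (μ ·ᵛ (T ⌟ g ·ᴹ x)) ≈⟨ pairing-·ʳ (b* i) (T ⌟ g ·ᴹ x) μ ⟩
          μ * pairing (b* i) (T ⌟ g ·ᴹ x) ≈⟨ *-congˡ (b*-contract i g x) ⟩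
          μ * (κ * (P′ i * pairing x (a i)))
            ≈⟨ solve 4 (λ m c p x → m :* (c :* (p :* x)) := c :* (m :* p :* x)) refl μ κ (P′ i) (pairing x (a i)) ⟩
          κ * (μ * P′ i * pairing x (a i)) ∎)

        a*-equation : ∀ i → P i * pairing x (b i) + Q i * pairing x (a i) ≈
                            μ * P′ i * pairing x (b i) + μ * Q′ i * pairing x (a i)
        a*-equation i = *-cancelˡ κ≉0 (begin
          κ * (P i * pairing x (b i) + Q i * pairing x (a i)) ≈⟨ a*-contract i f x ⟨
          pairing (a* i) (T ⌟ f ·ᴹ x) ≈⟨ pairing-cong {u = a* i} (λ _ → refl) Tfx≈μTgx ⟩
          pairing (a* i) (μ ·ᵛ (T ⌟ g ·ᴹ x)) ≈⟨ pairing-·ʳ (a* i) (T ⌟ g ·ᴹ x) μ ⟩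
          μ * pairing (a* i) (T ⌟ g ·ᴹ x) ≈⟨ *-congˡ (a*-contract i g x) ⟩
          μ * (κ * (P′ i * pairing x (b i) + Q′ i * pairing x (a i)))
            ≈⟨ solve 6 (λ m c p q x y → m :* (c :* (p :* y :+ q :* x)) := c :* (m :* p :* y :+ m :* q :* x))
                 refl μ κ (P′ i) (Q′ i) (pairing x (a i)) (pairing x (b i)) ⟩
          κ * (μ * P′ i * pairing x (b i) + μ * Q′ i * pairing x (a i)) ∎)

        -- Away from the eigenvalue `b*-equation` suffices. In its own block P = μP′ cancels the
        -- terms with q(x) in `a*-equation` and leaves Q p(x) = μQ′ p(x), where `nondegenerate`
        -- excludes Q = μQ′.
        x∙a≈0 : ∀ i → pairing x (a i) ≈ 0#
        x∙a≈0 i with P i ≟ μ * P′ i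
        ... | no  Pi≉ = cancel-distinct Pi≉ (b*-equation i)
        ... | yes Pi≈ = cancel-distinct Q≉μQ′ (+-cancelˡ _ _ _ (trans (a*-equation i) (+-congʳ (*-congʳ (sym Pi≈)))))
          where
          Q≉μQ′ : Q i ≉ μ * Q′ i
          Q≉μQ′ Q≈μQ′ = nondegenerate i (begin
            Q i * P′ i ≈⟨ *-congʳ Q≈μQ′ ⟩
            μ * Q′ i * P′ i ≈⟨ solve 3 (λ m x y → m :* x :* y := m :* y :* x) refl μ (Q′ i) (P′ i) ⟩
            μ * P′ i * Q′ i ≈⟨ *-congʳ Pi≈ ⟨
            P i * Q′ i ∎)

        x∙b≈0 : ∀ i → ¬ Eigenvalue μ i → pairing x (b i) ≈ 0#
        x∙b≈0 i Pi≉ = cancel-distinct Pi≉ (begin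
          P i * pairing x (b i) ≈⟨ drop (Q i) ⟨
          P i * pairing x (b i) + Q i * pairing x (a i) ≈⟨ a*-equation i ⟩
          μ * P′ i * pairing x (b i) + μ * Q′ i * pairing x (a i) ≈⟨ drop (μ * Q′ i) ⟩
          μ * P′ i * pairing x (b i) ∎)
          where
          drop : ∀ {y} c → y + c * pairing x (a i) ≈ y
          drop c = trans (+-congˡ (trans (*-congˡ (x∙a≈0 i)) (zeroʳ c))) (+-identityʳ _)

        has-index : ∃[ i ] Eigenvalue μ i
        has-index with any? (λ i → P i ≟ μ * P′ i)
        ... | yes i = i
        ... | no ¬i = contradiction (covector-zero x x∙a≈0 (λ i → x∙b≈0 i λ μi → ¬i (i , μi))) x≉0

        index : Fin r
        index = proj₁ has-index

        x∙b-off : ∀ j → j ≢ index → pairing x (b j) ≈ 0#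
        x∙b-off j j≢ = x∙b≈0 j λ μj → j≢ (eigenvalue-index-unique μj (proj₂ has-index))

        x∙b≉0 : pairing x (b index) ≉ 0#
        x∙b≉0 eq = x≉0 (covector-zero x x∙a≈0 λ j → case j (j Fin.≟ index))
          where
          case : ∀ j → Dec (j ≡ index) → pairing x (b j) ≈ 0#
          case j (yes ≡.refl) = eq
          case j (no j≢)      = x∙b-off j j≢

        scale : Carrier
        scale = κ * (P index * pairing x (b index))

        scale≉0 : scale ≉ 0#
        scale≉0 = *-nonzero κ≉0 (*-nonzero (fa≉0 index) x∙b≉0)

        image : T ⌟ f ·ᴹ x ≈ᵛ scale ·ᵛ a index
        image k = begin
          (T ⌟ f ·ᴹ x) k
            ≈⟨ in-block index (T ⌟ f ·ᴹ x)
                 (λ j j≢ → trans (coordinate j) (trans (*-congˡ (trans (*-congˡ (x∙b-off j j≢)) (zeroʳ _))) (zeroʳ _)))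
                 (λ j _ → b*-zero j) k ⟩
          pairing (a* index) (T ⌟ f ·ᴹ x) * a index k + pairing (b* index) (T ⌟ f ·ᴹ x) * b index k
            ≈⟨ +-cong (*-congʳ (coordinate index)) (trans (*-congʳ (b*-zero index)) (zeroˡ _)) ⟩
          scale * a index k + 0# ≈⟨ +-identityʳ _ ⟩
          scale * a index k ∎
          where
          coordinate : ∀ j → pairing (a* j) (T ⌟ f ·ᴹ x) ≈ κ * (P j * pairing x (b j))
          coordinate j = trans (a*-contract j f x) (*-congˡ
            (trans (+-congˡ (trans (*-congˡ (x∙a≈0 j)) (zeroʳ _))) (+-identityʳ _)))
          b*-zero : ∀ j → pairing (b* j) (T ⌟ f ·ᴹ x) ≈ 0#
          b*-zero j = trans (b*-contract j f x)
            (trans (*-congˡ (trans (*-congˡ (x∙a≈0 j)) (zeroʳ _))) (zeroʳ κ))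

      b*≉0 : ∀ i → ¬ b* i ≈ᵛ 0ᵛ
      b*≉0 i b*≈0 = 1≉0 (begin
        1#                    ≈⟨ δ-diag i ⟨
        δ i i                 ≈⟨ b*b i i ⟨
        pairing (b* i) (b i)  ≈⟨ trans (pairing-cong {v = b i} b*≈0 (λ _ → refl)) (pairing-comm 0ᵛ (b i)) ⟩
        pairing (b i) 0ᵛ      ≈⟨ pairing-0ʳ (b i) ⟩
        0#                    ∎)

      -- T_h maps `b* i` to κ p_i(h) `a i` for every h, so its images under T_f and T_g are parallel
      -- with ratio p_i(f) / p_i(g).
      b*-eigenvector : ∀ {μ i} → Eigenvalue μ i → ((T ⌟ f) -[ μ ] (T ⌟ g)) ·ᴹ b* i ≈ᵛ 0ᵛ
      b*-eigenvector {μ} {i} μi k = trans (pencil (T ⌟ f) (T ⌟ g) μ (b* i) k)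
        (x≈y⇒x∙y⁻¹≈ε (vector-ext {T ⌟ f ·ᴹ b* i} {μ ·ᵛ (T ⌟ g ·ᴹ b* i)} a*-equal b*-equal k))
        where
        a*-coordinate : ∀ h j → pairing (a* j) (T ⌟ h ·ᴹ b* i) ≈ κ * (pairing h (a j) * δ i j)
        a*-coordinate h j = trans (a*-contract j h (b* i)) (*-congˡ (trans
          (+-cong (*-congˡ (b*b i j)) (trans (*-congˡ (b*a i j)) (zeroʳ _))) (+-identityʳ _)))
        b*-coordinate : ∀ h j → pairing (b* j) (T ⌟ h ·ᴹ b* i) ≈ 0#
        b*-coordinate h j = trans (b*-contract j h (b* i))
          (trans (*-congˡ (trans (*-congˡ (b*a i j)) (zeroʳ _))) (zeroʳ κ))
        scaled-δ : ∀ j → P j * δ i j ≈ μ * (P′ j * δ i j)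
        scaled-δ j with i Fin.≟ j
        ... | yes ≡.refl = trans (*-congʳ μi) (*-assoc _ _ _)
        ... | no  i≢j    = begin
          P j * δ i j           ≈⟨ trans (*-congˡ (δ-off i≢j)) (zeroʳ _) ⟩
          0#                    ≈⟨ trans (*-congˡ (trans (*-congˡ (δ-off i≢j)) (zeroʳ _))) (zeroʳ μ) ⟨
          μ * (P′ j * δ i j)    ∎
        a*-equal : ∀ j → pairing (a* j) (T ⌟ f ·ᴹ b* i) ≈ pairing (a* j) (μ ·ᵛ (T ⌟ g ·ᴹ b* i))
        a*-equal j = begin
          pairing (a* j) (T ⌟ f ·ᴹ b* i)          ≈⟨ a*-coordinate f j ⟩
          κ * (P j * δ i j)                       ≈⟨ *-congˡ (scaled-δ j) ⟩
          κ * (μ * (P′ j * δ i j))                ≈⟨ solve 3 (λ c m x → c :* (m :* x) := m :* (c :* x)) refl κ μ _ ⟩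
          μ * (κ * (P′ j * δ i j))                ≈⟨ *-congˡ (a*-coordinate g j) ⟨
          μ * pairing (a* j) (T ⌟ g ·ᴹ b* i)      ≈⟨ pairing-·ʳ (a* j) (T ⌟ g ·ᴹ b* i) μ ⟨
          pairing (a* j) (μ ·ᵛ (T ⌟ g ·ᴹ b* i))   ∎
        b*-equal : ∀ j → pairing (b* j) (T ⌟ f ·ᴹ b* i) ≈ pairing (b* j) (μ ·ᵛ (T ⌟ g ·ᴹ b* i))
        b*-equal j = begin
          pairing (b* j) (T ⌟ f ·ᴹ b* i)          ≈⟨ b*-coordinate f j ⟩
          0#                                      ≈⟨ trans (*-congˡ (b*-coordinate g j)) (zeroʳ μ) ⟨
          μ * pairing (b* j) (T ⌟ g ·ᴹ b* i)      ≈⟨ pairing-·ʳ (b* j) (T ⌟ g ·ᴹ b* i) μ ⟨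
          pairing (b* j) (μ ·ᵛ (T ⌟ g ·ᴹ b* i))   ∎

      ratio : Vector Carrier r
      ratio i = P i * P′ i ⁻¹

      ratio-eigenvalue : ∀ i → Eigenvalue (ratio i) i
      ratio-eigenvalue i = begin
        P i                      ≈⟨ *-identityʳ _ ⟨
        P i * 1#                 ≈⟨ *-congˡ (inverseʳ (ga≉0 i)) ⟨
        P i * (P′ i * P′ i ⁻¹)   ≈⟨ solve 3 (λ x y z → x :* (y :* z) := x :* z :* y) refl (P i) (P′ i) (P′ i ⁻¹) ⟩
        P i * P′ i ⁻¹ * P′ i     ∎

      eigenvalue⇒ratio : ∀ {μ i} → Eigenvalue μ i → ratio i ≈ μ
      eigenvalue⇒ratio {μ} {i} μi = *-cancelˡ (ga≉0 i)
        (trans (*-comm _ _) (trans (sym (ratio-eigenvalue i)) (trans μi (*-comm _ _))))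

      eigenpairs : GeneralizedEigenpairs (T ⌟ f) (T ⌟ g)
      eigenpairs = record
        { count       = r
        ; value       = ratio
        ; solutions   = λ μ → mk⇔
            (λ det≈0 → let x , x≉0 , ker = det≈0⇒singular ((T ⌟ f) -[ μ ] (T ⌟ g)) det≈0
                           i , μi = Eigenvector.has-index x≉0 ker
                       in i , eigenvalue⇒ratio μi)
            (λ (i , eq) → singular⇒det≈0 ((T ⌟ f) -[ μ ] (T ⌟ g))
              (b* i , b*≉0 i , b*-eigenvector (trans (ratio-eigenvalue i) (*-congʳ eq))))
        ; distinct    = λ {i} {j} eq → eigenvalue-index-unique (ratio-eigenvalue i)
                          (trans (ratio-eigenvalue j) (*-congʳ (sym eq)))
        ; vector      = b*
        ; nonzero     = b*≉0
        ; eigenvector = λ i → b*-eigenvector (ratio-eigenvalue i)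
        }

      -- This is all that the later steps see of the chosen eigenvectors: up to a labelling `ρ` and
      -- nonzero factors `c` their images are the `a i`. That m equals r is derived only at the end.
      module Matched {m} (ρ : Fin m → Fin r) (ρ-injective : ∀ {s t} → ρ s ≡ ρ t → s ≡ t)
                     (ρ-surjective : ∀ i → ∃[ s ] ρ s ≡ i)
                     (a₁ : Vector (V n) m) (c : Vector Carrier m) (c≉0 : ∀ s → c s ≉ 0#)
                     (a₁≈ : ∀ s → a₁ s ≈ᵛ c s ·ᵛ a (ρ s)) where

        pairing-a₁ : ∀ x s → pairing x (a₁ s) ≈ c s * pairing x (a (ρ s))
        pairing-a₁ x s = trans (pairing-cong {u = x} (λ _ → refl) (a₁≈ s)) (pairing-·ʳ x (a (ρ s)) (c s))

        dual-vectors : DualVectors a₁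
        dual-vectors = record
          { b      = λ s → c s ⁻¹ ·ᵛ a* (ρ s)
          ; orthog = λ s t t≢s → trans (entry s t)
              (trans (*-congˡ (trans (*-congˡ (δ-off (λ eq → t≢s (≡.sym (ρ-injective eq))))) (zeroʳ _))) (zeroʳ _))
          ; normal = λ s → trans (entry s s) (trans (sym (*-assoc _ _ _))
              (trans (*-cong (trans (*-comm _ _) (inverseʳ (c≉0 s))) (δ-diag (ρ s))) (*-identityˡ 1#)))
          }
          where
          entry : ∀ s t → pairing (c s ⁻¹ ·ᵛ a* (ρ s)) (a₁ t) ≈ c s ⁻¹ * (c t * δ (ρ s) (ρ t))
          entry s t = trans (pairing-comm (c s ⁻¹ ·ᵛ a* (ρ s)) (a₁ t))
            (trans (pairing-·ʳ (a₁ t) (a* (ρ s)) (c s ⁻¹))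
            (*-congˡ (trans (pairing-comm (a₁ t) (a* (ρ s)))
              (trans (pairing-a₁ (a* (ρ s)) t) (*-congˡ (a*a (ρ s) (ρ t)))))))

        module WithDual (dual : DualVectors a₁) where
          open DualVectors dual using (orthog; normal) renaming (b to d)

          v : Vector (V n) m
          v s = contract₂ (d s) T

          U = λ s → ⟨ a₁ s , v s ⟩

          d∙a-off : ∀ s j → j ≢ ρ s → pairing (d s) (a j) ≈ 0#
          d∙a-off s j j≢ρs with ρ-surjective j
          ... | t , ≡.refl = x*y≈0⇒y≈0 (c≉0 t) (trans (sym (pairing-a₁ (d s) t))
                  (orthog s t (λ t≡s → j≢ρs (≡.cong ρ t≡s))))

          d∙a≉0 : ∀ s → pairing (d s) (a (ρ s)) ≉ 0#
          d∙a≉0 s eq = 1≉0 (trans (sym (normal s))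
            (trans (pairing-a₁ (d s) s) (trans (*-congˡ eq) (zeroʳ (c s)))))

          -- `d s` is prescribed on the first vectors only, so its value on `b (ρ s)` is free. Hence
          -- `y`, which is 2κ d(a) d(b), can be anything, while `z`, which is κ d(a)², is nonzero;
          -- this is why `a₁ s` and `v s` still span the plane.
          y z : Vector Carrier m
          y s = pairing (a* (ρ s)) (v s)
          z s = pairing (b* (ρ s)) (v s)

          private
            coordinates : ∀ w s → pairing w (v s) ≈ pairing w (T ⌟ d s ·ᴹ d s)
            coordinates w s = pairing-cong {u = w} (λ _ → refl) (contract₂≈ (d s))

          v≈ : ∀ s → v s ≈ᵛ y s ·ᵛ a (ρ s) +ᵛ z s ·ᵛ b (ρ s)
          v≈ s = in-block (ρ s) (v s)
            (λ j j≢ → trans (coordinates (a* j) s) (trans (a*-contract j (d s) (d s)) (trans (*-congˡ (trans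
              (+-cong (trans (*-congʳ (d∙a-off s j j≢)) (zeroˡ _)) (trans (*-congˡ (d∙a-off s j j≢)) (zeroʳ _)))
              (+-identityʳ 0#))) (zeroʳ κ))))
            (λ j j≢ → trans (coordinates (b* j) s) (trans (b*-contract j (d s) (d s))
              (trans (*-congˡ (trans (*-congʳ (d∙a-off s j j≢)) (zeroˡ _))) (zeroʳ κ))))

          z≉0 : ∀ s → z s ≉ 0#
          z≉0 s eq = *-nonzero κ≉0 (*-nonzero (d∙a≉0 s) (d∙a≉0 s))
            (trans (sym (b*-contract (ρ s) (d s) (d s))) (trans (sym (coordinates (b* (ρ s)) s)) eq))

          combine : ∀ s α β → α ·ᵛ a₁ s +ᵛ β ·ᵛ v s ≈ᵛ (α * c s + β * y s) ·ᵛ a (ρ s) +ᵛ (β * z s) ·ᵛ b (ρ s)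
          combine s α β k = trans (+-cong (*-congˡ (a₁≈ s k)) (*-congˡ (v≈ s k)))
            (solve 7 (λ α β c y z a b → α :* (c :* a) :+ β :* (y :* a :+ z :* b)
                                     := (α :* c :+ β :* y) :* a :+ (β :* z) :* b)
               refl α β (c s) (y s) (z s) (a (ρ s) k) (b (ρ s) k))

          module _ {u i e h} (u≈ : u ≈ᵛ e ·ᵛ a i +ᵛ h ·ᵛ b i) where
            pairing-block : ∀ w → pairing w u ≈ e * pairing w (a i) + h * pairing w (b i)
            pairing-block w = trans (pairing-cong {u = w} (λ _ → refl) u≈) (pairing-linearʳ w e (a i) h (b i))

            a*-block : ∀ j → pairing (a* j) u ≈ e * δ j i
            a*-block j = trans (pairing-block (a* j))
              (trans (+-cong (*-congˡ (a*a j i)) (trans (*-congˡ (a*b j i)) (zeroʳ h))) (+-identityʳ _))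

            b*-block : ∀ j → pairing (b* j) u ≈ h * δ j i
            b*-block j = trans (pairing-block (b* j))
              (trans (+-cong (trans (*-congˡ (b*a j i)) (zeroʳ e)) (*-congˡ (b*b j i))) (+-identityˡ _))

          projection : Vector (Matrix n) m
          projection s k l = a (ρ s) k * a* (ρ s) l + b (ρ s) k * b* (ρ s) l

          projection-apply : ∀ s u → projection s ·ᴹ u ≈ᵛ
            pairing (a* (ρ s)) u ·ᵛ a (ρ s) +ᵛ pairing (b* (ρ s)) u ·ᵛ b (ρ s)
          projection-apply s u k = trans
            (sum-cong-≋ (λ l → solve 5 (λ x y z w v → (x :* y :+ z :* w) :* v := (y :* v) :* x :+ (w :* v) :* z)
              refl (a (ρ s) k) (a* (ρ s) l) (b (ρ s) k) (b* (ρ s) l) (u l)))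
            (sum-linear (λ l → a* (ρ s) l * u l) (λ l → b* (ρ s) l * u l) (a (ρ s) k) (b (ρ s) k))

          are-projections : AreProjections U projection
          are-projections s = fixes , kills
            where
            block : ∀ t u → u ∈ U t → ∃[ e ] ∃[ h ] u ≈ᵛ e ·ᵛ a (ρ t) +ᵛ h ·ᵛ b (ρ t)
            block t u u∈U = let α , β , u≈ = ∈⟨,⟩ u∈U in
              α * c t + β * y t , β * z t , λ k → trans (u≈ k) (combine t α β k)
            fixes : ∀ u → u ∈ U s → projection s ·ᴹ u ≈ᵛ u
            fixes u u∈U k = let e , h , u≈ = block s u u∈U in begin
              (projection s ·ᴹ u) k ≈⟨ projection-apply s u k ⟩
              pairing (a* (ρ s)) u * a (ρ s) k + pairing (b* (ρ s)) u * b (ρ s) k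
                ≈⟨ +-cong (*-congʳ (trans (a*-block u≈ (ρ s)) (trans (*-congˡ (δ-diag (ρ s))) (*-identityʳ e))))
                          (*-congʳ (trans (b*-block u≈ (ρ s)) (trans (*-congˡ (δ-diag (ρ s))) (*-identityʳ h)))) ⟩
              e * a (ρ s) k + h * b (ρ s) k ≈⟨ u≈ k ⟨
              u k ∎
            kills : ∀ t → t ≢ s → ∀ u → u ∈ U t → projection s ·ᴹ u ≈ᵛ 0ᵛ
            kills t t≢s u u∈U k = let e , h , u≈ = block t u u∈U
                                      off = δ-off (λ eq → t≢s (≡.sym (ρ-injective eq))) in begin
              (projection s ·ᴹ u) k ≈⟨ projection-apply s u k ⟩
              pairing (a* (ρ s)) u * a (ρ s) k + pairing (b* (ρ s)) u * b (ρ s) k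
                ≈⟨ +-cong (*-congʳ (trans (a*-block u≈ (ρ s)) (trans (*-congˡ off) (zeroʳ e))))
                          (*-congʳ (trans (b*-block u≈ (ρ s)) (trans (*-congˡ off) (zeroʳ h)))) ⟩
              0# * a (ρ s) k + 0# * b (ρ s) k ≈⟨ +-cong (zeroˡ _) (zeroˡ _) ⟩
              0# + 0# ≈⟨ +-identityʳ 0# ⟩
              0# ∎

          -- The vectors `a₁` and `v` span, since neither `c` nor `z` vanishes. Applied to the rows
          -- of two projection matrices, this yields their uniqueness.
          covector-ext : ∀ {x x′} → (∀ s → pairing x (a₁ s) ≈ pairing x′ (a₁ s)) →
                         (∀ s → pairing x (v s) ≈ pairing x′ (v s)) → x ≈ᵛ x′
          covector-ext {x} {x′} eq₁ eq₂ l = trans (expand* x l)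
            (trans (sum-cong-≋ (λ i → +-cong (*-congʳ {x = a* i l} (on-a i)) (*-congʳ {x = b* i l} (on-b i)))) (sym (expand* x′ l)))
            where
            on-a : ∀ i → pairing x (a i) ≈ pairing x′ (a i)
            on-a i with ρ-surjective i
            ... | s , ≡.refl = *-cancelˡ (c≉0 s) (trans (sym (pairing-a₁ x s)) (trans (eq₁ s) (pairing-a₁ x′ s)))
            on-b : ∀ i → pairing x (b i) ≈ pairing x′ (b i)
            on-b i with ρ-surjective i
            ... | s , ≡.refl = *-cancelˡ (z≉0 s) (+-cancelˡ _ _ _ (begin
              y s * pairing x (a i) + z s * pairing x (b i) ≈⟨ pairing-block (v≈ s) x ⟨
              pairing x (v s) ≈⟨ eq₂ s ⟩
              pairing x′ (v s) ≈⟨ pairing-block (v≈ s) x′ ⟩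
              y s * pairing x′ (a i) + z s * pairing x′ (b i) ≈⟨ +-congʳ (*-congˡ (on-a i)) ⟨
              y s * pairing x (a i) + z s * pairing x′ (b i) ∎))

          projections-unique : ∀ {Π Π′} → AreProjections U Π → AreProjections U Π′ → ∀ s → Π s ≈ᴹ Π′ s
          projections-unique {Π} {Π′} proj proj′ s k = covector-ext
            (λ t → agree t (a₁ t) (left∈⟨,⟩ (a₁ t) (v t)) k)
            (λ t → agree t (v t) (right∈⟨,⟩ (a₁ t) (v t)) k)
            where
            agree : ∀ t u → u ∈ U t → Π s ·ᴹ u ≈ᵛ Π′ s ·ᴹ u
            agree t u u∈U k with t Fin.≟ s
            ... | yes ≡.refl = trans (proj₁ (proj s) u u∈U k) (sym (proj₁ (proj′ s) u u∈U k))
            ... | no  t≢s    = trans (proj₂ (proj s) t t≢s u u∈U k) (sym (proj₂ (proj′ s) t t≢s u u∈U k))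

          module WithProjections {Π} (proj : AreProjections U Π) where

            A B : Vector Carrier m
            A s = κ * (P (ρ s) * Q′ (ρ s) + Q (ρ s) * P′ (ρ s))
            B s = κ * (P (ρ s) * P′ (ρ s))

            lhs : ∀ s → Π s ·ᴹ (T ⌟ f ·ᴹ g) ≈ᵛ A s ·ᵛ a (ρ s) +ᵛ B s ·ᵛ b (ρ s)
            lhs s k = trans (·ᴹ-cong {u = T ⌟ f ·ᴹ g} (projections-unique proj are-projections s) (λ _ → refl) k)
              (trans (projection-apply s (T ⌟ f ·ᴹ g) k)
                (+-cong (*-congʳ (a*-contract (ρ s) f g)) (*-congʳ (b*-contract (ρ s) f g))))

            module _ (s : Fin m) (α β : Carrier) where
              X Z : Carrier
              X = α * c s + β * y s
              Z = β * z s

              u : V n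
              u = α ·ᵛ a₁ s +ᵛ β ·ᵛ v s

              -- The equation of step (5) is triangular in Z and X: as `B` is nonzero, its
              -- `b`-coordinate forces c²Z = 1, and its `a`-coordinate then leaves 3c²B X = 0.
              rhs : (a₁ s ²⊙ u) ⌟ f ·ᴹ g ≈ᵛ
                    ((c s * c s * Z) * A s + X * ((1# + 1# + 1#) * (c s * c s * B s))) ·ᵛ a (ρ s) +ᵛ
                    ((c s * c s * Z) * B s) ·ᵛ b (ρ s)
              rhs k = begin
                ((a₁ s ²⊙ u) ⌟ f ·ᴹ g) k
                  ≈⟨ ²⊙-contract (a₁ s) u f g k ⟩
                κ * (pairing f (a₁ s) * pairing g (a₁ s)) * u k +
                κ * (pairing f (a₁ s) * pairing g u + pairing f u * pairing g (a₁ s)) * a₁ s k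
                  ≈⟨ +-cong (*-cong (*-congˡ (*-cong (pairing-a₁ f s) (pairing-a₁ g s))) (combine s α β k))
                       (*-cong (*-congˡ (+-cong (*-cong (pairing-a₁ f s) (pairing-block (combine s α β) g))
                                                (*-cong (pairing-block (combine s α β) f) (pairing-a₁ g s))))
                               (a₁≈ s k)) ⟩
                κ * (c s * p * (c s * p′)) * (X * a (ρ s) k + Z * b (ρ s) k) +
                κ * (c s * p * (X * p′ + Z * q′) + (X * p + Z * q) * (c s * p′)) * (c s * a (ρ s) k)
                  ≈⟨ solve 10 (λ κ c X Z p q p′ q′ a b →
                       κ :* (c :* p :* (c :* p′)) :* (X :* a :+ Z :* b) :+
                       κ :* (c :* p :* (X :* p′ :+ Z :* q′) :+ (X :* p :+ Z :* q) :* (c :* p′)) :* (c :* a)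
                       := ((c :* c :* Z) :* (κ :* (p :* q′ :+ q :* p′)) :+
                           X :* ((con 1 :+ con 1 :+ con 1) :* (c :* c :* (κ :* (p :* p′))))) :* a :+
                          ((c :* c :* Z) :* (κ :* (p :* p′))) :* b)
                       refl κ (c s) X Z p q p′ q′ (a (ρ s) k) (b (ρ s) k) ⟩
                ((c s * c s * Z) * A s + X * ((1# + 1# + 1#) * (c s * c s * B s))) * a (ρ s) k +
                ((c s * c s * Z) * B s) * b (ρ s) k ∎
                where
                p  = P (ρ s)
                q  = Q (ρ s)
                p′ = P′ (ρ s)
                q′ = Q′ (ρ s)

            B≉0 : ∀ s → B s ≉ 0#
            B≉0 s = *-nonzero κ≉0 (*-nonzero (fa≉0 (ρ s)) (ga≉0 (ρ s)))

            3ccB≉0 : ∀ s → (1# + 1# + 1#) * (c s * c s * B s) ≉ 0#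
            3ccB≉0 s = *-nonzero 3≉0 (*-nonzero (*-nonzero (c≉0 s) (c≉0 s)) (B≉0 s))

            coefficients : Coefficients T f g a₁ v Π
            coefficients = record { α = α ; β = β ; solves = solves }
              where
              α β : Vector Carrier m
              -- `β` solves c²Z = 1 with Z = βz, and `α` then solves X = αc + βy = 0.
              β s = (c s * c s * z s) ⁻¹
              α s = - (β s * y s * c s ⁻¹)
              X≈0 : ∀ s → X s (α s) (β s) ≈ 0#
              X≈0 s = begin
                - (β s * y s * c s ⁻¹) * c s + β s * y s ≈⟨ +-congʳ (-‿distribˡ-* _ _) ⟨
                - (β s * y s * c s ⁻¹ * c s) + β s * y s
                  ≈⟨ +-congʳ (-‿cong (trans (*-assoc _ _ _) (trans (*-congˡ (trans (*-comm _ _) (inverseʳ (c≉0 s)))) (*-identityʳ _)))) ⟩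
                - (β s * y s) + β s * y s ≈⟨ -‿inverseˡ _ ⟩
                0# ∎
              ccZ≈1 : ∀ s → c s * c s * Z s (α s) (β s) ≈ 1#
              ccZ≈1 s = trans (solve 3 (λ c b z → c :* c :* (b :* z) := (c :* c :* z) :* b) refl (c s) (β s) (z s))
                (inverseʳ (*-nonzero (*-nonzero (c≉0 s) (c≉0 s)) (z≉0 s)))
              solves : ∀ s → Π s ·ᴹ (T ⌟ f ·ᴹ g) ≈ᵛ (a₁ s ²⊙ u s (α s) (β s)) ⌟ f ·ᴹ g
              solves s k = trans (lhs s k) (trans (+-cong
                (*-congʳ (sym (trans (+-cong (trans (*-congʳ (ccZ≈1 s)) (*-identityˡ _))
                                             (trans (*-congʳ (X≈0 s)) (zeroˡ _))) (+-identityʳ _))))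
                (*-congʳ (sym (trans (*-congʳ (ccZ≈1 s)) (*-identityˡ _)))))
                (sym (rhs s (α s) (β s) k)))

            -- Pairing the solved equation with the dual basis gives c²Z = 1 and X = 0 for any
            -- solution. So the new second vector is Z `b`, and the scalars cancel in (c a)²(Z b).
            output≈ : (coeff : Coefficients T f g a₁ v Π) → ∀ s →
                      a₁ s ²⊙ (Coefficients.α coeff s ·ᵛ a₁ s +ᵛ Coefficients.β coeff s ·ᵛ v s) ≈ᵀ a (ρ s) ²⊙ b (ρ s)
            output≈ coeff s i j k = trans
              (²⊙-cong (a₁≈ s) (λ k → trans (combine s (α s) (β s) k)
                (trans (+-congʳ (trans (*-congʳ X≈0) (zeroˡ _))) (+-identityˡ _))) i j k)
              (²⊙-rescale (a (ρ s)) (b (ρ s)) ccZ≈1 i j k)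
              where
              open Coefficients coeff
              X₀ Z₀ : Carrier
              X₀ = X s (α s) (β s)
              Z₀ = Z s (α s) (β s)
              balance : ∀ k → A s * a (ρ s) k + B s * b (ρ s) k ≈ _
              balance k = trans (sym (lhs s k)) (trans (solves s k) (rhs s (α s) (β s) k))
              unit : ∀ {e} → e * δ (ρ s) (ρ s) ≈ e
              unit {e} = trans (*-congˡ (δ-diag (ρ s))) (*-identityʳ e)
              ccZ≈1 : c s * c s * Z₀ ≈ 1#
              ccZ≈1 = *-cancelˡ (B≉0 s) (begin
                B s * (c s * c s * Z₀) ≈⟨ *-comm _ _ ⟩
                c s * c s * Z₀ * B s ≈⟨ unit ⟨
                c s * c s * Z₀ * B s * δ (ρ s) (ρ s) ≈⟨ b*-block balance (ρ s) ⟨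
                pairing (b* (ρ s)) (A s ·ᵛ a (ρ s) +ᵛ B s ·ᵛ b (ρ s)) ≈⟨ b*-block (λ _ → refl) (ρ s) ⟩
                B s * δ (ρ s) (ρ s) ≈⟨ unit ⟩
                B s ≈⟨ *-identityʳ _ ⟨
                B s * 1# ∎)
              X≈0 : X₀ ≈ 0#
              X≈0 = x*y≈0⇒y≈0 (3ccB≉0 s) (trans (*-comm _ _) (+-cancelˡ (A s) _ _ (begin
                A s + X₀ * _ ≈⟨ +-congʳ (trans (*-congʳ ccZ≈1) (*-identityˡ _)) ⟨
                c s * c s * Z₀ * A s + X₀ * _ ≈⟨ unit ⟨
                (c s * c s * Z₀ * A s + X₀ * _) * δ (ρ s) (ρ s) ≈⟨ a*-block balance (ρ s) ⟨
                pairing (a* (ρ s)) (A s ·ᵛ a (ρ s) +ᵛ B s ·ᵛ b (ρ s)) ≈⟨ a*-block (λ _ → refl) (ρ s) ⟩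
                A s * δ (ρ s) (ρ s) ≈⟨ unit ⟩
                A s ≈⟨ +-identityʳ _ ⟨
                A s + 0# ∎)))

      algorithm-correct : ∀ {t : Vector (Tensor n) r} → (∀ i → t i ≈ᵀ a i ²⊙ b i) → ∀ ℓ →
                          algorithm T f g ℓ λ {m} output → m ≡ r × Terms output ≐ Terms t
      algorithm-correct {t} t≈ ℓ = eigenpairs , λ eig →
        let open GeneralizedEigenpairs eig
            module E s = Eigenvector (nonzero s) (eigenvector s)
            ρ = E.index
            ρ-injective : ∀ {s t} → ρ s ≡ ρ t → s ≡ t
            ρ-injective {s} {t} eq = distinct (trans
              (sym (eigenvalue⇒ratio (proj₂ (E.has-index s))))
              (trans (reflexive (≡.cong ratio eq)) (eigenvalue⇒ratio (proj₂ (E.has-index t)))))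
            -- `b* i` makes the pencil singular at `ratio i`, and `solutions` lists every root of
            -- the determinant, so each ratio occurs among the values.
            ρ-surjective : ∀ i → ∃[ s ] ρ s ≡ i
            ρ-surjective i =
              let s , eq = Equivalence.to (solutions (ratio i)) (singular⇒det≈0 ((T ⌟ f) -[ ratio i ] (T ⌟ g))
                             (b* i , b*≉0 i , b*-eigenvector (ratio-eigenvalue i)))
              in s , eigenvalue-index-unique (proj₂ (E.has-index s))
                       (trans (ratio-eigenvalue i) (*-congʳ (sym eq)))
            open Matched ρ ρ-injective ρ-surjective (λ s → T ⌟ f ·ᴹ vector s) E.scale E.scale≉0 E.image
        in dual-vectors , λ dual →
        let open WithDual dual in
        (projection , are-projections , λ proj → projections-unique are-projections proj) , λ Π proj →
        let open WithProjections proj in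
        coefficients , λ coeff →
          -- `ρ` and its section are injections in both directions between finite sets, whence m =
          -- r.
          cantor-schröder-bernstein {g = λ i → proj₁ (ρ-surjective i)} ρ-injective
            (λ {i} {j} eq → ≡.trans (≡.sym (proj₂ (ρ-surjective i))) (≡.trans (≡.cong ρ eq) (proj₂ (ρ-surjective j)))) ,
          (λ (s , S≈) → ρ s , λ i j k → trans (S≈ i j k) (trans (output≈ coeff s i j k) (sym (t≈ (ρ s) i j k)))) ,
          (λ {S} (i , S≈) → let s , eq = ρ-surjective i in
            s , λ j k l → trans (S≈ j k l) (trans (t≈ i j k l) (trans
              (reflexive (≡.cong (λ i → (a i ²⊙ b i) j k l) (≡.sym eq))) (sym (output≈ coeff s j k l)))))

    -- Minimality and uniqueness

    module FramedTensor {n r} {a b : Vector (V n) r} (frame : Frame a b)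
                        {T : Tensor n} (T≈ : T ≈ᵀ ∑ᵀ (λ i → a i ²⊙ b i)) where
      open Frame frame
      open FramedDecomposition frame T≈

      -- For the vector h with p_i(h) = 1 and q_i(h) = 0, every block of T_h is κ times the exchange
      -- of two coordinates. The preimage therefore carries the coordinates of `v` exchanged and
      -- divided by κ.
      flattening-surjective : ∀ v → ∃[ x ] T ⌟ cocombination (λ _ → 1#) (λ _ → 0#) ·ᴹ x ≈ᵛ v
      flattening-surjective v = x , vector-ext
        (λ i → begin
          pairing (a* i) (T ⌟ h ·ᴹ x) ≈⟨ a*-contract i h x ⟩
          κ * (pairing h (a i) * pairing x (b i) + pairing h (b i) * pairing x (a i))
            ≈⟨ *-congˡ (+-cong (*-congʳ (ha i)) (*-congʳ (hb i))) ⟩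
          κ * (1# * pairing x (b i) + 0# * pairing x (a i))
            ≈⟨ *-congˡ (trans (+-cong (*-identityˡ _) (zeroˡ _)) (+-identityʳ _)) ⟩
          κ * pairing x (b i) ≈⟨ *-congˡ (cocombination-b (λ i → κ ⁻¹ * pairing (b* i) v) (λ i → κ ⁻¹ * pairing (a* i) v) i) ⟩
          κ * (κ ⁻¹ * pairing (a* i) v) ≈⟨ cancel _ ⟩
          pairing (a* i) v ∎)
        (λ i → begin
          pairing (b* i) (T ⌟ h ·ᴹ x) ≈⟨ b*-contract i h x ⟩
          κ * (pairing h (a i) * pairing x (a i)) ≈⟨ *-congˡ (trans (*-congʳ (ha i)) (*-identityˡ _)) ⟩
          κ * pairing x (a i) ≈⟨ *-congˡ (cocombination-a (λ i → κ ⁻¹ * pairing (b* i) v) (λ i → κ ⁻¹ * pairing (a* i) v) i) ⟩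
          κ * (κ ⁻¹ * pairing (b* i) v) ≈⟨ cancel _ ⟩
          pairing (b* i) v ∎)
        where
        h x : V n
        h = cocombination (λ _ → 1#) (λ _ → 0#)
        x = cocombination (λ i → κ ⁻¹ * pairing (b* i) v) (λ i → κ ⁻¹ * pairing (a* i) v)
        ha : ∀ i → pairing h (a i) ≈ 1#
        ha = cocombination-a (λ _ → 1#) (λ _ → 0#)
        hb : ∀ i → pairing h (b i) ≈ 0#
        hb = cocombination-b (λ _ → 1#) (λ _ → 0#)
        cancel : ∀ y → κ * (κ ⁻¹ * y) ≈ y
        cancel y = trans (sym (*-assoc _ _ _)) (trans (*-congʳ (inverseʳ κ≉0)) (*-identityˡ y))

      -- Each e_l is T_h x_l for the surjective T_h above. Expanding T_h x_l by the second
      -- decomposition writes e_l in the vectors `a′` and `b′`, and the coefficients are the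
      -- coframe.
      decomposition⇒coframe : ∀ {s} {a′ b′ : Vector (V n) s} →
        T ≈ᵀ ∑ᵀ (λ i → a′ i ²⊙ b′ i) → Coframe a′ b′
      decomposition⇒coframe {s} {a′} {b′} T≈′ = record
        { a* = λ i l → κ * (pairing h (a′ i) * pairing (x l) (b′ i) + pairing h (b′ i) * pairing (x l) (a′ i))
        ; b* = λ i l → κ * (pairing h (a′ i) * pairing (x l) (a′ i))
        ; complete = λ k l → begin
            _ ≈⟨ sum-cong-≋ (λ i → solve 4 (λ x y z w → x :* y :+ z :* w := w :* z :+ y :* x) refl
                   (a′ i k) (κ * (pairing h (a′ i) * pairing (x l) (b′ i) + pairing h (b′ i) * pairing (x l) (a′ i)))
                   (b′ i k) (κ * (pairing h (a′ i) * pairing (x l) (a′ i)))) ⟩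
            _ ≈⟨ Decomposition.contract-expand a′ b′ T≈′ h (x l) k ⟨
            (T ⌟ h ·ᴹ x l) k ≈⟨ proj₂ (flattening-surjective (δ l)) k ⟩
            δ l k ≈⟨ reflexive (δ-sym l k) ⟩
            δ k l ∎
        }
        where
        h = cocombination (λ _ → 1#) (λ _ → 0#)
        x : Fin n → V n
        x l = proj₁ (flattening-surjective (δ l))

      contract-b* : ∀ k x → T ⌟ b* k ·ᴹ x ≈ᵛ (κ * pairing x (a k)) ·ᵛ a k
      contract-b* k x = vector-ext
        (λ i → begin
          pairing (a* i) (T ⌟ b* k ·ᴹ x) ≈⟨ a*-contract i (b* k) x ⟩
          κ * (pairing (b* k) (a i) * pairing x (b i) + pairing (b* k) (b i) * pairing x (a i))
            ≈⟨ *-congˡ (trans (+-cong (trans (*-congʳ (b*a k i)) (zeroˡ _)) (*-congʳ (b*b k i))) (+-identityˡ _)) ⟩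
          κ * (δ k i * pairing x (a i)) ≈⟨ *-congˡ (select i) ⟩
          κ * (pairing x (a k) * δ i k) ≈⟨ *-assoc _ _ _ ⟨
          κ * pairing x (a k) * δ i k ≈⟨ *-congˡ (a*a i k) ⟨
          κ * pairing x (a k) * pairing (a* i) (a k) ≈⟨ pairing-·ʳ (a* i) (a k) _ ⟨
          pairing (a* i) ((κ * pairing x (a k)) ·ᵛ a k) ∎)
        (λ i → begin
          pairing (b* i) (T ⌟ b* k ·ᴹ x) ≈⟨ b*-contract i (b* k) x ⟩
          κ * (pairing (b* k) (a i) * pairing x (a i)) ≈⟨ trans (*-congˡ (trans (*-congʳ (b*a k i)) (zeroˡ _))) (zeroʳ κ) ⟩
          0# ≈⟨ trans (*-congˡ (b*a i k)) (zeroʳ _) ⟨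
          κ * pairing x (a k) * pairing (b* i) (a k) ≈⟨ pairing-·ʳ (b* i) (a k) _ ⟨
          pairing (b* i) ((κ * pairing x (a k)) ·ᵛ a k) ∎)
        where
        select : ∀ i → δ k i * pairing x (a i) ≈ pairing x (a k) * δ i k
        select i with i Fin.≟ k
        ... | yes ≡.refl = *-comm _ _
        ... | no  i≢k    = trans (trans (*-congʳ (δ-off (i≢k ∘ ≡.sym))) (zeroˡ _))
                                 (sym (trans (*-congˡ (δ-off i≢k)) (zeroʳ _)))

      -- Recovers a second vector from T and the dual basis, which makes the second vectors of two
      -- frames comparable.
      contract-a*a* : ∀ k → T ⌟ a* k ·ᴹ a* k ≈ᵛ κ ·ᵛ b k
      contract-a*a* k = vector-ext
        (λ i → begin
          pairing (a* i) (T ⌟ a* k ·ᴹ a* k) ≈⟨ a*-contract i (a* k) (a* k) ⟩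
          κ * (pairing (a* k) (a i) * pairing (a* k) (b i) + pairing (a* k) (b i) * pairing (a* k) (a i))
            ≈⟨ *-congˡ (trans (+-cong (trans (*-congˡ (a*b k i)) (zeroʳ _)) (trans (*-congʳ (a*b k i)) (zeroˡ _))) (+-identityʳ 0#)) ⟩
          κ * 0# ≈⟨ *-congˡ (a*b i k) ⟨
          κ * pairing (a* i) (b k) ≈⟨ pairing-·ʳ (a* i) (b k) κ ⟨
          pairing (a* i) (κ ·ᵛ b k) ∎)
        (λ i → begin
          pairing (b* i) (T ⌟ a* k ·ᴹ a* k) ≈⟨ b*-contract i (a* k) (a* k) ⟩
          κ * (pairing (a* k) (a i) * pairing (a* k) (a i)) ≈⟨ *-congˡ (square i) ⟩
          κ * pairing (b* i) (b k) ≈⟨ pairing-·ʳ (b* i) (b k) κ ⟨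
          pairing (b* i) (κ ·ᵛ b k) ∎)
        where
        square : ∀ i → pairing (a* k) (a i) * pairing (a* k) (a i) ≈ pairing (b* i) (b k)
        square i with i Fin.≟ k
        ... | yes ≡.refl = trans (*-congʳ (trans (a*a k k) (δ-diag k)))
                (trans (*-identityˡ _) (trans (a*a k k) (sym (b*b k k))))
        ... | no  i≢k    = trans (*-congʳ (trans (a*a k i) (δ-off (i≢k ∘ ≡.sym))))
                (trans (zeroˡ _) (sym (trans (b*b i k) (δ-off i≢k))))

    module TwoFrames {n r r′} {a b : Vector (V n) r} {a′ b′ : Vector (V n) r′}
                     (frame : Frame a b) (frame′ : Frame a′ b′) {T : Tensor n}
                     (T≈ : T ≈ᵀ ∑ᵀ (λ i → a i ²⊙ b i)) (T≈′ : T ≈ᵀ ∑ᵀ (λ i → a′ i ²⊙ b′ i)) where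
      open Frame frame
      open FramedDecomposition frame T≈
      open Frame frame′ using () renaming
        (a* to a′*; b* to b′*; a*a to a′*a′; a*b to a′*b′; b*a to b′*a′; b*b to b′*b′)
      open FramedTensor frame′ T≈′ using () renaming (contract-b* to contract-b′*; contract-a*a* to contract-a′*a′*)

      -- Contracting T twice with `b′* k` gives `b`-coordinates κ p_i(`b′* k`)² in the first frame,
      -- and zero in the second, where `b′* k` is orthogonal to `a′ k`. So the squares vanish.
      b′*∙a≈0 : ∀ k i → pairing (b′* k) (a i) ≈ 0#
      b′*∙a≈0 k i = x*x≈0⇒x≈0 (x*y≈0⇒y≈0 κ≉0 (begin
        κ * (pairing (b′* k) (a i) * pairing (b′* k) (a i)) ≈⟨ b*-contract i (b′* k) (b′* k) ⟨
        pairing (b* i) (T ⌟ b′* k ·ᴹ b′* k) ≈⟨ pairing-cong {u = b* i} (λ _ → refl) (contract-b′* k (b′* k)) ⟩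
        pairing (b* i) ((κ * pairing (b′* k) (a′ k)) ·ᵛ a′ k) ≈⟨ pairing-·ʳ (b* i) (a′ k) _ ⟩
        κ * pairing (b′* k) (a′ k) * pairing (b* i) (a′ k) ≈⟨ *-congʳ (trans (*-congˡ (b′*a′ k k)) (zeroʳ κ)) ⟩
        0# * pairing (b* i) (a′ k) ≈⟨ zeroˡ _ ⟩
        0# ∎))

      -- T contracted with b′ₖ* is κ a′ₖ ⊗ a′ₖ in one frame and diagonal in the other.
      diagonal : ∀ k i x → pairing x (a′ k) * pairing (a* i) (a′ k) ≈ pairing (b′* k) (b i) * pairing x (a i)
      diagonal k i x = *-cancelˡ κ≉0 (begin
        κ * (pairing x (a′ k) * pairing (a* i) (a′ k)) ≈⟨ *-assoc _ _ _ ⟨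
        κ * pairing x (a′ k) * pairing (a* i) (a′ k) ≈⟨ pairing-·ʳ (a* i) (a′ k) _ ⟨
        pairing (a* i) ((κ * pairing x (a′ k)) ·ᵛ a′ k) ≈⟨ pairing-cong {u = a* i} (λ _ → refl) (contract-b′* k x) ⟨
        pairing (a* i) (T ⌟ b′* k ·ᴹ x) ≈⟨ a*-contract i (b′* k) x ⟩
        κ * (pairing (b′* k) (a i) * pairing x (b i) + pairing (b′* k) (b i) * pairing x (a i))
          ≈⟨ *-congˡ (trans (+-congʳ (trans (*-congʳ (b′*∙a≈0 k i)) (zeroˡ _))) (+-identityˡ _)) ⟩
        κ * (pairing (b′* k) (b i) * pairing x (a i)) ∎)

      -- Contracting T with `b′* k` and `a′* k` gives κ `a′ k`, whose `b`-coordinates contain the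
      -- factor p_i(`b′* k`) = 0.
      b*∙a′≈0 : ∀ k i → pairing (b* i) (a′ k) ≈ 0#
      b*∙a′≈0 k i = begin
        pairing (b* i) (a′ k) ≈⟨ *-identityˡ _ ⟨
        1# * pairing (b* i) (a′ k) ≈⟨ *-congʳ (trans (a′*a′ k k) (δ-diag k)) ⟨
        pairing (a′* k) (a′ k) * pairing (b* i) (a′ k) ≈⟨ x*y≈0⇒y≈0 κ≉0 (begin
          κ * (pairing (a′* k) (a′ k) * pairing (b* i) (a′ k)) ≈⟨ *-assoc _ _ _ ⟨
          κ * pairing (a′* k) (a′ k) * pairing (b* i) (a′ k) ≈⟨ pairing-·ʳ (b* i) (a′ k) _ ⟨
          pairing (b* i) ((κ * pairing (a′* k) (a′ k)) ·ᵛ a′ k) ≈⟨ pairing-cong {u = b* i} (λ _ → refl) (contract-b′* k (a′* k)) ⟨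
          pairing (b* i) (T ⌟ b′* k ·ᴹ a′* k) ≈⟨ b*-contract i (b′* k) (a′* k) ⟩
          κ * (pairing (b′* k) (a i) * pairing (a′* k) (a i)) ≈⟨ trans (*-congˡ (trans (*-congʳ (b′*∙a≈0 k i)) (zeroˡ _))) (zeroʳ κ) ⟩
          0# ∎) ⟩
        0# ∎

      -- By `diagonal` the `a`-coordinates of `a′ k` satisfy s_i s_j = 0 for i ≠ j, so a nonzero one
      -- is the only one.
      proportional : ∀ k → ∃[ i ] ∃[ s ] a′ k ≈ᵛ s ·ᵛ a i
      proportional k = i , s i , λ l → begin
        a′ k l ≈⟨ in-block i (a′ k) off (λ j _ → b*∙a′≈0 k j) l ⟩
        s i * a i l + pairing (b* i) (a′ k) * b i l ≈⟨ +-congˡ (trans (*-congʳ (b*∙a′≈0 k i)) (zeroˡ _)) ⟩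
        s i * a i l + 0# ≈⟨ +-identityʳ _ ⟩
        s i * a i l ∎
        where
        s : V r
        s i = pairing (a* i) (a′ k)
        s≉0 : ¬ s ≈ᵛ 0ᵛ
        s≉0 s≈0 = 1≉0 (begin
          1# ≈⟨ trans (a′*a′ k k) (δ-diag k) ⟨
          pairing (a′* k) (a′ k) ≈⟨ pairing-cong {u = a′* k} (λ _ → refl) (vector-ext
            (λ i → trans (s≈0 i) (sym (pairing-0ʳ (a* i))))
            (λ i → trans (b*∙a′≈0 k i) (sym (pairing-0ʳ (b* i))))) ⟩
          pairing (a′* k) 0ᵛ ≈⟨ pairing-0ʳ (a′* k) ⟩
          0# ∎)
        i = proj₁ (nonzero-entry s s≉0)
        off : ∀ j → j ≢ i → s j ≈ 0#
        off j j≢i = x*y≈0⇒y≈0 (proj₂ (nonzero-entry s s≉0)) (begin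
          s i * s j ≈⟨ diagonal k j (a* i) ⟩
          pairing (b′* k) (b j) * pairing (a* i) (a j) ≈⟨ *-congˡ (trans (a*a i j) (δ-off (j≢i ∘ ≡.sym))) ⟩
          pairing (b′* k) (b j) * 0# ≈⟨ zeroʳ _ ⟩
          0# ∎)

    module _ {n r r′} {a b : Vector (V n) r} {a′ b′ : Vector (V n) r′}
             (frame : Frame a b) (frame′ : Frame a′ b′) {T : Tensor n}
             (T≈ : T ≈ᵀ ∑ᵀ (λ i → a i ²⊙ b i)) (T≈′ : T ≈ᵀ ∑ᵀ (λ i → a′ i ²⊙ b′ i)) where
      open Frame frame
      open FramedDecomposition frame T≈
      open Frame frame′ using () renaming (a* to a′*; a*a to a′*a′; a*b to a′*b′)

      -- Proportionality in both directions makes x = `a′* k` vanish on `a j` for j ≠ i, so κ `b′ k`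
      -- = T_x x lies in the i-th plane. Pairing it with x gives 0 = 3κp²q; hence q = 0 and `b′ k` =
      -- p² `b i`, and the scalars cancel because sp = 1.
      proportional⇒equal : ∀ k i s → a′ k ≈ᵛ s ·ᵛ a i → (∀ j → ∃[ l ] ∃[ t ] a j ≈ᵛ t ·ᵛ a′ l) →
                           a′ k ²⊙ b′ k ≈ᵀ a i ²⊙ b i
      proportional⇒equal k i s a′≈ proportional′ j l m = trans
        (²⊙-cong a′≈ b′≈ j l m) (²⊙-rescale (a i) (b i) ssp²≈1 j l m)
        where
        x = a′* k
        p q : Carrier
        p = pairing x (a i)
        q = pairing x (b i)
        sp≈1 : s * p ≈ 1#
        sp≈1 = begin
          s * p ≈⟨ pairing-·ʳ x (a i) s ⟨
          pairing x (s ·ᵛ a i) ≈⟨ pairing-cong {u = x} (λ _ → refl) a′≈ ⟨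
          pairing x (a′ k) ≈⟨ trans (a′*a′ k k) (δ-diag k) ⟩
          1# ∎
        p≉0 : p ≉ 0#
        p≉0 p≈0 = 1≉0 (trans (sym sp≈1) (trans (*-congˡ p≈0) (zeroʳ s)))
        ssp²≈1 : s * s * (p * p) ≈ 1#
        ssp²≈1 = trans (solve 2 (λ s p → s :* s :* (p :* p) := (s :* p) :* (s :* p)) refl s p)
          (trans (*-cong sp≈1 sp≈1) (*-identityˡ 1#))
        x∙a-off : ∀ j → j ≢ i → pairing x (a j) ≈ 0#
        x∙a-off j j≢i with proportional′ j
        ... | l , t , a≈ with l Fin.≟ k
        -- Here `a j` would be parallel to `a i` for j ≠ i, but `a* j` is 1 on the one and 0 on the
        -- other.
        ...   | yes ≡.refl = contradiction (begin
          1# ≈⟨ trans (a*a j j) (δ-diag j) ⟨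
          pairing (a* j) (a j) ≈⟨ pairing-cong {u = a* j} (λ _ → refl) (λ m → trans (a≈ m) (*-congˡ (a′≈ m))) ⟩
          pairing (a* j) (t ·ᵛ s ·ᵛ a i) ≈⟨ trans (pairing-·ʳ (a* j) (s ·ᵛ a i) t) (*-congˡ (pairing-·ʳ (a* j) (a i) s)) ⟩
          t * (s * pairing (a* j) (a i)) ≈⟨ *-congˡ (trans (*-congˡ (trans (a*a j i) (δ-off j≢i))) (zeroʳ s)) ⟩
          t * 0# ≈⟨ zeroʳ t ⟩
          0# ∎) 1≉0
        ...   | no l≢k = begin
          pairing x (a j) ≈⟨ pairing-cong {u = x} (λ _ → refl) a≈ ⟩
          pairing x (t ·ᵛ a′ l) ≈⟨ pairing-·ʳ x (a′ l) t ⟩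
          t * pairing x (a′ l) ≈⟨ *-congˡ (trans (a′*a′ k l) (δ-off (l≢k ∘ ≡.sym))) ⟩
          t * 0# ≈⟨ zeroʳ t ⟩
          0# ∎
        κb′≈ : κ ·ᵛ b′ k ≈ᵛ (κ * (p * q + q * p)) ·ᵛ a i +ᵛ (κ * (p * p)) ·ᵛ b i
        κb′≈ l = begin
          κ * b′ k l ≈⟨ FramedTensor.contract-a*a* frame′ T≈′ k l ⟨
          (T ⌟ x ·ᴹ x) l ≈⟨ in-block i (T ⌟ x ·ᴹ x)
            (λ j j≢i → trans (a*-contract j x x) (trans (*-congˡ (trans (+-cong
              (trans (*-congʳ (x∙a-off j j≢i)) (zeroˡ _)) (trans (*-congˡ (x∙a-off j j≢i)) (zeroʳ _))) (+-identityʳ 0#))) (zeroʳ κ)))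
            (λ j j≢i → trans (b*-contract j x x) (trans (*-congˡ (trans (*-congʳ (x∙a-off j j≢i)) (zeroˡ _))) (zeroʳ κ))) l ⟩
          pairing (a* i) (T ⌟ x ·ᴹ x) * a i l + pairing (b* i) (T ⌟ x ·ᴹ x) * b i l
            ≈⟨ +-cong (*-congʳ (a*-contract i x x)) (*-congʳ (b*-contract i x x)) ⟩
          κ * (p * q + q * p) * a i l + κ * (p * p) * b i l ∎
        q≈0 : q ≈ 0#
        q≈0 = x*y≈0⇒y≈0 (*-nonzero (*-nonzero κ≉0 (*-nonzero p≉0 p≉0)) 3≉0) (begin
          κ * (p * p) * (1# + 1# + 1#) * q
            ≈⟨ solve 3 (λ κ p q → κ :* (p :* p) :* (con 1 :+ con 1 :+ con 1) :* q
                               := κ :* (p :* q :+ q :* p) :* p :+ κ :* (p :* p) :* q) refl κ p q ⟩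
          κ * (p * q + q * p) * p + κ * (p * p) * q
            ≈⟨ pairing-linearʳ x (κ * (p * q + q * p)) (a i) (κ * (p * p)) (b i) ⟨
          pairing x ((κ * (p * q + q * p)) ·ᵛ a i +ᵛ (κ * (p * p)) ·ᵛ b i)
            ≈⟨ pairing-cong {u = x} (λ _ → refl) κb′≈ ⟨
          pairing x (κ ·ᵛ b′ k) ≈⟨ pairing-·ʳ x (b′ k) κ ⟩
          κ * pairing x (b′ k) ≈⟨ trans (*-congˡ (a′*b′ k k)) (zeroʳ κ) ⟩
          0# ∎)
        b′≈ : b′ k ≈ᵛ (p * p) ·ᵛ b i
        b′≈ l = *-cancelˡ κ≉0 (begin
          κ * b′ k l ≈⟨ κb′≈ l ⟩
          κ * (p * q + q * p) * a i l + κ * (p * p) * b i l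
            ≈⟨ +-congʳ (trans (*-congʳ (trans (*-congˡ (trans (+-cong
                 (trans (*-congˡ q≈0) (zeroʳ p)) (trans (*-congʳ q≈0) (zeroˡ p))) (+-identityʳ 0#))) (zeroʳ κ))) (zeroˡ _)) ⟩
          0# + κ * (p * p) * b i l ≈⟨ trans (+-identityˡ _) (*-assoc _ _ _) ⟩
          κ * (p * p * b i l) ∎)

      terms-match : ∀ k → ∃[ i ] a′ k ²⊙ b′ k ≈ᵀ a i ²⊙ b i
      terms-match k = let i , s , a′≈ = TwoFrames.proportional frame frame′ T≈ T≈′ k in
        i , proportional⇒equal k i s a′≈ (TwoFrames.proportional frame′ frame T≈′ T≈)

    module _ {n r} {a b : Vector (V n) r} (frame : Frame a b)
             {T : Tensor n} (T≈ : T ≈ᵀ ∑ᵀ (λ i → a i ²⊙ b i)) where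
      open FramedTensor frame T≈ using (decomposition⇒coframe)

      private
        t : Vector (Tensor n) r
        t i = a i ²⊙ b i

        module Factors {s} {t′ : Vector (Tensor n) s} (dec : IsWDecomposition T t′) where
          a′ b′ : Vector (V n) s
          a′ j = proj₁ (proj₁ dec j)
          b′ j = proj₁ (proj₂ (proj₁ dec j))
          t′≈ : ∀ j → t′ j ≈ᵀ a′ j ²⊙ b′ j
          t′≈ j = proj₂ (proj₂ (proj₂ (proj₁ dec j)))
          T≈′ : T ≈ᵀ ∑ᵀ (λ j → a′ j ²⊙ b′ j)
          T≈′ i j k = trans (proj₂ dec i j k) (sum-cong-≋ (λ s → t′≈ s i j k))

      minimal : (∀ i → LinearlyIndependent (a i ∷ b i ∷ [])) → IsMinimalWDecomposition T t
      minimal indep = ((λ i → a i , b i , indep i , λ _ _ _ → refl) , T≈) , λ t′ dec →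
        Exchange.frame-minimal frame (decomposition⇒coframe (Factors.T≈′ dec))

      unique-minimal : (∀ i → LinearlyIndependent (a i ∷ b i ∷ [])) → IsUniqueMinimalWDecomposition T t
      unique-minimal indep = minimal indep , unique
        where
        unique : ∀ {s} (t′ : Vector (Tensor n) s) → IsMinimalWDecomposition T t′ → Terms t′ ≐ Terms t
        unique {s} t′ (dec , least) = ⊆ , ⊇
          where
          open Factors dec
          coframe′ = decomposition⇒coframe T≈′
          -- Equal length turns the spanning vectors of the second decomposition into a basis; only
          -- then is the dual vector b′* with its orthogonality relations available.
          s≡r : s ≡ r
          s≡r = ℕ.≤-antisym (least t (proj₁ (minimal indep))) (Exchange.frame-minimal frame coframe′)
          frame′ : Frame a′ b′
          frame′ = independent⇒frame coframe′ (Exchange.spanning⇒independent frame coframe′ s≡r)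
          ⊆ : ∀ {S} → S ∈ Terms t′ → S ∈ Terms t
          ⊆ (j , S≈) = let i , eq = terms-match frame frame′ T≈ T≈′ j in
            i , λ k l m → trans (S≈ k l m) (trans (t′≈ j k l m) (eq k l m))
          ⊇ : ∀ {S} → S ∈ Terms t → S ∈ Terms t′
          ⊇ (i , S≈) = let j , eq = terms-match frame′ frame T≈′ T≈ i in
            j , λ k l m → trans (S≈ k l m) (trans (eq k l m) (sym (t′≈ j k l m)))

  -- Generic samples

  CharZero : Set
  CharZero = ∀ m → suc m ·ℕ 1# ≉ 0#

  module _ (char0 : CharZero) where
    charZero⇒3!≉0 : 3! ≉ 0#
    charZero⇒3!≉0 3!≈0 = char0 5 (trans
      (solve 1 (λ x → x :+ (x :+ (x :+ (x :+ (x :+ (x :+ con 0))))) := x :+ x :+ x :+ x :+ x :+ x) refl 1#) 3!≈0)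

    private
      <⇒≉ : ∀ {m n} → m ℕ.< n → m ·ℕ 1# ≉ n ·ℕ 1#
      <⇒≉ {m} {n} m<n eq with ℕ.m≤n⇒∃[o]m+o≡n m<n
      ... | d , ≡.refl = char0 d (+-cancelˡ (m ·ℕ 1#) _ _ (begin
        m ·ℕ 1# + suc d ·ℕ 1#  ≈⟨ ×-homo-+ 1# m (suc d) ⟨
        (m ℕ.+ suc d) ·ℕ 1#    ≈⟨ ×-congˡ (ℕ.+-suc m d) ⟩
        suc (m ℕ.+ d) ·ℕ 1#    ≈⟨ eq ⟨
        m ·ℕ 1#                ≈⟨ +-identityʳ _ ⟨
        m ·ℕ 1# + 0#           ∎))

    multiples-distinct : ∀ {m n} → m ≢ n → m ·ℕ 1# ≉ n ·ℕ 1#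
    multiples-distinct {m} {n} m≢n with ℕ.<-cmp m n
    ... | tri< m<n _ _ = <⇒≉ m<n
    ... | tri≈ _ m≡n _ = contradiction m≡n m≢n
    ... | tri> _ _ n<m = <⇒≉ n<m ∘ sym

  ∏ : ∀ {X m} → Vector (Polynomial X) m → Polynomial X
  ∏ {m = zero}  p = con 1#
  ∏ {m = suc m} p = p zero ⊗ ∏ (p ∘ suc)

  ∏-nonzero : ∀ {X m} (p : Vector (Polynomial X) m) x → (∀ i → eval (p i) x ≉ 0#) → eval (∏ p) x ≉ 0#
  ∏-nonzero {m = zero}  p x p≉0 = 1≉0
  ∏-nonzero {m = suc m} p x p≉0 = *-nonzero (p≉0 zero) (∏-nonzero (p ∘ suc) x (p≉0 ∘ suc))

  factorˡ-nonzero : ∀ {x y} → x * y ≉ 0# → x ≉ 0#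
  factorˡ-nonzero {x} {y} xy≉0 x≈0 = xy≉0 (trans (*-congʳ x≈0) (zeroˡ y))

  factorʳ-nonzero : ∀ {x y} → x * y ≉ 0# → y ≉ 0#
  factorʳ-nonzero {x} {y} xy≉0 y≈0 = xy≉0 (trans (*-congˡ y≈0) (zeroʳ x))

  ∏-nonzero⁻ : ∀ {X m} (p : Vector (Polynomial X) m) x → eval (∏ p) x ≉ 0# → ∀ i → eval (p i) x ≉ 0#
  ∏-nonzero⁻ p x ∏≉0 zero    = factorˡ-nonzero ∏≉0
  ∏-nonzero⁻ p x ∏≉0 (suc i) = ∏-nonzero⁻ (p ∘ suc) x (factorʳ-nonzero ∏≉0) i

  linear : ∀ {X n} → Vector X n → V n → Polynomial X
  linear {n = zero}  xs c = con 0#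
  linear {n = suc n} xs c = (var (xs zero) ⊗ con (c zero)) ⊕ linear (xs ∘ suc) (c ∘ suc)

  eval-linear : ∀ {X n} (xs : Vector X n) c x → eval (linear xs c) x ≈ pairing (x ∘ xs) c
  eval-linear {n = zero}  xs c x = refl
  eval-linear {n = suc n} xs c x = +-congˡ (eval-linear (xs ∘ suc) (c ∘ suc) x)

  _⊖_ : ∀ {X} → Polynomial X → Polynomial X → Polynomial X
  p ⊖ q = p ⊕ (con (- 1#) ⊗ q)

  eval-- : ∀ {X} (p q : Polynomial X) x → eval (p ⊖ q) x ≈ eval p x - eval q x
  eval-- p q x = +-congˡ (-1*x≈-x (eval q x))

  generic-nonzero : ∀ {X} (p : Polynomial X) (P : (X → Carrier) → Set) (x : X → Carrier) →
    eval p x ≉ 0# → (∀ x → eval p x ≉ 0# → P x) → Generic P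
  generic-nonzero p P x px≉0 p≉0⇒P =
    List.[ p ] , (x , λ { (px≈0 All.∷ All.[]) → px≉0 px≈0 }) , λ x x∉ → p≉0⇒P x λ px≈0 → x∉ (px≈0 All.∷ All.[])

  module GenericSamples (char0 : CharZero) where

    record GoodSample {n r} (a b : Vector (V n) r) (f g : V n) : Set where
      field
        fa≉0 : ∀ i → pairing f (a i) ≉ 0#
        ga≉0 : ∀ i → pairing g (a i) ≉ 0#
        ratios : ∀ {i j} → i ≢ j → pairing f (a i) * pairing g (a j) ≉ pairing f (a j) * pairing g (a i)
        nondegenerate : ∀ i → pairing f (b i) * pairing g (a i) ≉ pairing f (a i) * pairing g (b i)

    module _ {n r} {a b : Vector (V n) r} (frame : Frame a b) where
      open Frame frame using (cocombination; cocombination-a; cocombination-b)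

      private
        onF onG : V n → Polynomial (Fin 3 × Fin n)
        onF = linear (0F ,_)
        onG = linear (1F ,_)

        -- Pairs with i = j impose no condition and contribute the factor 1, so the product can run
        -- over all pairs. The decision is an argument so that proofs can split on it.
        ratio-polynomial : ∀ i j → Dec (i ≡ j) → Polynomial (Fin 3 × Fin n)
        ratio-polynomial i j (yes _) = con 1#
        ratio-polynomial i j (no _)  = (onF (a i) ⊗ onG (a j)) ⊖ (onF (a j) ⊗ onG (a i))

        -- `GoodSample` consists of finitely many nonvanishing conditions, so a single product has
        -- exactly the bad samples as its zeros.
        polynomial : Polynomial (Fin 3 × Fin n)
        polynomial = ∏ λ i → (onF (a i) ⊗ onG (a i)) ⊗
          (((onF (b i) ⊗ onG (a i)) ⊖ (onF (a i) ⊗ onG (b i))) ⊗ ∏ λ j → ratio-polynomial i j (i Fin.≟ j))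

        module At (x : Fin 3 × Fin n → Carrier) where
          f g : V n
          f i = x (0F , i)
          g i = x (1F , i)

          product : ∀ u v → eval (onF u ⊗ onG v) x ≈ pairing f u * pairing g v
          product u v = *-cong (eval-linear (0F ,_) u x) (eval-linear (1F ,_) v x)

          difference : ∀ u v w t → eval ((onF u ⊗ onG v) ⊖ (onF w ⊗ onG t)) x ≈ pairing f u * pairing g v - pairing f w * pairing g t
          difference u v w t = trans (eval-- (onF u ⊗ onG v) (onF w ⊗ onG t) x) (+-cong (product u v) (-‿cong (product w t)))

          difference≉0⇒≉ : ∀ u v w t → eval ((onF u ⊗ onG v) ⊖ (onF w ⊗ onG t)) x ≉ 0# → pairing f u * pairing g v ≉ pairing f w * pairing g t
          difference≉0⇒≉ u v w t ≉0 eq = ≉0 (trans (difference u v w t) (x≈y⇒x∙y⁻¹≈ε eq))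

          ≉⇒difference≉0 : ∀ u v w t → pairing f u * pairing g v ≉ pairing f w * pairing g t → eval ((onF u ⊗ onG v) ⊖ (onF w ⊗ onG t)) x ≉ 0#
          ≉⇒difference≉0 u v w t ≉ ≈0 = ≉ (x∙y⁻¹≈ε⇒x≈y _ _ (trans (sym (difference u v w t)) ≈0))

          good⇒nonzero : GoodSample a b f g → eval polynomial x ≉ 0#
          good⇒nonzero good = ∏-nonzero _ x λ i → *-nonzero
            (λ eq → *-nonzero (fa≉0 i) (ga≉0 i) (trans (sym (product (a i) (a i))) eq))
            (*-nonzero (≉⇒difference≉0 (b i) (a i) (a i) (b i) (nondegenerate i))
              (∏-nonzero _ x λ j → factor i j (i Fin.≟ j)))
            where
            open GoodSample good
            factor : ∀ i j d → eval (ratio-polynomial i j d) x ≉ 0#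
            factor i j (yes _)  = 1≉0
            factor i j (no i≢j) = ≉⇒difference≉0 (a i) (a j) (a j) (a i) (ratios i≢j)

          nonzero⇒good : eval polynomial x ≉ 0# → GoodSample a b f g
          nonzero⇒good nz = record
            { fa≉0 = λ i eq → factorˡ-nonzero (fg i) eq
            ; ga≉0 = λ i eq → factorʳ-nonzero (fg i) eq
            ; ratios = λ {i} {j} i≢j → factor i j (i Fin.≟ j) i≢j
                (∏-nonzero⁻ _ x (factorʳ-nonzero (factorʳ-nonzero (at i))) j)
            ; nondegenerate = λ i → difference≉0⇒≉ (b i) (a i) (a i) (b i) (factorˡ-nonzero (factorʳ-nonzero (at i)))
            }
            where
            at = ∏-nonzero⁻ _ x nz
            fg : ∀ i → pairing f (a i) * pairing g (a i) ≉ 0#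
            fg i eq = factorˡ-nonzero (at i) (trans (product (a i) (a i)) eq)
            factor : ∀ i j d → i ≢ j → eval (ratio-polynomial i j d) x ≉ 0# →
                     pairing f (a i) * pairing g (a j) ≉ pairing f (a j) * pairing g (a i)
            factor i j (yes i≡j) i≢j _ = contradiction i≡j i≢j
            factor i j (no _)    _ ≉0  = difference≉0⇒≉ (a i) (a j) (a j) (a i) ≉0

        -- The prescribed values are p_i(f₀) = i + 1, q_i(f₀) = 1, p_i(g₀) = 1 and q_i(g₀) = 0. The
        -- ratios become 1, 2, 3 and so on: distinct in characteristic zero, and nonzero thanks to
        -- the shift by one; `nondegenerate` becomes 1 ≠ 0.
        f₀ g₀ : V n
        f₀ = cocombination (λ i → suc (toℕ i) ·ℕ 1#) (λ _ → 1#)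
        g₀ = cocombination (λ _ → 1#) (λ _ → 0#)

        sample₀ : Fin 3 × Fin n → Carrier
        sample₀ (0F , i) = f₀ i
        sample₀ (1F , i) = g₀ i
        sample₀ (2F , i) = 0#

        f₀a : ∀ i → pairing f₀ (a i) ≈ suc (toℕ i) ·ℕ 1#
        f₀a = cocombination-a (λ i → suc (toℕ i) ·ℕ 1#) (λ _ → 1#)
        f₀b : ∀ i → pairing f₀ (b i) ≈ 1#
        f₀b = cocombination-b (λ i → suc (toℕ i) ·ℕ 1#) (λ _ → 1#)
        g₀a : ∀ i → pairing g₀ (a i) ≈ 1#
        g₀a = cocombination-a (λ _ → 1#) (λ _ → 0#)
        g₀b : ∀ i → pairing g₀ (b i) ≈ 0#
        g₀b = cocombination-b (λ _ → 1#) (λ _ → 0#)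

        good₀ : GoodSample a b f₀ g₀
        good₀ = record
          { fa≉0 = λ i eq → char0 (toℕ i) (trans (sym (f₀a i)) eq)
          ; ga≉0 = λ i eq → 1≉0 (trans (sym (g₀a i)) eq)
          ; ratios = λ {i} {j} i≢j eq → multiples-distinct char0 {suc (toℕ i)} {suc (toℕ j)}
              (i≢j ∘ toℕ-injective ∘ ℕ.suc-injective) (begin
              suc (toℕ i) ·ℕ 1# ≈⟨ product₀ i j ⟨
              pairing f₀ (a i) * pairing g₀ (a j) ≈⟨ eq ⟩
              pairing f₀ (a j) * pairing g₀ (a i) ≈⟨ product₀ j i ⟩
              suc (toℕ j) ·ℕ 1# ∎)
          ; nondegenerate = λ i eq → 1≉0 (begin
              1# ≈⟨ trans (*-cong (f₀b i) (g₀a i)) (*-identityˡ 1#) ⟨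
              pairing f₀ (b i) * pairing g₀ (a i) ≈⟨ eq ⟩
              pairing f₀ (a i) * pairing g₀ (b i) ≈⟨ trans (*-congˡ (g₀b i)) (zeroʳ _) ⟩
              0# ∎)
          }
          where
          product₀ : ∀ i j → pairing f₀ (a i) * pairing g₀ (a j) ≈ suc (toℕ i) ·ℕ 1#
          product₀ i j = trans (*-cong (f₀a i) (g₀a j)) (*-identityʳ _)

      good-samples-generic : ∀ {P : (Fin 3 × Fin n → Carrier) → Set} →
        (∀ x → GoodSample a b (λ i → x (0F , i)) (λ i → x (1F , i)) → P x) → Generic P
      good-samples-generic {P} good⇒P = generic-nonzero polynomial P sample₀ (At.good⇒nonzero sample₀ good₀)
        λ x nz → good⇒P x (At.nonzero⇒good x nz)

-- Passage from 𝕂 to ℂ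

record IsFieldEmbedding (K L : Field) (⟦_⟧ : Field.Carrier K → Field.Carrier L) : Set where
  private
    module K = Field K
    module L = Field L
  field
    ⟦⟧-cong : ∀ {x y} → x K.≈ y → ⟦ x ⟧ L.≈ ⟦ y ⟧
    +-homo : ∀ x y → ⟦ x K.+ y ⟧ L.≈ ⟦ x ⟧ L.+ ⟦ y ⟧
    *-homo : ∀ x y → ⟦ x K.* y ⟧ L.≈ ⟦ x ⟧ L.* ⟦ y ⟧
    0-homo : ⟦ K.0# ⟧ L.≈ L.0#
    1-homo : ⟦ K.1# ⟧ L.≈ L.1#

module Embedded {K L : Field} {⟦_⟧ : Field.Carrier K → Field.Carrier L} (φ : IsFieldEmbedding K L ⟦_⟧) where
  private
    module K where
      open Field K public
      open LinearAlgebra K public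
      open FieldTheory K public
      open RingProperties (Field.ring K) public using (x∙y⁻¹≈ε⇒x≈y)
    open Field L hiding (zero)
    open LinearAlgebra L
    open FieldTheory L
    open RingProperties ring using (+-cancelʳ)
    open Sum semiring using (sum; sum-cong-≋)
    open SetoidReasoning setoid
  open IsFieldEmbedding φ

  ⟦⟧-zero-injective : ∀ {x} → ⟦ x ⟧ ≈ 0# → x K.≈ K.0#
  ⟦⟧-zero-injective {x} eq with x K.≟ K.0#
  ... | yes x≈0 = x≈0
  ... | no  x≉0 = contradiction (begin
    1#                   ≈⟨ 1-homo ⟨
    ⟦ K.1# ⟧             ≈⟨ ⟦⟧-cong (K.inverseʳ x≉0) ⟨
    ⟦ x K.* x K.⁻¹ ⟧     ≈⟨ *-homo x (x K.⁻¹) ⟩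
    ⟦ x ⟧ * ⟦ x K.⁻¹ ⟧   ≈⟨ *-congʳ eq ⟩
    0# * ⟦ x K.⁻¹ ⟧      ≈⟨ zeroˡ _ ⟩
    0#                   ∎) 1≉0

  ⟦⟧-injective : ∀ {x y} → ⟦ x ⟧ ≈ ⟦ y ⟧ → x K.≈ y
  ⟦⟧-injective {x} {y} eq = K.x∙y⁻¹≈ε⇒x≈y x y (⟦⟧-zero-injective (+-cancelʳ ⟦ y ⟧ _ _ (begin
    ⟦ x K.- y ⟧ + ⟦ y ⟧     ≈⟨ +-homo (x K.- y) y ⟨
    ⟦ x K.- y K.+ y ⟧       ≈⟨ ⟦⟧-cong (K.trans (K.+-assoc _ _ _) (K.trans (K.+-congˡ (K.-‿inverseˡ y)) (K.+-identityʳ x))) ⟩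
    ⟦ x ⟧                   ≈⟨ eq ⟩
    ⟦ y ⟧                   ≈⟨ +-identityˡ _ ⟨
    0# + ⟦ y ⟧              ∎)))

  ·ℕ-homo : ∀ m → ⟦ m K.·ℕ K.1# ⟧ ≈ m ·ℕ 1#
  ·ℕ-homo zero    = 0-homo
  ·ℕ-homo (suc m) = trans (+-homo _ _) (+-cong 1-homo (·ℕ-homo m))

  char-zero : K.CharZero → CharZero
  char-zero char0 m eq = char0 m (⟦⟧-zero-injective (trans (·ℕ-homo (suc m)) eq))

  sum-homo : ∀ {n} (t : Vector K.Carrier n) → ⟦ K.sum-syntax n t ⟧ ≈ sum (⟦_⟧ ∘ t)
  sum-homo {zero}  t = 0-homo
  sum-homo {suc n} t = trans (+-homo _ _) (+-congˡ (sum-homo (t ∘ suc)))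

  pairing-homo : ∀ {n} (u v : K.V n) → ⟦ K.pairing u v ⟧ ≈ pairing (⟦_⟧ ∘ u) (⟦_⟧ ∘ v)
  pairing-homo u v = trans (sum-homo (λ i → u i K.* v i)) (sum-cong-≋ (λ i → *-homo (u i) (v i)))

  δ-homo : ∀ {n} (i j : Fin n) → ⟦ K.δ i j ⟧ ≈ δ i j
  δ-homo zero    zero    = 1-homo
  δ-homo zero    (suc j) = 0-homo
  δ-homo (suc i) zero    = 0-homo
  δ-homo (suc i) (suc j) = δ-homo i j

  frame-homo : ∀ {n r} {a b : Vector (K.V n) r} → K.Frame a b → Frame (λ i → ⟦_⟧ ∘ a i) (λ i → ⟦_⟧ ∘ b i)
  frame-homo {a = a} {b} frame = record
    { coframe = record
      { a* = λ i → ⟦_⟧ ∘ a* i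
      ; b* = λ i → ⟦_⟧ ∘ b* i
      ; complete = λ k l → trans
          (sym (trans (sum-homo (λ i → a i k K.* a* i l K.+ b i k K.* b* i l)) (sum-cong-≋ λ i → trans (+-homo _ _) (+-cong (*-homo (a i k) (a* i l)) (*-homo (b i k) (b* i l))))))
          (trans (⟦⟧-cong (complete k l)) (δ-homo k l))
      }
    ; a*a = λ i j → trans (sym (pairing-homo (a* i) (a j))) (trans (⟦⟧-cong (a*a i j)) (δ-homo i j))
    ; a*b = λ i j → trans (sym (pairing-homo (a* i) (b j))) (trans (⟦⟧-cong (a*b i j)) 0-homo)
    ; b*a = λ i j → trans (sym (pairing-homo (b* i) (a j))) (trans (⟦⟧-cong (b*a i j)) 0-homo)
    ; b*b = λ i j → trans (sym (pairing-homo (b* i) (b j))) (trans (⟦⟧-cong (b*b i j)) (δ-homo i j))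
    }
    where open K.Frame frame

  module _ (char0 : K.CharZero) where

    κ-homo : ⟦ K.κ ⟧ ≈ κ
    κ-homo = trans (*-homo _ _) (*-cong 3!⁻¹-homo (trans (+-homo _ _) (+-cong 1-homo 1-homo)))
      where
      3!-homo : ⟦ K.3! ⟧ ≈ 3!
      3!-homo = plus (plus (plus (plus (plus 1-homo))))
        where
        plus : ∀ {x y} → ⟦ x ⟧ ≈ y → ⟦ x K.+ K.1# ⟧ ≈ y + 1#
        plus eq = trans (+-homo _ _) (+-cong eq 1-homo)
      -- The total inverse is defined by a case split in each field, so the two inverses are
      -- compared after multiplication by `3!`.
      3!⁻¹-homo : ⟦ K.3! K.⁻¹ ⟧ ≈ 3! ⁻¹
      3!⁻¹-homo = *-cancelˡ (charZero⇒3!≉0 (char-zero char0)) (begin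
        3! * ⟦ K.3! K.⁻¹ ⟧        ≈⟨ *-congʳ 3!-homo ⟨
        ⟦ K.3! ⟧ * ⟦ K.3! K.⁻¹ ⟧  ≈⟨ *-homo _ _ ⟨
        ⟦ K.3! K.* K.3! K.⁻¹ ⟧    ≈⟨ ⟦⟧-cong (K.inverseʳ (K.charZero⇒3!≉0 char0)) ⟩
        ⟦ K.1# ⟧                  ≈⟨ 1-homo ⟩
        1#                        ≈⟨ inverseʳ (charZero⇒3!≉0 (char-zero char0)) ⟨
        3! * 3! ⁻¹                ∎)

    ²⊙-homo : ∀ {n} (a b : K.V n) i j k → ⟦ (a K.²⊙ b) i j k ⟧ ≈ ((⟦_⟧ ∘ a) ²⊙ (⟦_⟧ ∘ b)) i j k
    ²⊙-homo a b i j k = begin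
      ⟦ (a K.²⊙ b) i j k ⟧ ≈⟨ ⟦⟧-cong (K.²⊙-entry a b i j k) ⟩
      ⟦ K.κ K.* (a i K.* a j K.* b k K.+ a i K.* b j K.* a k K.+ b i K.* a j K.* a k) ⟧
        ≈⟨ trans (*-homo _ _) (*-cong κ-homo (trans (+-homo _ _) (+-cong (trans (+-homo _ _)
             (+-cong (triple (a i) (a j) (b k)) (triple (a i) (b j) (a k)))) (triple (b i) (a j) (a k))))) ⟩
      _ ≈⟨ ²⊙-entry (⟦_⟧ ∘ a) (⟦_⟧ ∘ b) i j k ⟨
      ((⟦_⟧ ∘ a) ²⊙ (⟦_⟧ ∘ b)) i j k ∎
      where
      triple : ∀ x y z → ⟦ x K.* y K.* z ⟧ ≈ ⟦ x ⟧ * ⟦ y ⟧ * ⟦ z ⟧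
      triple x y z = trans (*-homo _ _) (*-congʳ (*-homo x y))

    decomposition-homo : ∀ {n r} {T : K.Tensor n} {a b : Vector (K.V n) r} →
      T K.≈ᵀ K.∑ᵀ (λ i → a i K.²⊙ b i) →
      (λ i j k → ⟦ T i j k ⟧) ≈ᵀ ∑ᵀ (λ i → (⟦_⟧ ∘ a i) ²⊙ (⟦_⟧ ∘ b i))
    decomposition-homo {a = a} {b} T≈ i j k = trans (⟦⟧-cong (T≈ i j k))
      (trans (sum-homo (λ s → (a s K.²⊙ b s) i j k)) (sum-cong-≋ λ s → ²⊙-homo (a s) (b s) i j k))

    -- The excluded samples are cut out by a polynomial over `K`, while the run is over `L`. The
    -- frame and the decomposition are equations and map forward; the conditions on the sample are
    -- inequations and need the injectivity of the embedding.
    algorithm-generic : ∀ {n r} {T : K.Tensor n} {a b : Vector (K.V n) r} → K.Frame a b →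
      T K.≈ᵀ K.∑ᵀ (λ i → a i K.²⊙ b i) →
      Zariski.Generic K {Fin 3 × Fin n} λ x →
        Algorithm.algorithm L (λ i j k → ⟦ T i j k ⟧)
          (λ i → ⟦ x (0F , i) ⟧) (λ i → ⟦ x (1F , i) ⟧) (λ i → ⟦ x (2F , i) ⟧)
          λ {m} output → m ≡ r ×
            WTensors.Terms L output ≐ WTensors.Terms L (λ s i j k → ⟦ (a s K.²⊙ b s) i j k ⟧)
    algorithm-generic {n} {r} {T} {a} {b} frame T≈ = K.GenericSamples.good-samples-generic char0 frame λ x good →
      let open K.GenericSamples.GoodSample good
          f = λ i → x (0F , i)
          g = λ i → x (1F , i)
      in SixInvertible.Run.algorithm-correct (charZero⇒3!≉0 (char-zero char0))
           (frame-homo frame) (decomposition-homo {a = a} {b} T≈) (⟦_⟧ ∘ f) (⟦_⟧ ∘ g)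
           (λ i eq → fa≉0 i (⟦⟧-zero-injective (trans (pairing-homo f (a i)) eq)))
           (λ i eq → ga≉0 i (⟦⟧-zero-injective (trans (pairing-homo g (a i)) eq)))
           (λ {i} {j} i≢j eq → ratios i≢j (products f (a i) g (a j) f (a j) g (a i) eq))
           (λ i eq → nondegenerate i (products f (b i) g (a i) f (a i) g (b i) eq))
           (λ s i j k → ²⊙-homo (a s) (b s) i j k)
           (λ i → ⟦ x (2F , i) ⟧)
      where
      product-homo : ∀ (u v w t : K.V n) → ⟦ K.pairing u v K.* K.pairing w t ⟧ ≈
                     pairing (⟦_⟧ ∘ u) (⟦_⟧ ∘ v) * pairing (⟦_⟧ ∘ w) (⟦_⟧ ∘ t)
      product-homo u v w t = trans (*-homo _ _) (*-cong (pairing-homo u v) (pairing-homo w t))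
      products : ∀ (u v w t u′ v′ w′ t′ : K.V n) →
        pairing (⟦_⟧ ∘ u) (⟦_⟧ ∘ v) * pairing (⟦_⟧ ∘ w) (⟦_⟧ ∘ t) ≈
        pairing (⟦_⟧ ∘ u′) (⟦_⟧ ∘ v′) * pairing (⟦_⟧ ∘ w′) (⟦_⟧ ∘ t′) →
        K.pairing u v K.* K.pairing w t K.≈ K.pairing u′ v′ K.* K.pairing w′ t′
      products u v w t u′ v′ w′ t′ eq = ⟦⟧-injective
        (trans (product-homo u v w t) (trans eq (sym (product-homo u′ v′ w′ t′))))

-- Characteristic zero and the embedding of the scalars.

module _ (ℝ : RealNumbers) where
  open RealNumbers ℝ hiding (zero)
  open IsDecTotalOrder isDecTotalOrder using (total; antisym; ≤-respˡ-≈; ≤-respʳ-≈) renaming (refl to ≤-refl; trans to ≤-trans)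
  open RingProperties ring using (-1*x≈-x; -‿involutive)
  open Mult +-monoid using () renaming (_×_ to _·ℕ_)

  private
    0≤1 : 0# ≤ 1#
    0≤1 with total 0# 1#
    ... | inj₁ 0≤1 = 0≤1
    ... | inj₂ 1≤0 = ≤-respʳ-≈ (trans (-1*x≈-x (- 1#)) (-‿involutive 1#)) (*-nonNegative 0≤-1 0≤-1)
      where
      0≤-1 : 0# ≤ - 1#
      0≤-1 = ≤-respˡ-≈ (-‿inverseʳ 1#) (≤-respʳ-≈ (+-identityˡ _) (+-monoˡ-≤ (- 1#) 1≤0))

    1≤suc : ∀ m → 1# ≤ suc m ·ℕ 1#
    1≤suc zero    = ≤-respʳ-≈ (sym (+-identityʳ 1#)) ≤-refl
    1≤suc (suc m) = ≤-trans (1≤suc m) (≤-respˡ-≈ (+-identityˡ _) (+-monoˡ-≤ (suc m ·ℕ 1#) 0≤1))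

  -- The order gives 1 ≤ m + 1 for all m, so a vanishing multiple of 1 would yield 1 ≤ 0 ≤ 1.
  ℝ-charZero : FieldTheory.CharZero real-field
  ℝ-charZero m eq = 1≉0 (antisym (≤-respʳ-≈ eq (1≤suc m)) 0≤1)

  toℂ-embedding : (k : Scalars) → IsFieldEmbedding (scalarField ℝ k) (Complex.ℂ-field ℝ) (toℂ ℝ k)
  toℂ-embedding real = record
    { ⟦⟧-cong = λ x≈y → x≈y , refl
    ; +-homo  = λ x y → refl , sym (+-identityʳ 0#)
    ; *-homo  = λ x y →
        sym (trans (+-congˡ (trans (-‿cong (zeroˡ 0#)) -0#≈0#)) (+-identityʳ (x * y))) ,
        sym (trans (+-cong (zeroʳ x) (zeroˡ y)) (+-identityʳ 0#))
    ; 0-homo  = refl , refl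
    ; 1-homo  = refl , refl
    }
    where
    -0#≈0# : - 0# ≈ 0#
    -0#≈0# = trans (sym (+-identityˡ (- 0#))) (-‿inverseʳ 0#)
  toℂ-embedding complex = record
    { ⟦⟧-cong = id
    ; +-homo  = λ _ _ → ℂ.refl
    ; *-homo  = λ _ _ → ℂ.refl
    ; 0-homo  = ℂ.refl
    ; 1-homo  = ℂ.refl
    }
    where module ℂ = Field (Complex.ℂ-field ℝ)

  scalar-charZero : (k : Scalars) → FieldTheory.CharZero (scalarField ℝ k)
  scalar-charZero real    = ℝ-charZero
  scalar-charZero complex = Embedded.char-zero (toℂ-embedding real) ℝ-charZero

theorem4p5 : (ℝ : RealNumbers) (k : Scalars) → let open Setting ℝ k in
    (n r : ℕ) (T : Tensor n) (a₁ a₂ : Vector (V n) r) →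
    T ≈ᵀ ∑ᵀ (λ i → a₁ i ²⊙ a₂ i) →
    (∀ i → LinearlyIndependent (a₁ i ∷ a₂ i ∷ [])) →
    InDirectSum (λ i → ⟨ a₁ i , a₂ i ⟩) →
    WholeSpaceIsSum (λ i → ⟨ a₁ i , a₂ i ⟩) →
    IsUniqueMinimalWDecomposition T (λ i → a₁ i ²⊙ a₂ i) ×
    AlgorithmProduces T (λ i → a₁ i ²⊙ a₂ i)
theorem4p5 ℝ k n r T a₁ a₂ T≈ independent direct whole =
  FieldTheory.SixInvertible.unique-minimal K (FieldTheory.charZero⇒3!≉0 K char0) frame T≈ independent ,
  Embedded.algorithm-generic (toℂ-embedding ℝ k) char0 frame T≈
  where
  K = scalarField ℝ k
  char0 = scalar-charZero ℝ k
  frame = FieldTheory.direct-sum⇒frame K independent direct whole
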